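{- Fix integers $h\ge 2$ and $g\ge 1$. Let $k=k(n)\in[0,n]$ be arbitrary and let $\mathcal{C}\subseteq[n]$ be a random subset in which each element of $[n]$ is included independently with probability $p=k/n$. Then, as $n\to\infty$, \[ k=o\!\left(n^{\frac{g}{h(g+1)}}\right)\Rightarrow \mathbb{P}(\mathcal{C}\text{ is } B_h[g])\to 1, \] and \[ n^{\frac{g}{h(g+1)}}=o(k)\Rightarrow \mathbb{P}(\mathcal{C}\text{ is } B_h[g])\to 0. \]
   Context: For $h\ge 2$, $g\ge 1$, a set $\mathcal{A}\subseteq[n]$ has the $B_h[g]$ property if for every integer $m\in[h,nh]$ the equation $a_1+a_2+\dots+a_h=m$ with $a_1\le a_2\le\dots\le a_h$ and all $a_i\in\mathcal{A}$ has at most $g$ solutions.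
   Formalization: The function k(n) in [0,n] is taken to be rational-valued rather than real-valued, so the inclusion probability p = k/n is rational. -}

module Defs where

open import Data.Bool using (Bool; true; false)
open import Data.Nat as ℕ using (ℕ; zero; suc; _≤_; _≤?_)
open import Data.List using (List; []; _∷_; map; length; filter; _++_; concatMap; upTo; foldr)
open import Data.List.Relation.Unary.All using (All; all?)
open import Data.Vec using (Vec; []; _∷_)
open import Data.Nat.ListAction using (sum)
open import Data.Integer using (+_)
open import Data.Rational using (ℚ; 0ℚ; 1ℚ; _+_; _*_; _-_; _/_)
open import Relation.Nullary using (Dec; does)
open import Relation.Binary.PropositionalEquality using (_≡_)

-- All subsets of [n], encoded as characteristic vectors: entry i (0-based) is
-- true iff the integer i+1 belongs to the subset.
allSubsets : (n : ℕ) → List (Vec Bool n)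
allSubsets zero = [] ∷ []
allSubsets (suc n) = map (true ∷_) (allSubsets n) ++ map (false ∷_) (allSubsets n)

elemsFrom : ∀ {n} → ℕ → Vec Bool n → List ℕ
elemsFrom s [] = []
elemsFrom s (true ∷ v) = s ∷ elemsFrom (suc s) v
elemsFrom s (false ∷ v) = elemsFrom (suc s) v

elems : ∀ {n} → Vec Bool n → List ℕ
elems = elemsFrom 1

-- Multisets of size h drawn from a list of distinct elements, each given as a
-- nondecreasing list a₁ ≤ … ≤ a_h (the list of candidates is increasing).
msets : ℕ → List ℕ → List (List ℕ)
msets zero xs = [] ∷ []
msets (suc h) [] = []
msets (suc h) (x ∷ xs) = map (x ∷_) (msets h (x ∷ xs)) ++ msets (suc h) xs

solutions : ℕ → List ℕ → ℕ → ℕ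
solutions h xs m = length (filter (λ t → sum t ℕ.≟ m) (msets h xs))

range : ℕ → ℕ → List ℕ
range lo hi = map (lo ℕ.+_) (upTo (suc (hi ℕ.∸ lo)))

IsBhg : (h g n : ℕ) → Vec Bool n → Set
IsBhg h g n A = All (λ m → solutions h (elems A) m ≤ g) (range h (n ℕ.* h))

isBhg? : (h g n : ℕ) → (A : Vec Bool n) → Dec (IsBhg h g n A)
isBhg? h g n A = all? (λ m → solutions h (elems A) m ≤? g) (range h (n ℕ.* h))

weight : ∀ {n} → ℚ → Vec Bool n → ℚ
weight p [] = 1ℚ
weight p (true ∷ v) = p * weight p v
weight p (false ∷ v) = (1ℚ - p) * weight p v

probBhg : (h g n : ℕ) → ℚ → ℚ
probBhg h g n p = foldr (λ A acc → (if does (isBhg? h g n A) then weight p A else 0ℚ) + acc) 0ℚ (allSubsets n)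
  where
  if_then_else_ : {X : Set} → Bool → X → X → X
  if true then x else y = x
  if false then x else y = y

-- p = k / n (for n = 0 the value is irrelevant; we set it to 0).
pOf : ℕ → ℚ → ℚ
pOf zero k = 0ℚ
pOf (suc m) k = k * ((+ 1) / suc m)

_^ℚ_ : ℚ → ℕ → ℚ
q ^ℚ zero = 1ℚ
q ^ℚ suc e = q * (q ^ℚ e)

ℕ→ℚ : ℕ → ℚ
ℕ→ℚ n = (+ n) / 1

{-# OPTIONS --safe #-}

-- Sparse regime. If the property fails, the random set contains g + 1 distinct multisets of size h
-- with a common sum.  A family of ρ + 1 multisets with s distinct elements satisfies a homogeneous
-- linear system in these elements and the sum.  When the system has full rank, Gaussian elimination
-- bounds the number of placements by O(n^(s-ρ)), so the expected number of families in the random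
-- set is O(k^s / n^ρ), which vanishes as soon as g s ≤ h (g + 1) ρ.  This holds for the whole family
-- when it has full rank.  Otherwise split an integer dependency by signs, Σ a_i v_i = Σ b_j w_j: both
-- sides have the same support and the same total weight, so the support has at most h·min(#v, #w)
-- elements, and dropping one multiset leaves a smaller family with s ≤ h ρ, which is treated in the
-- same way.
--
-- Dense regime. Count only families in which each of the h (g + 1) elements has its own residue
-- class modulo a constant; then two families can share elements only in equal positions, and the
-- rows of a family are independent given the common sum.  With L ~ n quotients per class, z = L p
-- and μ = p z^(h-1), the mean is L μ^(g+1), two sums have correlation at most μ² (1 + O(1/z)) plus μ
-- if they coincide, and Chebyshev's inequality applies as soon as z, L and L μ^(g+1) tend to
-- infinity, which is what the hypothesis on k gives.

module Submission where

open import Defs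
open import Data.Bool using (Bool; true; false)
import Data.Nat as ℕ
open import Data.Nat using (ℕ; _≥_; zero; suc)
import Data.Nat.Properties as ℕₚ
import Data.Nat.DivMod as DivMod
open import Data.Nat.ListAction using () renaming (sum to sumℕ)
open import Data.Nat.ListAction.Properties using (sum-↭)
import Data.Nat.Solver as ℕSolver
import Data.Integer as ℤ
open import Data.Integer using (ℤ; 0ℤ; 1ℤ) renaming (+_ to pos)
import Data.Integer.Properties as ℤₚ
import Data.Integer.Solver as ℤSolver
import Algebra.Properties.AbelianGroup ℤₚ.+-0-abelianGroup as ℤGroup
open import Algebra.Properties.Semiring.Sum ℤₚ.+-*-semiring using (sum; sum-remove; sum-cong-≗; ∑-distrib-+; *-distribˡ-sum; *-distribʳ-sum; sum-replicate-zero)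
open import Data.Fin using (Fin; zero; suc; punchIn)
import Data.Fin.Properties as Finₚ
open import Data.Product using (_×_; ∃-syntax; Σ-syntax; _,_; proj₁; proj₂)
open import Data.Sum using (_⊎_; inj₁; inj₂)
open import Data.Empty using (⊥; ⊥-elim)
open import Data.Vec using (Vec; []; _∷_; head; tail; lookup; zipWith)
import Data.Vec as Vec
open import Data.Vec.Functional using (insertAt)
open import Data.Vec.Functional.Properties using (insertAt-lookup; insertAt-punchIn)
open import Data.Vec.Properties using (lookup-zipWith; lookup-map; lookup∘tabulate; toList∘fromList; length-toList)
open import Data.List using (List; []; _∷_; map; foldr; _++_; length; upTo; concat; deduplicate; tabulate; filter; take; cartesianProductWith)
import Data.List as List
open import Data.List.Properties using (length-upTo; length-++; length-map; length-take; length-applyUpTo; ∷-injectiveʳ; map-tabulate; tabulate-lookup)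
open import Data.List.Membership.Propositional using (_∈_; _∉_; find; lose)
open import Data.List.Membership.Propositional.Properties hiding (finite)
open import Data.List.Relation.Unary.Any as Any using (Any; here; there)
open import Data.List.Relation.Unary.All as All using (All; []; _∷_)
open import Data.List.Relation.Unary.AllPairs as AllPairs using ([]; _∷_)
open import Data.List.Relation.Unary.Unique.Propositional using (Unique)
open import Data.List.Relation.Unary.Unique.DecPropositional ℕ._≟_ using (unique?)
import Data.List.Relation.Unary.All.Properties as Allₚ
import Data.List.Relation.Unary.AllPairs.Properties as AllPairsₚ
import Data.List.Relation.Unary.Unique.Propositional.Properties as Unique
open import Data.List.Relation.Binary.Permutation.Propositional using (_↭_; ↭-refl; ↭-sym; ↭-trans; ↭-prep; ↭-swap; ↭⇒↭ₛ)
import Data.List.Relation.Binary.Permutation.Propositional.Properties as Perm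
import Data.List.Relation.Binary.Permutation.Setoid.Properties as SetoidPerm
open import Data.List.Relation.Binary.Sublist.Propositional using (_⊆_; ⊆-refl; []; _∷ʳ_; _∷_)
import Data.List.Relation.Binary.Sublist.Propositional.Properties as Sublist
open import Data.List.Relation.Unary.Unique.DecPropositional.Properties using (deduplicate-!)
open import Data.Rational using (ℚ; mkℚ; 0ℚ; 1ℚ; _≤_; _<_; _+_; _*_; _-_; -_; _/_; nonNegative; positive; ↥_; ↧_; *≤*)
open import Data.Rational.Properties hiding (_≟_; _≤?_; _<?_)
open import Data.Rational.Solver using (module +-*-Solver)
open import Relation.Nullary using (Dec; does; yes; no; ¬_; _×-dec_)
open import Relation.Binary.PropositionalEquality
open import Function using (_∘_)
open +-*-Solver using (solve; _:=_; _:+_; _:*_; :-_; con; _:-_)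

-- The inequality g s ≤ h (g + 1) ρ is what the hypothesis can pay for: when k ≥ 1, the g-th power
-- of k^s / n^ρ is at most the ρ-th power of k^(h (g + 1)) / n^g. Working with these powers also
-- avoids the fractional exponent g / (h (g + 1)). Elimination is kept free of division because the
-- sign split needs integer coefficients: only natural weights on both sides make a balanced
-- relation comparable with multiplicities.
--
-- In the dense regime the obstacle is the covariance of overlapping families. Fixing a residue
-- class for each position limits the overlaps and costs only a constant factor in the mean, since
-- the modulus depends on h and g alone. A single small number t controls every error there: z, L
-- and L μ^(g+1) are each made at least 1/t, and the probability of the property is then at most a
-- constant times t.

private variable
  X Y : Set

-- ordered field

*-monoˡ : ∀ {r a b} → 0ℚ ≤ r → a ≤ b → r * a ≤ r * b
*-monoˡ {r} 0≤r = *-monoˡ-≤-nonNeg r {{nonNegative 0≤r}}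

*-monoʳ : ∀ {r a b} → 0ℚ ≤ r → a ≤ b → a * r ≤ b * r
*-monoʳ {r} 0≤r = *-monoʳ-≤-nonNeg r {{nonNegative 0≤r}}

0≤* : ∀ {a b} → 0ℚ ≤ a → 0ℚ ≤ b → 0ℚ ≤ a * b
0≤* {a} {b} 0≤a 0≤b = subst (_≤ a * b) (*-zeroʳ a) (*-monoˡ 0≤a 0≤b)

0<* : ∀ {a b} → 0ℚ < a → 0ℚ < b → 0ℚ < a * b
0<* {a} {b} 0<a 0<b = subst (_< a * b) (*-zeroʳ a) (*-monoʳ-<-pos a {{positive 0<a}} 0<b)

0≤+ : ∀ {a b} → 0ℚ ≤ a → 0ℚ ≤ b → 0ℚ ≤ a + b
0≤+ {a} {b} 0≤a 0≤b = subst (_≤ a + b) (+-identityʳ 0ℚ) (+-mono-≤ 0≤a 0≤b)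

*-mono : ∀ {a b c d} → 0ℚ ≤ a → 0ℚ ≤ c → a ≤ b → c ≤ d → a * c ≤ b * d
*-mono 0≤a 0≤c a≤b c≤d = ≤-trans (*-monoʳ 0≤c a≤b) (*-monoˡ (≤-trans 0≤a a≤b) c≤d)

0<1 : 0ℚ < 1ℚ
0<1 = positive⁻¹ 1ℚ

0≤1 : 0ℚ ≤ 1ℚ
0≤1 = <⇒≤ 0<1

a≤a+b : ∀ {a b} → 0ℚ ≤ b → a ≤ a + b
a≤a+b {a} {b} 0≤b = subst (_≤ a + b) (+-identityʳ a) (+-monoʳ-≤ a 0≤b)

b≤a+b : ∀ {a b} → 0ℚ ≤ a → b ≤ a + b
b≤a+b {a} {b} 0≤a = subst (_≤ a + b) (+-identityˡ b) (+-monoˡ-≤ b 0≤a)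

0≤b-a : ∀ {a b} → a ≤ b → 0ℚ ≤ b - a
0≤b-a {a} {b} a≤b = subst (_≤ b - a) (+-inverseʳ a) (+-monoˡ-≤ (- a) a≤b)

0≤square : ∀ a → 0ℚ ≤ a * a
0≤square a with ≤-total 0ℚ a
... | inj₁ 0≤a = 0≤* 0≤a 0≤a
... | inj₂ a≤0 = subst (0ℚ ≤_) (solve 1 (λ x → (:- x) :* (:- x) := x :* x) refl a) (0≤* 0≤-a 0≤-a)
  where
  0≤-a : 0ℚ ≤ - a
  0≤-a = subst (_≤ - a) refl (neg-antimono-≤ a≤0)

*-cancelʳ : ∀ {a b r} → 0ℚ < r → a * r ≤ b * r → a ≤ b
*-cancelʳ {r = r} 0<r = *-cancelʳ-≤-pos r {{positive 0<r}}

inverse : ∀ {a} → 0ℚ < a → ∃[ b ] (0ℚ < b × a * b ≡ 1ℚ)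
inverse {a} 0<a = b , 0<b , *-inverseʳ a
  where
  instance
    a-pos = positive 0<a
    a≢0 = pos⇒nonZero a
  b = Data.Rational.1/ a
  0<b : 0ℚ < b
  0<b = positive⁻¹ b {{1/pos⇒pos a}}

-- powers

^-+ : ∀ q a b → q ^ℚ (a ℕ.+ b) ≡ q ^ℚ a * q ^ℚ b
^-+ q zero b = sym (*-identityˡ _)
^-+ q (suc a) b = trans (cong (q *_) (^-+ q a b)) (sym (*-assoc q _ _))

^-distrib-* : ∀ a b n → (a * b) ^ℚ n ≡ a ^ℚ n * b ^ℚ n
^-distrib-* a b zero = refl
^-distrib-* a b (suc n) = trans (cong (a * b *_) (^-distrib-* a b n))
  (solve 4 (λ a b x y → (a :* b) :* (x :* y) := (a :* x) :* (b :* y)) refl a b (a ^ℚ n) (b ^ℚ n))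

1^ : ∀ n → 1ℚ ^ℚ n ≡ 1ℚ
1^ zero = refl
1^ (suc n) = trans (*-identityˡ _) (1^ n)

^-* : ∀ q a b → q ^ℚ (a ℕ.* b) ≡ (q ^ℚ a) ^ℚ b
^-* q zero b = sym (1^ b)
^-* q (suc a) b = trans (^-+ q b (a ℕ.* b)) (trans (cong (q ^ℚ b *_) (^-* q a b)) (sym (^-distrib-* q (q ^ℚ a) b)))

0≤^ : ∀ {q} n → 0ℚ ≤ q → 0ℚ ≤ q ^ℚ n
0≤^ zero 0≤q = 0≤1
0≤^ (suc n) 0≤q = 0≤* 0≤q (0≤^ n 0≤q)

0<^ : ∀ {q} n → 0ℚ < q → 0ℚ < q ^ℚ n
0<^ zero 0<q = 0<1
0<^ (suc n) 0<q = 0<* 0<q (0<^ n 0<q)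

^-mono : ∀ {a b} n → 0ℚ ≤ a → a ≤ b → a ^ℚ n ≤ b ^ℚ n
^-mono zero 0≤a a≤b = ≤-refl
^-mono (suc n) 0≤a a≤b = *-mono 0≤a (0≤^ n 0≤a) a≤b (^-mono n 0≤a a≤b)

^-mono-< : ∀ {a b} n → 0ℚ ≤ a → a < b → a ^ℚ suc n < b ^ℚ suc n
^-mono-< {a} {b} n 0≤a a<b = ≤-<-trans (*-monoˡ 0≤a (^-mono n 0≤a (<⇒≤ a<b)))
  (*-monoˡ-<-pos (b ^ℚ n) {{positive (0<^ n (≤-<-trans 0≤a a<b))}} a<b)

^-cancel-≤ : ∀ {a b} n → 0ℚ ≤ b → a ^ℚ suc n ≤ b ^ℚ suc n → a ≤ b
^-cancel-≤ n 0≤b le = ≮⇒≥ (λ b<a → <-irrefl refl (<-≤-trans (^-mono-< n 0≤b b<a) le))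

1≤^ : ∀ {q} n → 1ℚ ≤ q → 1ℚ ≤ q ^ℚ n
1≤^ {q} n 1≤q = subst (_≤ q ^ℚ n) (1^ n) (^-mono n 0≤1 1≤q)

^≤1 : ∀ {q} n → 0ℚ ≤ q → q ≤ 1ℚ → q ^ℚ n ≤ 1ℚ
^≤1 {q} n 0≤q q≤1 = subst (q ^ℚ n ≤_) (1^ n) (^-mono n 0≤q q≤1)

^-monoᵉ : ∀ {q a b} → 1ℚ ≤ q → a ℕ.≤ b → q ^ℚ a ≤ q ^ℚ b
^-monoᵉ {q} {b = b} 1≤q ℕ.z≤n = 1≤^ b 1≤q
^-monoᵉ 1≤q (ℕ.s≤s a≤b) = *-monoˡ (≤-trans 0≤1 1≤q) (^-monoᵉ 1≤q a≤b)

-- the embedding of ℕ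

ℕ→ℚ-+ : ∀ a b → ℕ→ℚ (a ℕ.+ b) ≡ ℕ→ℚ a + ℕ→ℚ b
ℕ→ℚ-+ a b = toℚᵘ-injective (begin
  toℚᵘ (ℕ→ℚ (a ℕ.+ b)) ≈⟨ toℚᵘ-fromℚᵘ (mkℚᵘ (pos (a ℕ.+ b)) 0) ⟩
  mkℚᵘ (pos (a ℕ.+ b)) 0 ≈⟨ ℚᵘ.*≡* (cong (ℤ._* (pos 1)) (trans (ℤₚ.pos-+ a b) (sym (cong₂ ℤ._+_ (ℤₚ.*-identityʳ (pos a)) (ℤₚ.*-identityʳ (pos b)))))) ⟩
  mkℚᵘ (pos a) 0 ℚᵘ.+ mkℚᵘ (pos b) 0 ≈⟨ ℚᵘₚ.+-cong (toℚᵘ-fromℚᵘ (mkℚᵘ (pos a) 0)) (toℚᵘ-fromℚᵘ (mkℚᵘ (pos b) 0)) ⟨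
  toℚᵘ (ℕ→ℚ a) ℚᵘ.+ toℚᵘ (ℕ→ℚ b) ≈⟨ toℚᵘ-homo-+ (ℕ→ℚ a) (ℕ→ℚ b) ⟨
  toℚᵘ (ℕ→ℚ a + ℕ→ℚ b) ∎)
  where
  import Data.Rational.Unnormalised as ℚᵘ
  import Data.Rational.Unnormalised.Properties as ℚᵘₚ
  open import Data.Rational.Unnormalised using (mkℚᵘ)
  open import Data.Rational using (toℚᵘ; fromℚᵘ)
  open ℚᵘₚ.≃-Reasoning

ℕ→ℚ-suc : ∀ a → ℕ→ℚ (suc a) ≡ 1ℚ + ℕ→ℚ a
ℕ→ℚ-suc = ℕ→ℚ-+ 1

ℕ→ℚ-* : ∀ a b → ℕ→ℚ (a ℕ.* b) ≡ ℕ→ℚ a * ℕ→ℚ b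
ℕ→ℚ-* zero b = sym (*-zeroˡ (ℕ→ℚ b))
ℕ→ℚ-* (suc a) b = trans (ℕ→ℚ-+ b (a ℕ.* b)) (trans (cong (ℕ→ℚ b +_) (ℕ→ℚ-* a b))
  (trans (solve 2 (λ a b → b :+ a :* b := (con 1ℚ :+ a) :* b) refl (ℕ→ℚ a) (ℕ→ℚ b)) (cong (_* ℕ→ℚ b) (sym (ℕ→ℚ-suc a)))))

0≤ℕ→ℚ : ∀ a → 0ℚ ≤ ℕ→ℚ a
0≤ℕ→ℚ zero = ≤-refl
0≤ℕ→ℚ (suc a) = subst (0ℚ ≤_) (sym (ℕ→ℚ-suc a)) (0≤+ 0≤1 (0≤ℕ→ℚ a))

ℕ→ℚ-mono : ∀ {a b} → a ℕ.≤ b → ℕ→ℚ a ≤ ℕ→ℚ b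
ℕ→ℚ-mono {a} a≤b with ℕₚ.m≤n⇒∃[o]m+o≡n a≤b
... | o , refl = subst (ℕ→ℚ a ≤_) (sym (ℕ→ℚ-+ a o)) (a≤a+b (0≤ℕ→ℚ o))

0<ℕ→ℚ-suc : ∀ a → 0ℚ < ℕ→ℚ (suc a)
0<ℕ→ℚ-suc a = <-≤-trans 0<1 (ℕ→ℚ-mono {1} {suc a} (ℕ.s≤s ℕ.z≤n))

archimedes : ∀ q → ∃[ N ] (∀ n → n ≥ N → q ≤ ℕ→ℚ n)
archimedes q = ℤ.∣ ↥ q ∣ , λ n n≥N → ≤-trans q≤N (ℕ→ℚ-mono n≥N)
  where
  N = ℤ.∣ ↥ q ∣
  eq : mkℚ (pos N) 0 _ ≡ ℕ→ℚ N
  eq = sym (↥p/↧p≡p (mkℚ (pos N) 0 (Data.Nat.Coprimality.sym (Data.Nat.Coprimality.1-coprimeTo N))))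
    where import Data.Nat.Coprimality
  q≤N : q ≤ ℕ→ℚ N
  q≤N = subst (q ≤_) eq (*≤* (ℤₚ.≤-trans (ℤₚ.≤-reflexive (ℤₚ.*-identityʳ (↥ q))) (le q)))
    where
    le : ∀ q → ↥ q ℤ.≤ (pos (ℤ.∣ ↥ q ∣)) ℤ.* ↧ q
    le (mkℚ (pos a) d _) = subst (pos a ℤ.≤_) (ℤₚ.pos-* a (suc d)) (ℤ.+≤+ (ℕₚ.m≤m*n a (suc d)))
    le (mkℚ (ℤ.-[1+ a ]) d _) = ℤₚ.≤-trans ℤ.-≤+ (ℤₚ.≤-reflexive (ℤₚ.pos-* (suc a) (suc d)))

-- finite sums

∑ : List X → (X → ℚ) → ℚ
∑ [] f = 0ℚ
∑ (x ∷ xs) f = f x + ∑ xs f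

∑-cong∈ : ∀ (xs : List X) {f g : X → ℚ} → (∀ {x} → x ∈ xs → f x ≡ g x) → ∑ xs f ≡ ∑ xs g
∑-cong∈ [] eq = refl
∑-cong∈ (x ∷ xs) eq = cong₂ _+_ (eq (here refl)) (∑-cong∈ xs (eq ∘ there))

∑-cong : ∀ (xs : List X) {f g : X → ℚ} → (∀ x → f x ≡ g x) → ∑ xs f ≡ ∑ xs g
∑-cong xs eq = ∑-cong∈ xs (λ {x} _ → eq x)

∑-mono∈ : ∀ (xs : List X) {f g : X → ℚ} → (∀ {x} → x ∈ xs → f x ≤ g x) → ∑ xs f ≤ ∑ xs g
∑-mono∈ [] le = ≤-refl
∑-mono∈ (x ∷ xs) le = +-mono-≤ (le (here refl)) (∑-mono∈ xs (le ∘ there))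

∑-mono : ∀ (xs : List X) {f g : X → ℚ} → (∀ x → f x ≤ g x) → ∑ xs f ≤ ∑ xs g
∑-mono xs le = ∑-mono∈ xs (λ {x} _ → le x)

∑-zero : ∀ (xs : List X) → ∑ xs (λ _ → 0ℚ) ≡ 0ℚ
∑-zero [] = refl
∑-zero (x ∷ xs) = trans (+-identityˡ _) (∑-zero xs)

0≤∑ : ∀ (xs : List X) {f : X → ℚ} → (∀ x → 0ℚ ≤ f x) → 0ℚ ≤ ∑ xs f
0≤∑ xs {f} 0≤f = subst (_≤ ∑ xs f) (∑-zero xs) (∑-mono xs 0≤f)

∑-+ : ∀ (xs : List X) (f g : X → ℚ) → ∑ xs (λ x → f x + g x) ≡ ∑ xs f + ∑ xs g
∑-+ [] f g = refl
∑-+ (x ∷ xs) f g = trans (cong (f x + g x +_) (∑-+ xs f g))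
  (solve 4 (λ a b c d → (a :+ b) :+ (c :+ d) := (a :+ c) :+ (b :+ d)) refl (f x) (g x) (∑ xs f) (∑ xs g))

∑-*ˡ : ∀ (xs : List X) c (f : X → ℚ) → ∑ xs (λ x → c * f x) ≡ c * ∑ xs f
∑-*ˡ [] c f = sym (*-zeroʳ c)
∑-*ˡ (x ∷ xs) c f = trans (cong (c * f x +_) (∑-*ˡ xs c f)) (sym (*-distribˡ-+ c (f x) (∑ xs f)))

∑-*ʳ : ∀ (xs : List X) c (f : X → ℚ) → ∑ xs (λ x → f x * c) ≡ ∑ xs f * c
∑-*ʳ xs c f = trans (∑-cong xs (λ x → *-comm (f x) c)) (trans (∑-*ˡ xs c f) (*-comm c (∑ xs f)))

∑-const : ∀ (xs : List X) c → ∑ xs (λ _ → c) ≡ ℕ→ℚ (length xs) * c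
∑-const [] c = sym (*-zeroˡ c)
∑-const (x ∷ xs) c = trans (cong (c +_) (∑-const xs c))
  (trans (solve 2 (λ a c → c :+ a :* c := (con 1ℚ :+ a) :* c) refl (ℕ→ℚ (length xs)) c) (cong (_* c) (sym (ℕ→ℚ-suc (length xs)))))

∑-comm : ∀ (xs : List X) (ys : List Y) (f : X → Y → ℚ) → ∑ xs (λ x → ∑ ys (f x)) ≡ ∑ ys (λ y → ∑ xs (λ x → f x y))
∑-comm [] ys f = sym (∑-zero ys)
∑-comm (x ∷ xs) ys f = trans (cong (∑ ys (f x) +_) (∑-comm xs ys f)) (sym (∑-+ ys (f x) (λ y → ∑ xs (λ x → f x y))))

∑-* : ∀ (xs : List X) (ys : List Y) (f : X → ℚ) (g : Y → ℚ) → ∑ xs f * ∑ ys g ≡ ∑ xs (λ x → ∑ ys (λ y → f x * g y))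
∑-* xs ys f g = trans (sym (∑-*ʳ xs (∑ ys g) f)) (∑-cong xs (λ x → sym (∑-*ˡ ys (f x) g)))

∈⇒≤∑ : ∀ {xs : List X} {f : X → ℚ} → (∀ x → 0ℚ ≤ f x) → ∀ {x} → x ∈ xs → f x ≤ ∑ xs f
∈⇒≤∑ {xs = y ∷ xs} 0≤f (here refl) = a≤a+b (0≤∑ xs 0≤f)
∈⇒≤∑ {xs = y ∷ xs} 0≤f (there x∈) = ≤-trans (∈⇒≤∑ 0≤f x∈) (b≤a+b (0≤f y))

-- expectation over a random subset

E : ∀ {n} → ℚ → (Vec Bool n → ℚ) → ℚ
E {zero} p f = f []
E {suc n} p f = p * E p (f ∘ (true ∷_)) + (1ℚ - p) * E p (f ∘ (false ∷_))

𝟙 : Bool → ℚ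
𝟙 true = 1ℚ
𝟙 false = 0ℚ

0≤𝟙 : ∀ b → 0ℚ ≤ 𝟙 b
0≤𝟙 true = 0≤1
0≤𝟙 false = ≤-refl

E-cong : ∀ {n} p {f g : Vec Bool n → ℚ} → (∀ A → f A ≡ g A) → E p f ≡ E p g
E-cong {zero} p eq = eq []
E-cong {suc n} p eq = cong₂ _+_ (cong (p *_) (E-cong p (eq ∘ (true ∷_)))) (cong ((1ℚ - p) *_) (E-cong p (eq ∘ (false ∷_))))

E-+ : ∀ {n} p (f g : Vec Bool n → ℚ) → E p (λ A → f A + g A) ≡ E p f + E p g
E-+ {zero} p f g = refl
E-+ {suc n} p f g = trans (cong₂ (λ x y → p * x + (1ℚ - p) * y) (E-+ p (f ∘ (true ∷_)) (g ∘ (true ∷_))) (E-+ p (f ∘ (false ∷_)) (g ∘ (false ∷_))))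
  (solve 6 (λ p q a b c d → p :* (a :+ b) :+ q :* (c :+ d) := (p :* a :+ q :* c) :+ (p :* b :+ q :* d)) refl p (1ℚ - p)
    (E p (f ∘ (true ∷_))) (E p (g ∘ (true ∷_))) (E p (f ∘ (false ∷_))) (E p (g ∘ (false ∷_))))

E-*ˡ : ∀ {n} p c (f : Vec Bool n → ℚ) → E p (λ A → c * f A) ≡ c * E p f
E-*ˡ {zero} p c f = refl
E-*ˡ {suc n} p c f = trans (cong₂ (λ x y → p * x + (1ℚ - p) * y) (E-*ˡ p c (f ∘ (true ∷_))) (E-*ˡ p c (f ∘ (false ∷_))))
  (solve 5 (λ p q c a b → p :* (c :* a) :+ q :* (c :* b) := c :* (p :* a :+ q :* b)) refl p (1ℚ - p) c (E p (f ∘ (true ∷_))) (E p (f ∘ (false ∷_))))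

E-const : ∀ {n} p c → E {n} p (λ _ → c) ≡ c
E-const {zero} p c = refl
E-const {suc n} p c = trans (cong₂ (λ x y → p * x + (1ℚ - p) * y) (E-const {n} p c) (E-const {n} p c))
  (solve 2 (λ p c → p :* c :+ (con 1ℚ :- p) :* c := c) refl p c)

E-∑ : ∀ {n} p (xs : List X) (f : X → Vec Bool n → ℚ) → E p (λ A → ∑ xs (λ x → f x A)) ≡ ∑ xs (λ x → E p (f x))
E-∑ {n = n} p [] f = E-const {n} p 0ℚ
E-∑ p (x ∷ xs) f = trans (E-+ p (f x) (λ A → ∑ xs (λ x → f x A))) (cong (E p (f x) +_) (E-∑ p xs f))

record Probability (p : ℚ) : Set where
  constructor prob
  field
    0≤p : 0ℚ ≤ p
    p≤1 : p ≤ 1ℚ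

open Probability

E-mono : ∀ {n p} → Probability p → {f g : Vec Bool n → ℚ} → (∀ A → f A ≤ g A) → E p f ≤ E p g
E-mono {zero} P le = le []
E-mono {suc n} P le = +-mono-≤ (*-monoˡ (0≤p P) (E-mono P (le ∘ (true ∷_)))) (*-monoˡ (0≤b-a (p≤1 P)) (E-mono P (le ∘ (false ∷_))))

0≤E : ∀ {n p} → Probability p → {f : Vec Bool n → ℚ} → (∀ A → 0ℚ ≤ f A) → 0ℚ ≤ E p f
0≤E {n} {p} P {f} 0≤f = subst (_≤ E p f) (E-const {n} p 0ℚ) (E-mono P 0≤f)

-- probBhg as an expectation

∑-++ : ∀ (xs ys : List X) (f : X → ℚ) → ∑ (xs ++ ys) f ≡ ∑ xs f + ∑ ys f
∑-++ [] ys f = sym (+-identityˡ _)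
∑-++ (x ∷ xs) ys f = trans (cong (f x +_) (∑-++ xs ys f)) (sym (+-assoc (f x) _ _))

∑-map : ∀ (h : X → Y) xs (f : Y → ℚ) → ∑ (map h xs) f ≡ ∑ xs (f ∘ h)
∑-map h [] f = refl
∑-map h (x ∷ xs) f = cong (f (h x) +_) (∑-map h xs f)

∑-allSubsets : ∀ n p (f : Vec Bool n → ℚ) → ∑ (allSubsets n) (λ A → weight p A * f A) ≡ E p f
∑-allSubsets zero p f = trans (+-identityʳ _) (*-identityˡ (f []))
∑-allSubsets (suc n) p f = begin
  ∑ (map (true ∷_) As ++ map (false ∷_) As) w ≡⟨ ∑-++ (map (true ∷_) As) _ w ⟩
  ∑ (map (true ∷_) As) w + ∑ (map (false ∷_) As) w ≡⟨ cong₂ _+_ (∑-map (true ∷_) As w) (∑-map (false ∷_) As w) ⟩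
  ∑ As (λ A → p * weight p A * f (true ∷ A)) + ∑ As (λ A → (1ℚ - p) * weight p A * f (false ∷ A))
    ≡⟨ cong₂ _+_ (half p true) (half (1ℚ - p) false) ⟩
  E p f ∎
  where
  open ≡-Reasoning
  As = allSubsets n
  w = λ A → weight p A * f A
  half : ∀ c b → ∑ As (λ A → c * weight p A * f (b ∷ A)) ≡ c * E p (f ∘ (b ∷_))
  half c b = trans (∑-cong As (λ A → *-assoc c (weight p A) (f (b ∷ A))))
    (trans (∑-*ˡ As c _) (cong (c *_) (∑-allSubsets n p (f ∘ (b ∷_)))))

private
  foldrStep : ∀ {x : ℚ} {xs : List X} {step : X → ℚ → ℚ} → x ≡ foldr step 0ℚ xs → X → ℚ → ℚ
  foldrStep {step = step} _ = step

  -- The conditional in probBhg is local to Defs, so the summand is recovered by unification.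
  probBhgStep : ∀ h g n p → Vec Bool n → ℚ → ℚ
  probBhgStep h g n p = foldrStep {xs = allSubsets n} (refl {x = probBhg h g n p})

  probBhgStep-≡ : ∀ h g n p A acc → probBhgStep h g n p A acc ≡ weight p A * 𝟙 (does (isBhg? h g n A)) + acc
  probBhgStep-≡ h g n p A acc with does (isBhg? h g n A)
  ... | true = cong (_+ acc) (sym (*-identityʳ (weight p A)))
  ... | false = cong (_+ acc) (sym (*-zeroʳ (weight p A)))

probBhg≡E : ∀ h g n p → probBhg h g n p ≡ E p (λ A → 𝟙 (does (isBhg? h g n A)))
probBhg≡E h g n p = trans (go (allSubsets n)) (∑-allSubsets n p _)
  where
  go : ∀ As → foldr (probBhgStep h g n p) 0ℚ As ≡ ∑ As (λ A → weight p A * 𝟙 (does (isBhg? h g n A)))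
  go [] = refl
  go (A ∷ As) = trans (probBhgStep-≡ h g n p A _) (cong (weight p A * 𝟙 (does (isBhg? h g n A)) +_) (go As))

-- membership indicators

-- Coordinates beyond n count as absent, so later sums may run over boxes larger than the ground
-- set.
at : ∀ {n} → Vec Bool n → ℕ → ℚ
at [] x = 0ℚ
at (b ∷ A) zero = 𝟙 b
at (b ∷ A) (suc x) = at A x

0≤at : ∀ {n} (A : Vec Bool n) x → 0ℚ ≤ at A x
0≤at [] x = ≤-refl
0≤at (b ∷ A) zero = 0≤𝟙 b
0≤at (b ∷ A) (suc x) = 0≤at A x

at-idem : ∀ {n} (A : Vec Bool n) x → at A x * at A x ≡ at A x
at-idem [] x = refl
at-idem (true ∷ A) zero = refl
at-idem (false ∷ A) zero = refl
at-idem (b ∷ A) (suc x) = at-idem A x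

at-out : ∀ {n} (A : Vec Bool n) {x} → n ℕ.≤ x → at A x ≡ 0ℚ
at-out [] _ = refl
at-out (b ∷ A) (ℕ.s≤s n≤x) = at-out A n≤x

∈elemsFrom⇒at : ∀ {n} s (A : Vec Bool n) {y} → y ∈ elemsFrom s A → ∃[ x ] (y ≡ s ℕ.+ x × at A x ≡ 1ℚ)
∈elemsFrom⇒at s (true ∷ A) (here refl) = 0 , sym (ℕₚ.+-identityʳ s) , refl
∈elemsFrom⇒at s (true ∷ A) (there y∈) with ∈elemsFrom⇒at (suc s) A y∈
... | x , eq , one = suc x , trans eq (sym (ℕₚ.+-suc s x)) , one
∈elemsFrom⇒at s (false ∷ A) y∈ with ∈elemsFrom⇒at (suc s) A y∈
... | x , eq , one = suc x , trans eq (sym (ℕₚ.+-suc s x)) , one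

at-zero-or-∈ : ∀ {n} s (A : Vec Bool n) x → at A x ≡ 0ℚ ⊎ s ℕ.+ x ∈ elemsFrom s A
at-zero-or-∈ s [] x = inj₁ refl
at-zero-or-∈ s (true ∷ A) zero = inj₂ (here (ℕₚ.+-identityʳ s))
at-zero-or-∈ s (false ∷ A) zero = inj₁ refl
at-zero-or-∈ s (true ∷ A) (suc x) with at-zero-or-∈ (suc s) A x
... | inj₁ eq = inj₁ eq
... | inj₂ x∈ = inj₂ (there (subst (_∈ elemsFrom (suc s) A) (sym (ℕₚ.+-suc s x)) x∈))
at-zero-or-∈ s (false ∷ A) (suc x) with at-zero-or-∈ (suc s) A x
... | inj₁ eq = inj₁ eq
... | inj₂ x∈ = inj₂ (subst (_∈ elemsFrom (suc s) A) (sym (ℕₚ.+-suc s x)) x∈)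

setAt : ∀ {n} → ℕ → Bool → Vec Bool n → Vec Bool n
setAt x b [] = []
setAt zero b (_ ∷ A) = b ∷ A
setAt (suc x) b (c ∷ A) = c ∷ setAt x b A

-- Independence is used in this form only: the indicator at x factors out of an expectation when the
-- other factor is invariant under changes at x.
Free : ∀ {n} → ℕ → (Vec Bool n → ℚ) → Set
Free x f = ∀ b A → f (setAt x b A) ≡ f A

at-free : ∀ {n x y} → x ≢ y → Free {n} x (λ A → at A y)
at-free {x = x} x≢y b [] = refl
at-free {x = zero} {zero} x≢y b (c ∷ A) = ⊥-elim (x≢y refl)
at-free {x = zero} {suc y} x≢y b (c ∷ A) = refl
at-free {x = suc x} {zero} x≢y b (c ∷ A) = refl
at-free {x = suc x} {suc y} x≢y b (c ∷ A) = at-free (x≢y ∘ cong suc) b A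

*-free : ∀ {n x} {f g : Vec Bool n → ℚ} → Free x f → Free x g → Free x (λ A → f A * g A)
*-free F G b A = cong₂ _*_ (F b A) (G b A)

∑-free : ∀ {n x} (xs : List X) {f : X → Vec Bool n → ℚ} → (∀ i → Free x (f i)) → Free x (λ A → ∑ xs (λ i → f i A))
∑-free xs F b A = ∑-cong xs (λ i → F i b A)

E-at : ∀ {n} p {x} {f : Vec Bool n → ℚ} → x ℕ.< n → Free x f → E p (λ A → at A x * f A) ≡ p * E p f
E-at {suc n} p {zero} {f} _ F = begin
  p * E p (λ A → 1ℚ * f (true ∷ A)) + (1ℚ - p) * E p (λ A → 0ℚ * f (false ∷ A))
    ≡⟨ cong₂ (λ x y → p * x + (1ℚ - p) * y) (E-*ˡ p 1ℚ (f ∘ (true ∷_))) (E-*ˡ p 0ℚ (f ∘ (false ∷_))) ⟩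
  p * (1ℚ * a) + (1ℚ - p) * (0ℚ * b)
    ≡⟨ solve 3 (λ p a b → p :* (con 1ℚ :* a) :+ (con 1ℚ :- p) :* (con 0ℚ :* b) := p :* (p :* a :+ (con 1ℚ :- p) :* a)) refl p a b ⟩
  p * (p * a + (1ℚ - p) * a)
    -- Freeness at coordinate 0 makes the two branches of `f` agree, so the second copy of `a` can
    -- be traded for `b`.
    ≡⟨ cong (λ y → p * (p * a + (1ℚ - p) * y)) (E-cong p (λ A → F true (false ∷ A))) ⟩
  p * E p f ∎
  where
  open ≡-Reasoning
  a = E p (f ∘ (true ∷_))
  b = E p (f ∘ (false ∷_))
E-at {suc n} p {suc x} {f} (ℕ.s≤s x<n) F = trans
  (cong₂ (λ x y → p * x + (1ℚ - p) * y) (E-at p x<n (λ b A → F b (true ∷ A))) (E-at p x<n (λ b A → F b (false ∷ A))))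
  (solve 3 (λ p a b → p :* (p :* a) :+ (con 1ℚ :- p) :* (p :* b) := p :* (p :* a :+ (con 1ℚ :- p) :* b)) refl p
    (E p (f ∘ (true ∷_))) (E p (f ∘ (false ∷_))))

-- For x outside the range the left side is zero; weakening equality to an inequality removes range
-- conditions from all upper bounds.
E-at-≤ : ∀ {n p} → Probability p → ∀ {x} {f : Vec Bool n → ℚ} → (∀ A → 0ℚ ≤ f A) → Free x f →
  E p (λ A → at A x * f A) ≤ p * E p f
E-at-≤ {n} {p} P {x} {f} 0≤f F with x ℕ.<? n
... | yes x<n = ≤-reflexive (E-at p x<n F)
... | no x≮n = subst (_≤ p * E p f)
  (sym (trans (E-cong p (λ A → trans (cong (_* f A) (at-out A (ℕₚ.≮⇒≥ x≮n))) (*-zeroˡ (f A)))) (E-const {n} p 0ℚ)))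
  (0≤* (0≤p P) (0≤E P 0≤f))

pairProb : ℚ → ℕ → ℕ → ℚ
pairProb p x y with x ℕ.≟ y
... | yes _ = p
... | no _ = p * p

E-at-at-≤ : ∀ {n p} → Probability p → ∀ {x y} {f : Vec Bool n → ℚ} → (∀ A → 0ℚ ≤ f A) → Free x f → Free y f →
  E p (λ A → at A x * at A y * f A) ≤ pairProb p x y * E p f
E-at-at-≤ {n} {p} P {x} {y} {f} 0≤f F G with x ℕ.≟ y
... | yes refl = subst (_≤ p * E p f) (E-cong p (λ A → cong (_* f A) (sym (at-idem A x)))) (E-at-≤ P 0≤f F)
... | no x≢y = begin
  E p (λ A → at A x * at A y * f A) ≡⟨ E-cong p (λ A → *-assoc (at A x) (at A y) (f A)) ⟩
  E p (λ A → at A x * (at A y * f A)) ≤⟨ E-at-≤ P (λ A → 0≤* (0≤at A y) (0≤f A)) (*-free (at-free x≢y) F) ⟩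
  p * E p (λ A → at A y * f A) ≤⟨ *-monoˡ (0≤p P) (E-at-≤ P 0≤f G) ⟩
  p * (p * E p f) ≡⟨ *-assoc p p (E p f) ⟨
  p * p * E p f ∎
  where open ≤-Reasoning

-- Elements are 1-based, coordinates are 0-based.
has : ∀ {n} → Vec Bool n → ℕ → ℚ
has A zero = 0ℚ
has A (suc x) = at A x

0≤has : ∀ {n} (A : Vec Bool n) x → 0ℚ ≤ has A x
0≤has A zero = ≤-refl
0≤has A (suc x) = 0≤at A x

∈elems⇒has : ∀ {n} (A : Vec Bool n) {x} → x ∈ elems A → has A x ≡ 1ℚ
∈elems⇒has A x∈ with ∈elemsFrom⇒at 1 A x∈
... | x , refl , one = one

hasAll : ∀ {n} → Vec Bool n → List ℕ → ℚ
hasAll A [] = 1ℚ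
hasAll A (x ∷ xs) = has A x * hasAll A xs

0≤hasAll : ∀ {n} (A : Vec Bool n) xs → 0ℚ ≤ hasAll A xs
0≤hasAll A [] = 0≤1
0≤hasAll A (x ∷ xs) = 0≤* (0≤has A x) (0≤hasAll A xs)

hasAll-one : ∀ {n} (A : Vec Bool n) {xs} → (∀ {x} → x ∈ xs → x ∈ elems A) → hasAll A xs ≡ 1ℚ
hasAll-one A {[]} sub = refl
hasAll-one A {x ∷ xs} sub = cong₂ _*_ (∈elems⇒has A (sub (here refl))) (hasAll-one A {xs} (sub ∘ there))

hasAll-free : ∀ {n x xs} → suc x ∉ xs → Free {n} x (λ A → hasAll A xs)
hasAll-free {xs = []} x∉ b A = refl
hasAll-free {xs = zero ∷ xs} x∉ b A = cong (0ℚ *_) (hasAll-free {xs = xs} (x∉ ∘ there) b A)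
hasAll-free {xs = suc y ∷ xs} x∉ b A = cong₂ _*_ (at-free (x∉ ∘ here ∘ cong suc) b A) (hasAll-free {xs = xs} (x∉ ∘ there) b A)

E-hasAll-≤ : ∀ {n p} → Probability p → ∀ {xs} → Unique xs → E {n} p (λ A → hasAll A xs) ≤ p ^ℚ length xs
E-hasAll-≤ {n} {p} P {[]} [] = ≤-reflexive (E-const {n} p 1ℚ)
E-hasAll-≤ {n} {p} P {zero ∷ xs} (_ ∷ u) = subst (_≤ p ^ℚ length (zero ∷ xs))
  (sym (trans (E-cong {n} p (λ A → *-zeroˡ (hasAll A xs))) (E-const {n} p 0ℚ))) (0≤^ (length (zero ∷ xs)) (0≤p P))
E-hasAll-≤ {n} {p} P {suc x ∷ xs} (x∉ ∷ u) = ≤-trans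
  (E-at-≤ {n} P (λ A → 0≤hasAll A xs) (hasAll-free {xs = xs} (λ x∈ → All.lookup x∉ x∈ refl)))
  (*-monoˡ (0≤p P) (E-hasAll-≤ {n} P u))

-- vanishing sequences

Eventually : (ℕ → Set) → Set
Eventually P = ∃[ N ] (∀ n → n ≥ N → P n)

Eventually-map : ∀ {P Q : ℕ → Set} → (∀ n → P n → Q n) → Eventually P → Eventually Q
Eventually-map f (N , ev) = N , λ n n≥N → f n (ev n n≥N)

Eventually-× : ∀ {P Q : ℕ → Set} → Eventually P → Eventually Q → Eventually (λ n → P n × Q n)
Eventually-× (N , ev) (N′ , ev′) = N ℕ.⊔ N′ , λ n n≥ → ev n (ℕₚ.≤-trans (ℕₚ.m≤m⊔n N N′) n≥) , ev′ n (ℕₚ.≤-trans (ℕₚ.m≤n⊔m N N′) n≥)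

-- One-sided on purpose: both conclusions of the theorem are upper bounds on a probability.
Small : (ℕ → ℚ) → Set
Small f = ∀ ε → 0ℚ < ε → Eventually (λ n → f n ≤ ε)

Small-mono : ∀ {f g} → Eventually (λ n → f n ≤ g n) → Small g → Small f
Small-mono ev S ε 0<ε = Eventually-map (λ n (fg , gε) → ≤-trans fg gε) (Eventually-× ev (S ε 0<ε))

split-ε : ∀ {ε c} → 0ℚ < ε → 0ℚ < c → ∃[ δ ] (0ℚ < δ × c * δ ≡ ε)
split-ε {ε} {c} 0<ε 0<c = let d , 0<d , cd≡1 = inverse 0<c in
  ε * d , 0<* 0<ε 0<d ,
  trans (solve 3 (λ c ε d → c :* (ε :* d) := ε :* (c :* d)) refl c ε d) (trans (cong (ε *_) cd≡1) (*-identityʳ ε))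

Small-zero : Small (λ _ → 0ℚ)
Small-zero ε 0<ε = 0 , λ _ _ → <⇒≤ 0<ε

Small-*ˡ : ∀ {f} c → 0ℚ < c → Small f → Small (λ n → c * f n)
Small-*ˡ {f} c 0<c S ε 0<ε = let δ , 0<δ , cδ≡ε = split-ε 0<ε 0<c in
  Eventually-map (λ n fδ → subst (c * f n ≤_) cδ≡ε (*-monoˡ {c} {f n} {δ} (<⇒≤ 0<c) fδ)) (S δ 0<δ)

Small-+ : ∀ {f g} → Small f → Small g → Small (λ n → f n + g n)
Small-+ {f} {g} S T ε 0<ε = let δ , 0<δ , 2δ≡ε = split-ε {c = 1ℚ + 1ℚ} 0<ε (<-≤-trans 0<1 (a≤a+b 0≤1)) in
  Eventually-map
  (λ n (fδ , gδ) → subst (f n + g n ≤_) (trans (trans (sym (cong₂ _+_ (*-identityˡ δ) (*-identityˡ δ))) (sym (*-distribʳ-+ δ 1ℚ 1ℚ))) 2δ≡ε) (+-mono-≤ fδ gδ))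
  (Eventually-× (S δ 0<δ) (T δ 0<δ))

Small-∑ : ∀ (xs : List X) {f : X → ℕ → ℚ} → (∀ x → Small (f x)) → Small (λ n → ∑ xs (λ x → f x n))
Small-∑ [] S = Small-zero
Small-∑ (x ∷ xs) S = Small-+ (S x) (Small-∑ xs S)

-- Here q stands for 1/n. Having n q = 1 in place of a division turns the later rearrangements into
-- polynomial identities.
record Scaled (n : ℕ) (k p q : ℚ) : Set where
  field
    p≡kq : p ≡ k * q
    nq≡1 : ℕ→ℚ n * q ≡ 1ℚ
    0≤q : 0ℚ ≤ q
    q≤1 : q ≤ 1ℚ
    isProb : Probability p

qOf : ℕ → ℚ
qOf n = pOf n 1ℚ

pOf-scaled : ∀ n k → 0ℚ ≤ k → k ≤ ℕ→ℚ n → 1 ℕ.≤ n → Scaled n k (pOf n k) (qOf n)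
pOf-scaled (suc m) k 0≤k k≤n _ = subst (Scaled (suc m) k (pOf (suc m) k)) (sym (*-identityˡ q)) (record
  { p≡kq = refl
  ; nq≡1 = nq≡1
  ; 0≤q = 0≤q
  ; q≤1 = subst₂ _≤_ (*-identityˡ q) nq≡1 (*-monoʳ 0≤q (ℕ→ℚ-mono {1} {suc m} (ℕ.s≤s ℕ.z≤n)))
  ; isProb = prob (0≤* 0≤k 0≤q) (subst (k * q ≤_) nq≡1 (*-monoʳ 0≤q k≤n))
  })
  where
  import Data.Integer as ℤ
  import Data.Integer.Properties as ℤₚ
  import Data.Rational.Unnormalised as ℚᵘ
  import Data.Rational.Unnormalised.Properties as ℚᵘₚ
  open import Data.Rational.Unnormalised using (mkℚᵘ)
  open import Data.Rational using (toℚᵘ; fromℚᵘ)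
  q = (pos 1) / suc m
  0≤q : 0ℚ ≤ q
  0≤q = nonNegative⁻¹ q {{normalize-nonNeg 1 (suc m)}}
  nq≡1 : ℕ→ℚ (suc m) * q ≡ 1ℚ
  nq≡1 = toℚᵘ-injective (begin
    toℚᵘ (ℕ→ℚ (suc m) * q) ≈⟨ toℚᵘ-homo-* (ℕ→ℚ (suc m)) q ⟩
    toℚᵘ (ℕ→ℚ (suc m)) ℚᵘ.* toℚᵘ q ≈⟨ ℚᵘₚ.*-cong (toℚᵘ-fromℚᵘ (mkℚᵘ (pos (suc m)) 0)) (toℚᵘ-fromℚᵘ (mkℚᵘ (pos 1) m)) ⟩
    mkℚᵘ (pos (suc m)) 0 ℚᵘ.* mkℚᵘ (pos 1) m ≈⟨ ℚᵘ.*≡* (trans (ℤₚ.*-identityʳ _) (trans (ℤₚ.*-identityʳ (pos (suc m))) (sym (trans (ℤₚ.*-identityˡ _) (cong ℤ.+_ (ℕₚ.*-identityˡ (suc m))))))) ⟩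
    toℚᵘ 1ℚ ∎)
    where open ℚᵘₚ.≃-Reasoning

-- sums over boxes

∑ᵥ : ∀ (N s : ℕ) → (Vec ℕ s → ℚ) → ℚ
∑ᵥ N zero f = f []
∑ᵥ N (suc s) f = ∑ (upTo N) (λ a → ∑ᵥ N s (f ∘ (a ∷_)))

∑ᵥ-mono : ∀ N s {f g : Vec ℕ s → ℚ} → (∀ x → f x ≤ g x) → ∑ᵥ N s f ≤ ∑ᵥ N s g
∑ᵥ-mono N zero le = le []
∑ᵥ-mono N (suc s) le = ∑-mono (upTo N) (λ a → ∑ᵥ-mono N s (le ∘ (a ∷_)))

∑ᵥ-*ʳ : ∀ N s c (f : Vec ℕ s → ℚ) → ∑ᵥ N s (λ x → f x * c) ≡ ∑ᵥ N s f * c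
∑ᵥ-*ʳ N zero c f = refl
∑ᵥ-*ʳ N (suc s) c f = trans (∑-cong (upTo N) (λ a → ∑ᵥ-*ʳ N s c (f ∘ (a ∷_)))) (∑-*ʳ (upTo N) c _)

0≤∑ᵥ : ∀ N s {f : Vec ℕ s → ℚ} → (∀ x → 0ℚ ≤ f x) → 0ℚ ≤ ∑ᵥ N s f
0≤∑ᵥ N zero 0≤f = 0≤f []
0≤∑ᵥ N (suc s) 0≤f = 0≤∑ (upTo N) (λ a → 0≤∑ᵥ N s (0≤f ∘ (a ∷_)))

∑ᵥ-∑-comm : ∀ N s (xs : List X) (f : X → Vec ℕ s → ℚ) → ∑ xs (λ a → ∑ᵥ N s (f a)) ≡ ∑ᵥ N s (λ x → ∑ xs (λ a → f a x))
∑ᵥ-∑-comm N zero xs f = refl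
∑ᵥ-∑-comm N (suc s) xs f = trans (∑-comm xs (upTo N) _) (∑-cong (upTo N) (λ b → ∑ᵥ-∑-comm N s xs (λ a x → f a (b ∷ x))))

𝟙-mono : ∀ {P Q : Set} (P? : Dec P) (Q? : Dec Q) → (P → Q) → 𝟙 (does P?) ≤ 𝟙 (does Q?)
𝟙-mono (yes p) (yes q) f = ≤-refl
𝟙-mono (yes p) (no ¬q) f = ⊥-elim (¬q (f p))
𝟙-mono (no ¬p) Q? f = 0≤𝟙 (does Q?)

∑-𝟙-none : ∀ {P : X → Set} (P? : ∀ a → Dec (P a)) xs → (∀ {a} → a ∈ xs → ¬ P a) → ∑ xs (λ a → 𝟙 (does (P? a))) ≡ 0ℚ
∑-𝟙-none P? [] none = refl
∑-𝟙-none P? (x ∷ xs) none = cong₂ _+_ (lemma (P? x) (none (here refl))) (∑-𝟙-none P? xs (none ∘ there))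
  where
  lemma : ∀ {P : Set} (P? : Dec P) → ¬ P → 𝟙 (does P?) ≡ 0ℚ
  lemma (yes p) ¬p = ⊥-elim (¬p p)
  lemma (no _) _ = refl

-- At most one summand is 1. This serves both to solve for a pivot variable and to sum Kronecker
-- deltas.
∑-𝟙-unique : ∀ {P : X → Set} {Q : Set} (P? : ∀ a → Dec (P a)) (Q? : Dec Q) {xs} → Unique xs →
  (∀ {a} → P a → Q) → (∀ {a b} → P a → P b → a ≡ b) → ∑ xs (λ a → 𝟙 (does (P? a))) ≤ 𝟙 (does Q?)
∑-𝟙-unique P? Q? [] P⇒Q uniq = 0≤𝟙 (does Q?)
∑-𝟙-unique {P = P} {Q} P? Q? {x ∷ xs} (x∉ ∷ u) P⇒Q uniq = step (P? x)
  where
  rest = ∑ xs (λ a → 𝟙 (does (P? a)))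
  step : (Px? : Dec (P x)) → 𝟙 (does Px?) + rest ≤ 𝟙 (does Q?)
  step (yes px) = subst (_≤ 𝟙 (does Q?)) (sym (trans (cong (1ℚ +_) (∑-𝟙-none P? xs (λ a∈ pa → All.lookup x∉ a∈ (uniq px pa)))) (+-identityʳ 1ℚ)))
    (𝟙-mono (yes px) Q? P⇒Q)
  step (no _) = subst (_≤ 𝟙 (does Q?)) (sym (+-identityˡ rest)) (∑-𝟙-unique P? Q? u P⇒Q uniq)

-- integer linear systems

dot : ∀ {s} → Vec ℤ s → Vec ℕ s → ℤ
dot [] [] = 0ℤ
dot (a ∷ v) (x ∷ xs) = a ℤ.* pos x ℤ.+ dot v xs

dot-∷ : ∀ {s} (v : Vec ℤ (suc s)) a x → dot v (a ∷ x) ≡ head v ℤ.* pos a ℤ.+ dot (tail v) x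
dot-∷ (_ ∷ _) a x = refl

Solves : ∀ {s ρ} → (Fin ρ → Vec ℤ s) → (Fin ρ → ℤ) → Vec ℕ s → Set
Solves D b x = ∀ i → dot (D i) x ≡ b i

solves? : ∀ {s ρ} (D : Fin ρ → Vec ℤ s) b x → Dec (Solves D b x)
solves? D b x = Finₚ.all? (λ i → dot (D i) x ℤ.≟ b i)

countSolutions : ∀ {s ρ} → (Fin ρ → Vec ℤ s) → (Fin ρ → ℤ) → ℕ → ℚ
countSolutions {s} D b N = ∑ᵥ N s (λ x → 𝟙 (does (solves? D b x)))

-- Full rank enters only through this consequence, at most N^(s-ρ) solutions in a box of side N; the
-- factor N^ρ stands on the left to avoid subtraction in the exponent.
FullRankBound : ∀ {s ρ} → (Fin ρ → Vec ℤ s) → Set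
FullRankBound {s} {ρ} D = ∀ b N → countSolutions D b N * ℕ→ℚ N ^ℚ ρ ≤ ℕ→ℚ N ^ℚ s

Dependent : ∀ {s ρ} → (Fin ρ → Vec ℤ s) → Set
Dependent {s} {ρ} D = Σ[ c ∈ (Fin ρ → ℤ) ] ((∃[ i ] c i ≢ 0ℤ) × (∀ j → sum (λ i → c i ℤ.* lookup (D i) j) ≡ 0ℤ))

-- Fraction-free elimination of the first column with pivot `d`. Staying over ℤ keeps the
-- coefficients of a dependency integral, as the later split by signs requires.
module Elimination {s ρ : ℕ} (D : Fin (suc ρ) → Vec ℤ (suc s)) (i₀ : Fin (suc ρ)) (d≢0 : head (D i₀) ≢ 0ℤ) where

  open ℤSolver.+-*-Solver renaming (solve to solveℤ; _:=_ to _⊜_; _:+_ to _⊕_; _:*_ to _⊗_; _:-_ to _⊝_; :-_ to ⊝_; con to conℤ) using ()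

  d : ℤ
  d = head (D i₀)

  e : Fin ρ → ℤ
  e i = head (D (punchIn i₀ i))

  combine : ∀ {s} → ℤ → Vec ℤ s → Vec ℤ s → Vec ℤ s
  combine e = zipWith (λ u w → d ℤ.* u ℤ.- e ℤ.* w)

  reduced : Fin ρ → Vec ℤ s
  reduced i = combine (e i) (tail (D (punchIn i₀ i))) (tail (D i₀))

  dot-combine : ∀ {s} e (u w : Vec ℤ s) x → dot (combine e u w) x ≡ d ℤ.* dot u x ℤ.- e ℤ.* dot w x
  dot-combine e [] [] [] = solveℤ 2 (λ d e → conℤ 0ℤ ⊜ d ⊗ conℤ 0ℤ ⊝ e ⊗ conℤ 0ℤ) refl d e
  dot-combine e (u ∷ us) (w ∷ ws) (x ∷ xs) = trans (cong₂ ℤ._+_ {x = (d ℤ.* u ℤ.- e ℤ.* w) ℤ.* pos x} refl (dot-combine e us ws xs))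
    (solveℤ 7 (λ d e u w x p q → (d ⊗ u ⊝ e ⊗ w) ⊗ x ⊕ (d ⊗ p ⊝ e ⊗ q) ⊜ d ⊗ (u ⊗ x ⊕ p) ⊝ e ⊗ (w ⊗ x ⊕ q)) refl d e u w (pos x) (dot us xs) (dot ws xs))

  rhs : (Fin (suc ρ) → ℤ) → Fin ρ → ℤ
  rhs b i = d ℤ.* b (punchIn i₀ i) ℤ.- e i ℤ.* b i₀

  solves-reduced : ∀ {b a x} → Solves D b (a ∷ x) → Solves reduced (rhs b) x
  solves-reduced {b} {a} {x} sol i = begin
    dot (reduced i) x ≡⟨ dot-combine (e i) (tail (D (punchIn i₀ i))) (tail (D i₀)) x ⟩
    d ℤ.* U ℤ.- e i ℤ.* W
      ≡⟨ solveℤ 5 (λ d e a U W → d ⊗ U ⊝ e ⊗ W ⊜ d ⊗ (e ⊗ a ⊕ U) ⊝ e ⊗ (d ⊗ a ⊕ W)) refl d (e i) (pos a) U W ⟩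
    d ℤ.* (e i ℤ.* pos a ℤ.+ U) ℤ.- e i ℤ.* (d ℤ.* pos a ℤ.+ W)
      ≡⟨ cong₂ (λ y z → d ℤ.* y ℤ.- e i ℤ.* z) (trans (sym (dot-∷ (D (punchIn i₀ i)) a x)) (sol _)) (trans (sym (dot-∷ (D i₀) a x)) (sol _)) ⟩
    rhs b i ∎
    where
    open ≡-Reasoning
    U = dot (tail (D (punchIn i₀ i))) x
    W = dot (tail (D i₀)) x

  solves-unique : ∀ {b x a a′} → Solves D b (a ∷ x) → Solves D b (a′ ∷ x) → a ≡ a′
  solves-unique {b} {x} {a} {a′} sol sol′ = ℤₚ.+-injective (ℤₚ.*-cancelˡ-≡ d (pos a) (pos a′) {{ℤ.≢-nonZero d≢0}}
    (ℤGroup.∙-cancelʳ (dot (tail (D i₀)) x) (d ℤ.* pos a) (d ℤ.* pos a′)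
      (trans (trans (sym (dot-∷ (D i₀) a x)) (sol i₀)) (sym (trans (sym (dot-∷ (D i₀) a′ x)) (sol′ i₀))))))

  -- The pivot row determines the first coordinate from the others, so dropping it is injective on
  -- solutions. One variable and one equation disappear together, and s - ρ does not change.
  fullRank : FullRankBound reduced → FullRankBound D
  fullRank bound b N = begin
    countSolutions D b N * (N′ * N′ ^ℚ ρ) ≤⟨ *-monoʳ (0≤^ (suc ρ) (0≤ℕ→ℚ N)) fewer ⟩
    countSolutions reduced (rhs b) N * (N′ * N′ ^ℚ ρ)
      ≡⟨ solve 3 (λ c n m → c :* (n :* m) := n :* (c :* m)) refl (countSolutions reduced (rhs b) N) N′ (N′ ^ℚ ρ) ⟩
    N′ * (countSolutions reduced (rhs b) N * N′ ^ℚ ρ) ≤⟨ *-monoˡ (0≤ℕ→ℚ N) (bound (rhs b) N) ⟩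
    N′ * N′ ^ℚ s ∎
    where
    open ≤-Reasoning
    N′ = ℕ→ℚ N
    fewer : countSolutions D b N ≤ countSolutions reduced (rhs b) N
    fewer = subst (_≤ countSolutions reduced (rhs b) N) (sym (∑ᵥ-∑-comm N s (upTo N) (λ a x → 𝟙 (does (solves? D b (a ∷ x))))))
      (∑ᵥ-mono N s (λ x → ∑-𝟙-unique (λ a → solves? D b (a ∷ x)) (solves? reduced (rhs b) x) (Unique.upTo⁺ N) solves-reduced solves-unique))

  -- Expanding a dependency of the reduced rows collects the coefficient d c_i on the old row i and
  -- -Σ c_i e_i on the pivot row; a nonzero c_i stays nonzero because d ≠ 0.
  dependent : Dependent reduced → Dependent D
  dependent (c , (i , ci≢0) , sum≡0) = c′ , (punchIn i₀ i , nonzero) , columns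
    where
    S = sum (λ i → c i ℤ.* e i)
    c′ : Fin (suc ρ) → ℤ
    c′ = insertAt (λ i → d ℤ.* c i) i₀ (ℤ.- S)
    nonzero : c′ (punchIn i₀ i) ≢ 0ℤ
    nonzero eq with ℤₚ.i*j≡0⇒i≡0∨j≡0 d (trans (sym (insertAt-punchIn _ i₀ _ i)) eq)
    ... | inj₁ d≡0 = d≢0 d≡0
    ... | inj₂ ci≡0 = ci≢0 ci≡0
    split : ∀ (col : Fin (suc ρ) → ℤ) → sum (λ i → c′ i ℤ.* col i) ≡ (ℤ.- S) ℤ.* col i₀ ℤ.+ sum (λ i → d ℤ.* c i ℤ.* col (punchIn i₀ i))
    split col = trans (sum-remove {i = i₀} (λ i → c′ i ℤ.* col i))
      (cong₂ ℤ._+_ (cong (ℤ._* col i₀) (insertAt-lookup _ i₀ _)) (sum-cong-≗ (λ i → cong (ℤ._* col (punchIn i₀ i)) (insertAt-punchIn _ i₀ _ i))))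
    lookup-zero : ∀ i → lookup (D i) zero ≡ head (D i)
    lookup-zero i with D i
    ... | _ ∷ _ = refl
    lookup-suc : ∀ i j → lookup (D i) (suc j) ≡ lookup (tail (D i)) j
    lookup-suc i j with D i
    ... | _ ∷ _ = refl
    columns : ∀ j → sum (λ i → c′ i ℤ.* lookup (D i) j) ≡ 0ℤ
    columns zero = begin
      sum (λ i → c′ i ℤ.* lookup (D i) zero) ≡⟨ sum-cong-≗ (λ i → cong (c′ i ℤ.*_) (lookup-zero i)) ⟩
      sum (λ i → c′ i ℤ.* head (D i)) ≡⟨ split (head ∘ D) ⟩
      (ℤ.- S) ℤ.* d ℤ.+ sum (λ i → d ℤ.* c i ℤ.* e i)
        ≡⟨ cong₂ ℤ._+_ {x = (ℤ.- S) ℤ.* d} refl (trans (sum-cong-≗ (λ i → ℤₚ.*-assoc d (c i) (e i))) (sym (*-distribˡ-sum d (λ i → c i ℤ.* e i)))) ⟩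
      (ℤ.- S) ℤ.* d ℤ.+ d ℤ.* S ≡⟨ solveℤ 2 (λ S d → (⊝ S) ⊗ d ⊕ d ⊗ S ⊜ conℤ 0ℤ) refl S d ⟩
      0ℤ ∎
      where open ≡-Reasoning
    columns (suc j) = begin
      sum (λ i → c′ i ℤ.* lookup (D i) (suc j)) ≡⟨ sum-cong-≗ (λ i → cong (c′ i ℤ.*_) (lookup-suc i j)) ⟩
      sum (λ i → c′ i ℤ.* col i) ≡⟨ split col ⟩
      (ℤ.- S) ℤ.* w ℤ.+ sum (λ i → d ℤ.* c i ℤ.* u i)
        ≡⟨ cong (ℤ._+ sum (λ i → d ℤ.* c i ℤ.* u i)) (trans (solveℤ 2 (λ S w → (⊝ S) ⊗ w ⊜ S ⊗ (⊝ w)) refl S w) (*-distribʳ-sum (ℤ.- w) (λ i → c i ℤ.* e i))) ⟩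
      sum (λ i → c i ℤ.* e i ℤ.* (ℤ.- w)) ℤ.+ sum (λ i → d ℤ.* c i ℤ.* u i)
        ≡⟨ ∑-distrib-+ (λ i → c i ℤ.* e i ℤ.* (ℤ.- w)) (λ i → d ℤ.* c i ℤ.* u i) ⟨
      sum (λ i → c i ℤ.* e i ℤ.* (ℤ.- w) ℤ.+ d ℤ.* c i ℤ.* u i)
        ≡⟨ sum-cong-≗ (λ i → trans
             (solveℤ 5 (λ c e w d u → c ⊗ e ⊗ (⊝ w) ⊕ d ⊗ c ⊗ u ⊜ c ⊗ (d ⊗ u ⊝ e ⊗ w)) refl (c i) (e i) w d (u i))
             (cong (c i ℤ.*_) (sym (lookup-zipWith (λ u w → d ℤ.* u ℤ.- e i ℤ.* w) j (tail (D (punchIn i₀ i))) (tail (D i₀)))))) ⟩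
      sum (λ i → c i ℤ.* lookup (reduced i) j) ≡⟨ sum≡0 j ⟩
      0ℤ ∎
      where
      open ≡-Reasoning
      col : Fin (suc ρ) → ℤ
      col i = lookup (tail (D i)) j
      w = col i₀
      u = λ i → col (punchIn i₀ i)

module ZeroColumn {s ρ : ℕ} (D : Fin ρ → Vec ℤ (suc s)) (zeros : ∀ i → head (D i) ≡ 0ℤ) where

  fullRank : FullRankBound (tail ∘ D) → FullRankBound D
  fullRank bound b N = begin
    countSolutions D b N * N′ ^ℚ ρ ≤⟨ *-monoʳ (0≤^ ρ (0≤ℕ→ℚ N)) (∑-mono (upTo N) fewer) ⟩
    ∑ (upTo N) (λ _ → countSolutions (tail ∘ D) b N) * N′ ^ℚ ρ
      ≡⟨ cong (_* N′ ^ℚ ρ) (trans (∑-const (upTo N) _) (cong (λ l → ℕ→ℚ l * countSolutions (tail ∘ D) b N) (length-upTo N))) ⟩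
    N′ * countSolutions (tail ∘ D) b N * N′ ^ℚ ρ ≡⟨ *-assoc N′ _ _ ⟩
    N′ * (countSolutions (tail ∘ D) b N * N′ ^ℚ ρ) ≤⟨ *-monoˡ (0≤ℕ→ℚ N) (bound b N) ⟩
    N′ * N′ ^ℚ s ∎
    where
    open ≤-Reasoning
    N′ = ℕ→ℚ N
    solves-tail : ∀ {a x} → Solves D b (a ∷ x) → Solves (tail ∘ D) b x
    solves-tail {a} {x} sol i = trans (sym (trans (dot-∷ (D i) a x)
      (trans (cong (λ h → h ℤ.* pos a ℤ.+ dot (tail (D i)) x) (zeros i)) (ℤₚ.+-identityˡ _)))) (sol i)
    fewer : ∀ a → ∑ᵥ N s (λ x → 𝟙 (does (solves? D b (a ∷ x)))) ≤ countSolutions (tail ∘ D) b N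
    fewer a = ∑ᵥ-mono N s (λ x → 𝟙-mono (solves? D b (a ∷ x)) (solves? (tail ∘ D) b x) solves-tail)

  dependent : Dependent (tail ∘ D) → Dependent D
  dependent (c , nz , sum≡0) = c , nz , columns
    where
    lookup-zero : ∀ i → lookup (D i) zero ≡ 0ℤ
    lookup-zero i with D i | zeros i
    ... | _ ∷ _ | z = z
    lookup-suc : ∀ i j → lookup (D i) (suc j) ≡ lookup (tail (D i)) j
    lookup-suc i j with D i
    ... | _ ∷ _ = refl
    columns : ∀ j → sum (λ i → c i ℤ.* lookup (D i) j) ≡ 0ℤ
    columns zero = trans (sum-cong-≗ (λ i → trans (cong (c i ℤ.*_) (lookup-zero i)) (ℤₚ.*-zeroʳ (c i)))) (sum-replicate-zero ρ)
    columns (suc j) = trans (sum-cong-≗ (λ i → cong (c i ℤ.*_) (lookup-suc i j))) (sum≡0 j)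

fullRank-or-dependent : ∀ {s ρ} (D : Fin ρ → Vec ℤ s) → FullRankBound D ⊎ Dependent D
fullRank-or-dependent {zero} {zero} D = inj₁ (λ b N → ≤-reflexive (*-identityʳ 1ℚ))
-- With no columns left every combination vanishes, so any remaining row gives a dependency.
fullRank-or-dependent {zero} {suc ρ} D = inj₂ ((λ _ → 1ℤ) , (zero , λ ()) , λ ())
fullRank-or-dependent {suc s} {ρ} D with Finₚ.all? (λ i → head (D i) ℤ.≟ 0ℤ)
... | yes zeros with fullRank-or-dependent (tail ∘ D)
...   | inj₁ bound = inj₁ (ZeroColumn.fullRank D zeros bound)
...   | inj₂ dep = inj₂ (ZeroColumn.dependent D zeros dep)
fullRank-or-dependent {suc s} {zero} D | no ¬zeros = ⊥-elim (¬zeros λ ())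
fullRank-or-dependent {suc s} {suc ρ} D | no ¬zeros with Finₚ.¬∀⟶∃¬ (suc ρ) _ (λ i → head (D i) ℤ.≟ 0ℤ) ¬zeros
... | i₀ , d≢0 with fullRank-or-dependent (Elimination.reduced D i₀ d≢0)
...   | inj₁ bound = inj₁ (Elimination.fullRank D i₀ d≢0 bound)
...   | inj₂ dep = inj₂ (Elimination.dependent D i₀ d≢0 dep)

-- multisets as nondecreasing lists

occ : ℕ → List ℕ → ℕ
occ x [] = 0
occ x (y ∷ t) with x ℕ.≟ y
... | yes _ = suc (occ x t)
... | no _ = occ x t

occ-∷-same : ∀ x t → occ x (x ∷ t) ≡ suc (occ x t)
occ-∷-same x t with x ℕ.≟ x
... | yes _ = refl
... | no x≢x = ⊥-elim (x≢x refl)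

occ-∉ : ∀ {x t} → x ∉ t → occ x t ≡ 0
occ-∉ {t = []} x∉ = refl
occ-∉ {x} {y ∷ t} x∉ with x ℕ.≟ y
... | yes x≡y = ⊥-elim (x∉ (here x≡y))
... | no _ = occ-∉ (x∉ ∘ there)

occ-∈ : ∀ {x t} → x ∈ t → occ x t ≢ 0
occ-∈ {x} {y ∷ t} x∈ with x ℕ.≟ y
occ-∈ {x} {y ∷ t} x∈ | yes _ = λ ()
occ-∈ {x} {y ∷ t} (here x≡y) | no x≢y = ⊥-elim (x≢y x≡y)
occ-∈ {x} {y ∷ t} (there x∈) | no x≢y = occ-∈ x∈

occ-≢0 : ∀ {x} t → occ x t ≢ 0 → x ∈ t
occ-≢0 {x} [] ne = ⊥-elim (ne refl)
occ-≢0 {x} (y ∷ t) ne with x ℕ.≟ y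
... | yes x≡y = here x≡y
... | no _ = there (occ-≢0 t ne)

occ-≤-length : ∀ x t → occ x t ℕ.≤ length t
occ-≤-length x [] = ℕ.z≤n
occ-≤-length x (y ∷ t) with x ℕ.≟ y
... | yes _ = ℕ.s≤s (occ-≤-length x t)
... | no _ = ℕₚ.m≤n⇒m≤1+n (occ-≤-length x t)

msets-∷⁻ : ∀ h x xs {t} → t ∈ msets (suc h) (x ∷ xs) → (∃[ t′ ] (t ≡ x ∷ t′ × t′ ∈ msets h (x ∷ xs))) ⊎ t ∈ msets (suc h) xs
msets-∷⁻ h x xs t∈ with ∈-++⁻ (map (x ∷_) (msets h (x ∷ xs))) t∈
... | inj₁ t∈ˡ with t′ , t′∈ , eq ← ∈-map⁻ (x ∷_) t∈ˡ = inj₁ (t′ , eq , t′∈)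
... | inj₂ t∈ʳ = inj₂ t∈ʳ

msets-length : ∀ h xs {t} → t ∈ msets h xs → length t ≡ h
msets-length zero xs (here refl) = refl
msets-length (suc h) (x ∷ xs) t∈ with msets-∷⁻ h x xs t∈
... | inj₁ (t′ , refl , t′∈) = cong suc (msets-length h (x ∷ xs) t′∈)
... | inj₂ t∈ʳ = msets-length (suc h) xs t∈ʳ

msets-⊆ : ∀ h xs {t y} → t ∈ msets h xs → y ∈ t → y ∈ xs
msets-⊆ zero xs (here refl) ()
msets-⊆ (suc h) (x ∷ xs) t∈ y∈ with msets-∷⁻ h x xs t∈
... | inj₂ t∈ʳ = there (msets-⊆ (suc h) xs t∈ʳ y∈)
msets-⊆ (suc h) (x ∷ xs) t∈ (here y≡x) | inj₁ (t′ , refl , t′∈) = here y≡x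
msets-⊆ (suc h) (x ∷ xs) t∈ (there y∈) | inj₁ (t′ , refl , t′∈) = msets-⊆ h (x ∷ xs) t′∈ y∈

occ-cancel : ∀ x {y t t′} → occ y (x ∷ t) ≡ occ y (x ∷ t′) → occ y t ≡ occ y t′
occ-cancel x {y} eq with y ℕ.≟ x
... | yes _ = ℕₚ.suc-injective eq
... | no _ = eq

-- If only one of the lists starts with the first candidate x, the other is drawn from the remaining
-- candidates, where x does not occur; the multiplicities of x then differ.
msets-occ-injective : ∀ h {xs t t′} → Unique xs → t ∈ msets h xs → t′ ∈ msets h xs → (∀ y → occ y t ≡ occ y t′) → t ≡ t′
msets-occ-injective zero u (here refl) (here refl) eq = refl
msets-occ-injective (suc h) {x ∷ xs} (x∉ ∷ u) t∈ t′∈ eq with msets-∷⁻ h x xs t∈ | msets-∷⁻ h x xs t′∈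
... | inj₁ (r , refl , r∈) | inj₁ (r′ , refl , r′∈) =
  cong (x ∷_) (msets-occ-injective h (x∉ ∷ u) r∈ r′∈ (λ y → occ-cancel x {y} {r} {r′} (eq y)))
... | inj₁ (r , refl , r∈) | inj₂ t′∈ʳ =
  ⊥-elim (occ-∈ {x} {x ∷ r} (here refl) (trans (eq x) (occ-∉ (λ x∈ → All.lookup x∉ (msets-⊆ (suc h) xs t′∈ʳ x∈) refl))))
... | inj₂ t∈ʳ | inj₁ (r′ , refl , r′∈) =
  ⊥-elim (occ-∈ {x} {x ∷ r′} (here refl) (trans (sym (eq x)) (occ-∉ (λ x∈ → All.lookup x∉ (msets-⊆ (suc h) xs t∈ʳ x∈) refl))))
... | inj₂ t∈ʳ | inj₂ t′∈ʳ = msets-occ-injective (suc h) u t∈ʳ t′∈ʳ eq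

msets-unique : ∀ h {xs} → Unique xs → Unique (msets h xs)
msets-unique zero u = [] ∷ []
msets-unique (suc h) {[]} u = []
msets-unique (suc h) {x ∷ xs} (x∉ ∷ u) = Unique.++⁺ (Unique.map⁺ ∷-injectiveʳ (msets-unique h (x∉ ∷ u))) (msets-unique (suc h) u) disjoint
  where
  disjoint : ∀ {t} → t ∈ map (x ∷_) (msets h (x ∷ xs)) × t ∈ msets (suc h) xs → ⊥
  disjoint (t∈ , t∈ʳ) with _ , _ , refl ← ∈-map⁻ (x ∷_) t∈ = All.lookup x∉ (msets-⊆ (suc h) xs t∈ʳ (here refl)) refl

elemsFrom-≥ : ∀ {n} s (A : Vec Bool n) {y} → y ∈ elemsFrom s A → s ℕ.≤ y
elemsFrom-≥ s A y∈ with x , refl , _ ← ∈elemsFrom⇒at s A y∈ = ℕₚ.m≤m+n s x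

elemsFrom-unique : ∀ {n} s (A : Vec Bool n) → Unique (elemsFrom s A)
elemsFrom-unique s [] = []
elemsFrom-unique s (true ∷ A) = All.tabulate (λ y∈ → ℕₚ.<⇒≢ (elemsFrom-≥ (suc s) A y∈)) ∷ elemsFrom-unique (suc s) A
elemsFrom-unique s (false ∷ A) = elemsFrom-unique (suc s) A

unique-length-≤ : ∀ {xs ys : List X} → Unique xs → (∀ {x} → x ∈ xs → x ∈ ys) → length xs ℕ.≤ length ys
unique-length-≤ {xs = []} _ _ = ℕ.z≤n
unique-length-≤ {xs = x ∷ xs} (x∉ ∷ u) sub with as , bs , refl ← ∈-∃++ (sub (here refl)) =
  subst (suc (length xs) ℕ.≤_) (sym (Perm.↭-length (Perm.shift x as bs))) (ℕ.s≤s (unique-length-≤ u sub′))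
  where
  sub′ : ∀ {y} → y ∈ xs → y ∈ as ++ bs
  sub′ y∈ with Perm.∈-resp-↭ (Perm.shift x as bs) (sub (there y∈))
  ... | here refl = ⊥-elim (All.lookup x∉ y∈ refl)
  ... | there y∈′ = y∈′

-- integer dependencies among multisets

support : List (List ℕ) → List ℕ
support F = deduplicate ℕ._≟_ (concat F)

length-concat : ∀ {h} (F : List (List ℕ)) → (∀ {t} → t ∈ F → length t ≡ h) → length (concat F) ≡ length F ℕ.* h
length-concat [] len = refl
length-concat (t ∷ F) len = trans (length-++ t) (cong₂ ℕ._+_ (len (here refl)) (length-concat F (len ∘ there)))

-- Taking for `Q` one side of a balanced relation bounds the support of both sides by h times the
-- number of multisets on that side.
support-size : ∀ {h} {F : List (List ℕ)} Q → (∀ {t} → t ∈ Q → length t ≡ h) → (∀ {x} → x ∈ concat F → x ∈ concat Q) → length (support F) ℕ.≤ length Q ℕ.* h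
support-size {h} {F} Q len sub = subst (length (support F) ℕ.≤_) (length-concat Q len)
  (unique-length-≤ (deduplicate-! ℕ._≟_ (concat F)) (λ x∈ → sub (∈-deduplicate⁻ ℕ._≟_ (concat F) x∈)))

-- The leading −1 is the coefficient of the common sum.
row : (xs : List ℕ) → List ℕ → Vec ℤ (suc (length xs))
row xs t = ℤ.- 1ℤ ∷ Vec.map (λ x → pos (occ x t)) (Vec.fromList xs)

-- Stored as a vector and not as a function, so that it can be found in the finite list `matrices`;
-- the outcome of the rank decision for the family is then literally the one for that list entry.
matrix : (F : List (List ℕ)) → Vec (Vec ℤ (suc (length (support F)))) (length F)
matrix F = Vec.tabulate (λ i → row (support F) (List.lookup F i))

system : (F : List (List ℕ)) → Fin (length F) → Vec ℤ (suc (length (support F)))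
system F = lookup (matrix F)

system-row : ∀ F i → system F i ≡ row (support F) (List.lookup F i)
system-row F = lookup∘tabulate (λ i → row (support F) (List.lookup F i))

-- The pair (a , t) stands for the multiset t with coefficient suc a.
wsum : List (ℕ × List ℕ) → (List ℕ → ℕ) → ℕ
wsum [] f = 0
wsum ((a , t) ∷ P) f = suc a ℕ.* f t ℕ.+ wsum P f

wsum-≢0 : ∀ P f {t} → t ∈ map proj₂ P → f t ≢ 0 → wsum P f ≢ 0
wsum-≢0 ((a , t) ∷ P) f (here refl) ft≢0 eq = ft≢0 (ℕₚ.m+n≡0⇒m≡0 (f t) (ℕₚ.m+n≡0⇒m≡0 (suc a ℕ.* f t) eq))
wsum-≢0 ((a , t) ∷ P) f (there t∈) ft≢0 eq = wsum-≢0 P f t∈ ft≢0 (ℕₚ.m+n≡0⇒n≡0 (suc a ℕ.* f t) eq)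

≢0-wsum : ∀ P f → wsum P f ≢ 0 → ∃[ t ] (t ∈ map proj₂ P × f t ≢ 0)
≢0-wsum [] f ne = ⊥-elim (ne refl)
≢0-wsum ((a , t) ∷ P) f ne with f t ℕ.≟ 0
... | no ft≢0 = t , here refl , ft≢0
... | yes ft≡0 with t′ , t′∈ , ne′ ← ≢0-wsum P f (λ eq → ne (trans (cong₂ (λ u v → suc a ℕ.* u ℕ.+ v) ft≡0 eq) (cong (ℕ._+ 0) (ℕₚ.*-zeroʳ (suc a))))) = t′ , there t′∈ , ne′

-- All weights are positive, so nothing cancels: x has nonzero weighted multiplicity on a side
-- exactly when it occurs in some multiset of that side.
wsum-cover : ∀ P Q → (∀ x → wsum P (occ x) ≡ wsum Q (occ x)) → ∀ {x} → x ∈ concat (map proj₂ P) → x ∈ concat (map proj₂ Q)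
wsum-cover P Q bal {x} x∈ =
  let t , x∈t , t∈ = ∈-concat⁻′ (map proj₂ P) x∈
      t′ , t′∈ , ne = ≢0-wsum Q (occ x) (λ eq → wsum-≢0 P (occ x) t∈ (occ-∈ x∈t) (trans (bal x) eq))
  in ∈-concat⁺′ (occ-≢0 t′ ne) t′∈

lsum : List (ℤ × List ℕ) → (List ℕ → ℤ) → ℤ
lsum [] f = 0ℤ
lsum ((c , t) ∷ cs) f = c ℤ.* f t ℤ.+ lsum cs f

-- The members with coefficient zero are kept in `Z`: the permutation then carries distinctness from
-- the whole family to the two sides.
record SignSplit (cs : List (ℤ × List ℕ)) : Set where
  field
    P N : List (ℕ × List ℕ)
    Z : List (List ℕ)
    perm : map proj₂ cs ↭ map proj₂ P ++ map proj₂ N ++ Z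
    balance : ∀ f → lsum cs (pos ∘ f) ℤ.+ pos (wsum N f) ≡ pos (wsum P f)
    nonzero : Any (λ ct → proj₁ ct ≢ 0ℤ) cs → ¬ (P ≡ [] × N ≡ [])

signSplit : ∀ cs → SignSplit cs
signSplit [] = record { P = [] ; N = [] ; Z = [] ; perm = ↭-refl ; balance = λ f → refl ; nonzero = λ () }
signSplit ((c , t) ∷ cs) with signSplit cs
signSplit ((pos zero , t) ∷ cs) | S = record
  { P = P ; N = N ; Z = t ∷ Z
  ; perm = ↭-trans (↭-prep t perm) (↭-sym (↭-trans (Perm.++⁺ˡ (map proj₂ P) (Perm.shift t (map proj₂ N) Z)) (Perm.shift t (map proj₂ P) (map proj₂ N ++ Z))))
  ; balance = λ f → trans (cong (ℤ._+ pos (wsum N f)) (ℤₚ.+-identityˡ (lsum cs (pos ∘ f)))) (balance f)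
  ; nonzero = λ { (here c≢0) → ⊥-elim (c≢0 refl) ; (there nz) → nonzero nz } }
  where open SignSplit S
signSplit ((ℤ.+[1+ a ] , t) ∷ cs) | S = record
  { P = (a , t) ∷ P ; N = N ; Z = Z
  ; perm = ↭-prep t perm
  ; balance = λ f → trans (ℤₚ.+-assoc (ℤ.+[1+ a ] ℤ.* pos (f t)) (lsum cs (pos ∘ f)) (pos (wsum N f)))
      (trans (cong₂ ℤ._+_ (sym (ℤₚ.pos-* (suc a) (f t))) (balance f)) (sym (ℤₚ.pos-+ (suc a ℕ.* f t) (wsum P f))))
  ; nonzero = λ _ () }
  where open SignSplit S
signSplit ((ℤ.-[1+ a ] , t) ∷ cs) | S = record
  { P = P ; N = (a , t) ∷ N ; Z = Z
  ; perm = ↭-trans (↭-prep t perm) (↭-sym (Perm.shift t (map proj₂ P) (map proj₂ N ++ Z)))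
  ; balance = λ f → trans (cong₂ ℤ._+_ {x = ℤ.-[1+ a ] ℤ.* pos (f t) ℤ.+ lsum cs (pos ∘ f)} refl
        (trans (ℤₚ.pos-+ (suc a ℕ.* f t) (wsum N f)) (cong (ℤ._+ pos (wsum N f)) (ℤₚ.pos-* (suc a) (f t)))))
      (trans (rearrange (pos (suc a)) (pos (f t)) (lsum cs (pos ∘ f)) (pos (wsum N f))) (balance f))
  ; nonzero = λ _ () }
  where
  open SignSplit S
  rearrange : ∀ a y s w → ((ℤ.- a) ℤ.* y ℤ.+ s) ℤ.+ (a ℤ.* y ℤ.+ w) ≡ s ℤ.+ w
  rearrange = solveℤ 4 (λ a y s w → ((⊝ a) ⊗ y ⊕ s) ⊕ (a ⊗ y ⊕ w) ⊜ s ⊕ w) refl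
    where open ℤSolver.+-*-Solver renaming (solve to solveℤ; _:=_ to _⊜_; _:+_ to _⊕_; _:*_ to _⊗_; :-_ to ⊝_) using ()

lsum-tabulate : ∀ {ρ} (c : Fin ρ → ℤ) (T : Fin ρ → List ℕ) f → lsum (tabulate (λ i → c i , T i)) f ≡ sum (λ i → c i ℤ.* f (T i))
lsum-tabulate {zero} c T f = refl
lsum-tabulate {suc ρ} c T f = cong₂ ℤ._+_ {x = c zero ℤ.* f (T zero)} refl (lsum-tabulate (c ∘ suc) (T ∘ suc) f)

record Dependency (F : List (List ℕ)) : Set where
  field
    P N : List (ℕ × List ℕ)
    Z : List (List ℕ)
    perm : F ↭ map proj₂ P ++ map proj₂ N ++ Z
    occ-balance : ∀ x → wsum P (occ x) ≡ wsum N (occ x)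
    one-balance : wsum P (λ _ → 1) ≡ wsum N (λ _ → 1)
    nonempty : ¬ (P ≡ [] × N ≡ [])

-- An element column gives the balance of its multiplicities, and the column of entries -1, which
-- belongs to the common sum, gives equality of the total weights. Elements outside the support have
-- multiplicity zero everywhere.
dependency : ∀ F → Dependent (system F) → Dependency F
dependency F (c , (i , ci≢0) , columns′) = record
  { P = P ; N = N ; Z = Z
  ; perm = subst (_↭ map proj₂ P ++ map proj₂ N ++ Z) cs-F perm
  ; occ-balance = λ x → balanced (occ x) (occ-vanish x)
  ; one-balance = balanced (λ _ → 1) one-vanish
  ; nonempty = nonzero (lose (∈-tabulate⁺ i) ci≢0) }
  where
  columns : ∀ j → sum (λ i → c i ℤ.* lookup (row (support F) (List.lookup F i)) j) ≡ 0ℤ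
  columns j = trans (sum-cong-≗ (λ i → cong (λ v → c i ℤ.* lookup v j) (sym (system-row F i)))) (columns′ j)
  cs = tabulate (λ i → c i , List.lookup F i)
  open SignSplit (signSplit cs)
  cs-F : map proj₂ cs ≡ F
  cs-F = trans (map-tabulate (λ i → c i , List.lookup F i) proj₂) (tabulate-lookup F)
  balanced : ∀ f → lsum cs (pos ∘ f) ≡ 0ℤ → wsum P f ≡ wsum N f
  balanced f eq = ℤₚ.+-injective (sym (trans (sym (trans (cong (ℤ._+ pos (wsum N f)) eq) (ℤₚ.+-identityˡ _))) (balance f)))
  one-vanish : lsum cs (λ _ → 1ℤ) ≡ 0ℤ
  one-vanish = trans (lsum-tabulate c (List.lookup F) (λ _ → 1ℤ)) (trans (sum-cong-≗ (λ i → neg-neg (c i)))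
    (trans (sym (*-distribʳ-sum (ℤ.- 1ℤ) (λ i → c i ℤ.* (ℤ.- 1ℤ)))) (cong (ℤ._* (ℤ.- 1ℤ)) (columns zero))))
    where
    open ℤSolver.+-*-Solver renaming (solve to solveℤ; _:=_ to _⊜_; _:*_ to _⊗_; con to conℤ) using ()
    neg-neg : ∀ a → a ℤ.* 1ℤ ≡ a ℤ.* (ℤ.- 1ℤ) ℤ.* (ℤ.- 1ℤ)
    neg-neg = solveℤ 1 (λ a → a ⊗ conℤ 1ℤ ⊜ a ⊗ conℤ (ℤ.- 1ℤ) ⊗ conℤ (ℤ.- 1ℤ)) refl
  lookup-fromList : ∀ {x} {xs : List ℕ} → x ∈ xs → ∃[ j ] Vec.lookup (Vec.fromList xs) j ≡ x
  lookup-fromList (here refl) = zero , refl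
  lookup-fromList (there x∈) = let j , eq = lookup-fromList x∈ in suc j , eq
  occ-vanish : ∀ x → lsum cs (pos ∘ occ x) ≡ 0ℤ
  occ-vanish x = trans (lsum-tabulate c (List.lookup F) (pos ∘ occ x)) (vanish (Any.any? (x ℕ.≟_) (concat F)))
    where
    vanish : Dec (x ∈ concat F) → sum (λ i → c i ℤ.* pos (occ x (List.lookup F i))) ≡ 0ℤ
    vanish (yes x∈) = let j , eq = lookup-fromList (∈-deduplicate⁺ ℕ._≟_ x∈) in
      trans (sum-cong-≗ (λ i → cong (c i ℤ.*_) (sym (trans (lookup-map j (λ x → pos (occ x (List.lookup F i))) (Vec.fromList (support F)))
        (cong (λ y → pos (occ y (List.lookup F i))) eq))))) (columns (suc j))
    vanish (no x∉) = trans (sum-cong-≗ (λ i → trans (cong (λ o → c i ℤ.* pos o) (occ-∉ (λ x∈ → x∉ (∈-concat⁺′ {vs = List.lookup F i} {xss = F} x∈ (∈-lookup i))))) (ℤₚ.*-zeroʳ (c i))))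
      (sum-replicate-zero (length F))

-- Descent to a full-rank subfamily

module Reduction (h : ℕ) (Sol : List ℕ → Set) (size : ∀ {t} → Sol t → length t ≡ h)
  (ext : ∀ {t t′} → Sol t → Sol t′ → (∀ y → occ y t ≡ occ y t′) → t ≡ t′) where

  record Family (F : List (List ℕ)) : Set where
    constructor family
    field
      unique : Unique F
      sols : All Sol F

  Family-↭ : ∀ {F G} → F ↭ G → Family F → Family G
  Family-↭ p (family u s) = family (SetoidPerm.Unique-resp-↭ (setoid (List ℕ)) (↭⇒↭ₛ p) u) (Perm.All-resp-↭ p s)

  Unique-resp-⊇ : ∀ {F G : List (List ℕ)} → G ⊆ F → Unique F → Unique G
  Unique-resp-⊇ [] [] = []
  Unique-resp-⊇ (_ ∷ʳ p) (_ ∷ u) = Unique-resp-⊇ p u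
  Unique-resp-⊇ (refl ∷ p) (t∉ ∷ u) = Sublist.All-resp-⊆ p t∉ ∷ Unique-resp-⊇ p u

  Family-⊆ : ∀ {F G} → G ⊆ F → Family F → Family G
  Family-⊆ p (family u s) = family (Unique-resp-⊇ p u) (Sublist.All-resp-⊆ p s)

  -- Implies g s ≤ h (g + 1) ρ for every g.
  Tight : List (List ℕ) → Set
  Tight F = ∃[ ρ ] (length F ≡ suc ρ × 1 ℕ.≤ ρ × length (support F) ℕ.≤ ρ ℕ.* h)

  record Smaller (F : List (List ℕ)) : Set where
    field
      G : List (List ℕ)
      isFamily : Family G
      tight : Tight G
      shorter : length G ℕ.< length F

  private
    -- Equal total weights identify the two coefficients, which then cancel from the multiplicities.
    weights-equal : ∀ {a b t t′} → Sol t → Sol t′ → wsum ((a , t) ∷ []) (λ _ → 1) ≡ wsum ((b , t′) ∷ []) (λ _ → 1) →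
      (∀ x → wsum ((a , t) ∷ []) (occ x) ≡ wsum ((b , t′) ∷ []) (occ x)) → t ≡ t′
    weights-equal {a} {b} {t} {t′} st st′ one bal = ext st st′ λ x → ℕₚ.*-cancelˡ-≡ (occ x t) (occ x t′) (suc a)
      (trans (trans (sym (ℕₚ.+-identityʳ _)) (bal x)) (trans (ℕₚ.+-identityʳ _) (cong (λ e → e ℕ.* occ x t′) (sym a≡b))))
      where
      a≡b : suc a ≡ suc b
      a≡b = trans (sym (trans (ℕₚ.+-identityʳ _) (ℕₚ.*-identityʳ (suc a)))) (trans one (trans (ℕₚ.+-identityʳ _) (ℕₚ.*-identityʳ (suc b))))

  smaller : ∀ {F} → Family F → Dependency F → Smaller F
  smaller {F} fam dep = go P N perm occ-balance one-balance nonempty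
    where
    open Dependency dep
    π : List (ℕ × List ℕ) → List (List ℕ)
    π = map proj₂
    sol : ∀ {t} → t ∈ F → Sol t
    sol = All.lookup (Family.sols fam)
    go : ∀ P N → F ↭ π P ++ π N ++ Z → (∀ x → wsum P (occ x) ≡ wsum N (occ x)) → wsum P (λ _ → 1) ≡ wsum N (λ _ → 1) →
      ¬ (P ≡ [] × N ≡ []) → Smaller F
    go [] [] _ _ _ ne = ⊥-elim (ne (refl , refl))
    -- A relation with one empty side would equate weight zero with a positive weight.
    go [] (n ∷ N) _ _ () ne
    go (p ∷ P) [] _ _ () ne
    go (p ∷ []) (n ∷ []) perm bal one ne = ⊥-elim (p∉ (weights-equal {proj₁ p} {proj₁ n} at-first at-second one bal))
      where
      fam′ = Family-↭ perm fam
      at-first : Sol (proj₂ p)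
      at-first = All.lookup (Family.sols fam′) (here refl)
      at-second : Sol (proj₂ n)
      at-second = All.lookup (Family.sols fam′) (there (here refl))
      p∉ : proj₂ p ≢ proj₂ n
      p∉ eq = All.lookup (AllPairs.head (Family.unique fam′)) (here refl) eq
    -- The dropped multiset is the only one on the right. Its at most h elements cover the left
    -- side, and ρ ≥ 1 because the left side has at least two members.
    go (p ∷ p′ ∷ P) (n ∷ []) perm bal one ne = record
      { G = G
      ; isFamily = fam″
      ; tight = suc (length P) , cong (λ l → suc (suc l)) (length-map proj₂ P) , ℕ.s≤s ℕ.z≤n ,
          ℕₚ.≤-trans (support-size {F = G} (π (n ∷ [])) (λ { (here refl) → size (All.lookup (Family.sols fam′) (∈-++⁺ʳ G (here refl))) }) (wsum-cover (p ∷ p′ ∷ P) (n ∷ []) bal))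
            (ℕₚ.*-monoˡ-≤ h {1} {suc (length P)} (ℕ.s≤s ℕ.z≤n))
      ; shorter = subst (length G ℕ.<_) (sym (Perm.↭-length perm)) (subst (length G ℕ.<_) (sym (length-++ G)) (ℕₚ.m<m+n (length G) (ℕ.s≤s ℕ.z≤n))) }
      where
      G = π (p ∷ p′ ∷ P)
      fam′ = Family-↭ perm fam
      fam″ = Family-⊆ (Sublist.++⁺ʳ (π (n ∷ []) ++ Z) ⊆-refl) fam′
    -- One member of the right side is dropped. The left side alone covers the support, and since a
    -- right member remains, ρ is at least the number of multisets on the left.
    go (p ∷ P) (n ∷ n′ ∷ N) perm bal one ne = record
      { G = G
      ; isFamily = Family-⊆ sub fam′
      ; tight = length (p ∷ P) ℕ.+ length N , lenG , ℕ.s≤s ℕ.z≤n ,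
          ℕₚ.≤-trans (support-size {F = G} (π (p ∷ P)) (λ t∈ → size (All.lookup (Family.sols fam′) (∈-++⁺ˡ t∈))) cover)
            (ℕₚ.*-monoˡ-≤ h (subst (ℕ._≤ length (p ∷ P) ℕ.+ length N) (sym (length-map proj₂ (p ∷ P))) (ℕₚ.m≤m+n (length (p ∷ P)) (length N))))
      ; shorter = subst (length G ℕ.<_) (sym (Perm.↭-length perm)) shorter }
      where
      G = π (p ∷ P) ++ π (n′ ∷ N)
      fam′ = Family-↭ perm fam
      sub : G ⊆ π (p ∷ P) ++ π (n ∷ n′ ∷ N) ++ Z
      sub = Sublist.++⁺ (⊆-refl {x = π (p ∷ P)}) (proj₂ n ∷ʳ Sublist.++⁺ʳ Z (⊆-refl {x = π (n′ ∷ N)}))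
      lenG : length G ≡ suc (length (p ∷ P) ℕ.+ length N)
      lenG = trans (length-++ (π (p ∷ P))) (trans (cong₂ ℕ._+_ (length-map proj₂ (p ∷ P)) (length-map proj₂ (n′ ∷ N))) (ℕₚ.+-suc (length (p ∷ P)) (length N)))
      shorter : length G ℕ.< length (π (p ∷ P) ++ π (n ∷ n′ ∷ N) ++ Z)
      shorter = subst₂ ℕ._<_ (sym (length-++ (π (p ∷ P)))) (sym (length-++ (π (p ∷ P))))
        (ℕₚ.+-monoʳ-< (length (π (p ∷ P))) (ℕ.s≤s (subst (length (π (n′ ∷ N)) ℕ.≤_) (sym (length-++ (π (n′ ∷ N)))) (ℕₚ.m≤m+n _ _))))
      cover : ∀ {x} → x ∈ concat G → x ∈ concat (π (p ∷ P))
      cover x∈ with t , x∈t , t∈ ← ∈-concat⁻′ G x∈ with ∈-++⁻ (π (p ∷ P)) t∈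
      ... | inj₁ t∈P = ∈-concat⁺′ x∈t t∈P
      ... | inj₂ t∈N = wsum-cover (n ∷ n′ ∷ N) (p ∷ P) (sym ∘ bal) (∈-concat⁺′ {xss = π (n ∷ n′ ∷ N)} x∈t (there t∈N))

  -- Besides the bound, the outcome of the decision procedure is remembered, because the union bound
  -- selects its terms by that outcome.
  record FullRankSubfamily (F : List (List ℕ)) : Set where
    field
      G : List (List ℕ)
      sols : All Sol G
      bound : FullRankBound (system G)
      fullRank : fullRank-or-dependent (system G) ≡ inj₁ bound
      shape : G ≡ F ⊎ (length G ℕ.≤ length F × Tight G)

  -- Descent on the number of multisets. Tightness of the replacement does not refer to the family
  -- it came from, so only the last replacement matters; if there was none, the family is the
  -- original one.
  fullRankSubfamily : ∀ fuel F → length F ℕ.< fuel → Family F → FullRankSubfamily F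
  fullRankSubfamily (suc fuel) F (ℕ.s≤s len) fam with fullRank-or-dependent (system F) in eq
  ... | inj₁ bound = record { G = F ; sols = Family.sols fam ; fullRank = eq ; shape = inj₁ refl }
  ... | inj₂ dep = lift (fullRankSubfamily fuel G (ℕₚ.<-≤-trans shorter len) isFamily)
    where
    open Smaller (smaller fam (dependency F dep))
    lift : FullRankSubfamily G → FullRankSubfamily F
    lift R = record { G = R.G ; sols = R.sols ; fullRank = R.fullRank ; shape = inj₂ (shape R.shape) }
      where
      module R = FullRankSubfamily R
      shape : R.G ≡ G ⊎ (length R.G ℕ.≤ length G × Tight R.G) → length R.G ℕ.≤ length F × Tight R.G
      shape (inj₁ eq) = subst (λ G → length G ℕ.≤ length F × Tight G) (sym eq) (ℕₚ.<⇒≤ shorter , tight)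
      shape (inj₂ (le , t)) = ℕₚ.≤-trans le (ℕₚ.<⇒≤ shorter) , t

-- union bound over count matrices

vecsOver : List X → ∀ n → List (Vec X n)
vecsOver xs zero = [] ∷ []
vecsOver xs (suc n) = cartesianProductWith _∷_ xs (vecsOver xs n)

∈-vecsOver : ∀ {xs : List X} {n} (v : Vec X n) → (∀ i → lookup v i ∈ xs) → v ∈ vecsOver xs n
∈-vecsOver [] _ = here refl
∈-vecsOver (x ∷ v) mem = ∈-cartesianProductWith⁺ _∷_ (mem zero) (∈-vecsOver v (mem ∘ suc))

-- An entry is -1 in the column of the sum and otherwise a multiplicity, at most h because the
-- multiset has h members.
entries : ℕ → List ℤ
entries h = ℤ.- 1ℤ ∷ map pos (upTo (suc h))

matrices : ℕ → (s l : ℕ) → List (Vec (Vec ℤ (suc s)) l)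
matrices h s l = vecsOver (vecsOver (entries h) (suc s)) l

row-∈ : ∀ h xs t → length t ≡ h → row xs t ∈ vecsOver (entries h) (suc (length xs))
row-∈ h xs t len = ∈-vecsOver (row xs t) entry
  where
  entry : ∀ j → lookup (row xs t) j ∈ entries h
  entry zero = here refl
  entry (suc j) = there (subst (_∈ map pos (upTo (suc h))) (sym (lookup-map j (λ x → pos (occ x t)) (Vec.fromList xs)))
    (∈-map⁺ pos (∈-upTo⁺ (ℕ.s≤s (subst (occ (lookup (Vec.fromList xs) j) t ℕ.≤_) len (occ-≤-length _ t))))))

matrix-∈ : ∀ h F → (∀ {t} → t ∈ F → length t ≡ h) → matrix F ∈ matrices h (length (support F)) (length F)
matrix-∈ h F len = ∈-vecsOver (matrix F) (λ i → subst (_∈ vecsOver (entries h) _) (sym (system-row F i))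
  (row-∈ h (support F) (List.lookup F i) (len (∈-lookup i))))

occSum : List ℕ → List ℕ → ℕ
occSum [] t = 0
occSum (x ∷ xs) t = occ x t ℕ.* x ℕ.+ occSum xs t

occSum-[] : ∀ xs → occSum xs [] ≡ 0
occSum-[] [] = refl
occSum-[] (x ∷ xs) = occSum-[] xs

occ-∷-other : ∀ {x y} t → x ≢ y → occ x (y ∷ t) ≡ occ x t
occ-∷-other {x} {y} t x≢y with x ℕ.≟ y
... | yes x≡y = ⊥-elim (x≢y x≡y)
... | no _ = refl

occSum-∉ : ∀ {y} xs t → y ∉ xs → occSum xs (y ∷ t) ≡ occSum xs t
occSum-∉ [] t y∉ = refl
occSum-∉ (x ∷ xs) t y∉ = cong₂ (λ a b → a ℕ.* x ℕ.+ b) (occ-∷-other t (λ x≡y → y∉ (here (sym x≡y)))) (occSum-∉ xs t (y∉ ∘ there))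

occSum-∷ : ∀ {y xs} t → Unique xs → y ∈ xs → occSum xs (y ∷ t) ≡ y ℕ.+ occSum xs t
occSum-∷ {y} {x ∷ xs} t (x∉ ∷ u) (here refl) = trans
  (cong₂ (λ a b → a ℕ.* x ℕ.+ b) (occ-∷-same x t) (occSum-∉ xs t (λ x∈ → All.lookup x∉ x∈ refl)))
  (ℕₚ.+-assoc x (occ x t ℕ.* x) (occSum xs t))
occSum-∷ {y} {x ∷ xs} t (x∉ ∷ u) (there y∈) = trans
  (cong₂ (λ a b → a ℕ.* x ℕ.+ b) (occ-∷-other t (All.lookup x∉ y∈)) (occSum-∷ t u y∈))
  (trans (sym (ℕₚ.+-assoc (occ x t ℕ.* x) y _)) (trans (cong (ℕ._+ occSum xs t) (ℕₚ.+-comm (occ x t ℕ.* x) y)) (ℕₚ.+-assoc y _ _)))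

occSum≡sum : ∀ {xs} t → Unique xs → (∀ {y} → y ∈ t → y ∈ xs) → occSum xs t ≡ sumℕ t
occSum≡sum {xs} [] u sub = occSum-[] xs
occSum≡sum (y ∷ t) u sub = trans (occSum-∷ t u (sub (here refl))) (cong (y ℕ.+_) (occSum≡sum t u (sub ∘ there)))

dot-occ : ∀ xs t → dot (Vec.map (λ x → pos (occ x t)) (Vec.fromList xs)) (Vec.fromList xs) ≡ pos (occSum xs t)
dot-occ [] t = refl
dot-occ (x ∷ xs) t = trans (cong₂ ℤ._+_ (sym (ℤₚ.pos-* (occ x t) x)) (dot-occ xs t)) (sym (ℤₚ.pos-+ (occ x t ℕ.* x) (occSum xs t)))

dot-row : ∀ {xs} t m → Unique xs → (∀ {y} → y ∈ t → y ∈ xs) → sumℕ t ≡ m → dot (row xs t) (m ∷ Vec.fromList xs) ≡ 0ℤ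
dot-row {xs} t m u sub eq = trans (cong₂ ℤ._+_ (ℤₚ.-1*i≡-i (pos m)) (trans (dot-occ xs t) (cong pos (trans (occSum≡sum t u sub) eq))))
  (ℤₚ.+-inverseˡ (pos m))

∑ᵥ-lower : ∀ N s {f : Vec ℕ s → ℚ} → (∀ y → 0ℚ ≤ f y) → ∀ y → (∀ i → lookup y i ℕ.< N) → f y ≤ ∑ᵥ N s f
∑ᵥ-lower N zero 0≤f [] lt = ≤-refl
∑ᵥ-lower N (suc s) {f} 0≤f (a ∷ y) lt = ≤-trans (∑ᵥ-lower N s (0≤f ∘ (a ∷_)) y (lt ∘ suc))
  (∈⇒≤∑ {f = λ a → ∑ᵥ N s (f ∘ (a ∷_))} (λ a → 0≤∑ᵥ N s (0≤f ∘ (a ∷_))) (∈-upTo⁺ (lt zero)))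

E-∑ᵥ : ∀ {n} p N s (f : Vec ℕ s → Vec Bool n → ℚ) → E p (λ A → ∑ᵥ N s (λ y → f y A)) ≡ ∑ᵥ N s (λ y → E p (f y))
E-∑ᵥ p N zero f = refl
E-∑ᵥ p N (suc s) f = trans (E-∑ p (upTo N) (λ a A → ∑ᵥ N s (λ y → f (a ∷ y) A))) (∑-cong (upTo N) (λ a → E-∑ᵥ p N s (f ∘ (a ∷_))))

𝟙-yes : ∀ {P : Set} (P? : Dec P) → P → 𝟙 (does P?) ≡ 1ℚ
𝟙-yes (yes _) _ = refl
𝟙-yes (no ¬p) p = ⊥-elim (¬p p)

module _ {s l : ℕ} (D : Fin l → Vec ℤ (suc s)) (N : ℕ) where

  -- The first coordinate of `y` is the common sum, constrained by the equations alone and not by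
  -- membership. The distinctness factor makes the other s memberships independent, which yields p^s
  -- in expectation.
  solutionWeight : ∀ {n} → Vec Bool n → Vec ℕ (suc s) → ℚ
  solutionWeight A y = 𝟙 (does (solves? D (λ _ → 0ℤ) y)) * (𝟙 (does (unique? (Vec.toList (tail y)))) * hasAll A (Vec.toList (tail y)))

  0≤solutionWeight : ∀ {n} (A : Vec Bool n) y → 0ℚ ≤ solutionWeight A y
  0≤solutionWeight A y = 0≤* (0≤𝟙 (does (solves? D (λ _ → 0ℤ) y))) (0≤* (0≤𝟙 (does (unique? (Vec.toList (tail y))))) (0≤hasAll A (Vec.toList (tail y))))

  solutionsIn : ∀ {n} → Vec Bool n → ℚ
  solutionsIn A = ∑ᵥ N (suc s) (solutionWeight A)

  E-solutionsIn : ∀ {n p} → Probability p → E {n} p solutionsIn ≤ countSolutions D (λ _ → 0ℤ) N * p ^ℚ s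
  E-solutionsIn {n} {p} P = begin
    E {n} p solutionsIn ≡⟨ E-∑ᵥ {n} p N (suc s) (λ y A → solutionWeight A y) ⟩
    ∑ᵥ N (suc s) (λ y → E {n} p (λ A → solutionWeight A y)) ≤⟨ ∑ᵥ-mono N (suc s) bound ⟩
    ∑ᵥ N (suc s) (λ y → 𝟙 (does (solves? D (λ _ → 0ℤ) y)) * p ^ℚ s) ≡⟨ ∑ᵥ-*ʳ N (suc s) (p ^ℚ s) (λ y → 𝟙 (does (solves? D (λ _ → 0ℤ) y))) ⟩
    countSolutions D (λ _ → 0ℤ) N * p ^ℚ s ∎
    where
    open ≤-Reasoning
    distinct : ∀ (xs : List ℕ) (u? : Dec (Unique xs)) → length xs ≡ s → E {n} p (λ A → 𝟙 (does u?) * hasAll A xs) ≤ p ^ℚ s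
    distinct xs (yes u) len = ≤-trans (≤-reflexive (E-cong {n} p (λ A → *-identityˡ (hasAll A xs))))
      (≤-trans (E-hasAll-≤ {n} P u) (≤-reflexive (cong (p ^ℚ_) len)))
    distinct xs (no _) len = subst (_≤ p ^ℚ s) (sym (trans (E-cong {n} p (λ A → *-zeroˡ (hasAll A xs))) (E-const {n} p 0ℚ))) (0≤^ s (Probability.0≤p P))
    bound : ∀ y → E {n} p (λ A → solutionWeight A y) ≤ 𝟙 (does (solves? D (λ _ → 0ℤ) y)) * p ^ℚ s
    bound y = subst (_≤ 𝟙 (does (solves? D (λ _ → 0ℤ) y)) * p ^ℚ s)
      (sym (E-*ˡ {n} p (𝟙 (does (solves? D (λ _ → 0ℤ) y))) (λ A → 𝟙 (does (unique? (Vec.toList (tail y)))) * hasAll A (Vec.toList (tail y)))))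
      (*-monoˡ (0≤𝟙 (does (solves? D (λ _ → 0ℤ) y))) (distinct (Vec.toList (tail y)) (unique? (Vec.toList (tail y))) (length-toList (tail y))))

-- l = ρ + 1 is the number of multisets and s the size of their support.
Admissible : (h g s l : ℕ) → Set
Admissible h g s l = 2 ℕ.≤ l × g ℕ.* s ℕ.≤ h ℕ.* (g ℕ.+ 1) ℕ.* (l ℕ.∸ 1)

admissible? : ∀ h g s l → Dec (Admissible h g s l)
admissible? h g s l = (2 ℕ.≤? l) ×-dec (g ℕ.* s ℕ.≤? h ℕ.* (g ℕ.+ 1) ℕ.* (l ℕ.∸ 1))

-- Full rank is tested by the outcome of `fullRank-or-dependent`, since `FullRankBound` quantifies
-- over all right-hand sides and boxes.
restrict : ∀ {P Q R : Set} → Dec P → Q ⊎ R → ℚ → ℚ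
restrict (yes _) (inj₁ _) x = x
restrict _ _ _ = 0ℚ

0≤restrict : ∀ {P Q R : Set} (d : Dec P) (e : Q ⊎ R) {x} → 0ℚ ≤ x → 0ℚ ≤ restrict d e x
0≤restrict (yes _) (inj₁ _) 0≤x = 0≤x
0≤restrict (yes _) (inj₂ _) _ = ≤-refl
0≤restrict (no _) e _ = ≤-refl

-- The index set depends on h and g only, so limits in n can be taken term by term.
patternSum : (h g : ℕ) → (∀ s l → Vec (Vec ℤ (suc s)) l → ℚ) → ℚ
patternSum h g f = ∑ (upTo (suc (h ℕ.* (g ℕ.+ 1)))) λ s → ∑ (upTo (suc (suc g))) λ l → ∑ (matrices h s l) λ M →
  restrict (admissible? h g s l) (fullRank-or-dependent (lookup M)) (f s l M)

module _ {h g : ℕ} where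

  pattern-≤-sum : ∀ {f : ∀ s l → Vec (Vec ℤ (suc s)) l → ℚ} → (∀ s l M → 0ℚ ≤ f s l M) →
    ∀ {s l M} → s ℕ.≤ h ℕ.* (g ℕ.+ 1) → l ℕ.≤ suc g → M ∈ matrices h s l → Admissible h g s l →
    ∀ {b} → fullRank-or-dependent (lookup M) ≡ inj₁ b → f s l M ≤ patternSum h g f
  pattern-≤-sum {f} 0≤f {s} {l} {M} s≤ l≤ M∈ adm eq = begin
    f s l M ≡⟨ restricted (admissible? h g s l) _ adm eq ⟨
    r s l M ≤⟨ ∈⇒≤∑ {f = r s l} (0≤r s l) M∈ ⟩
    ∑ (matrices h s l) (r s l) ≤⟨ ∈⇒≤∑ {f = λ l → ∑ (matrices h s l) (r s l)} (λ l → 0≤∑ (matrices h s l) (0≤r s l)) (∈-upTo⁺ (ℕ.s≤s l≤)) ⟩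
    ∑ (upTo (suc (suc g))) (λ l → ∑ (matrices h s l) (r s l))
      ≤⟨ ∈⇒≤∑ {f = λ s → ∑ (upTo (suc (suc g))) (λ l → ∑ (matrices h s l) (r s l))}
           (λ s → 0≤∑ (upTo (suc (suc g))) (λ l → 0≤∑ (matrices h s l) (0≤r s l))) (∈-upTo⁺ (ℕ.s≤s s≤)) ⟩
    patternSum h g f ∎
    where
    open ≤-Reasoning
    r : ∀ s l → Vec (Vec ℤ (suc s)) l → ℚ
    r s l M = restrict (admissible? h g s l) (fullRank-or-dependent (lookup M)) (f s l M)
    0≤r : ∀ s l M → 0ℚ ≤ r s l M
    0≤r s l M = 0≤restrict (admissible? h g s l) (fullRank-or-dependent (lookup M)) (0≤f s l M)
    restricted : ∀ {P Q R : Set} (d : Dec P) (e : Q ⊎ R) → P → ∀ {b x} → e ≡ inj₁ b → restrict d e x ≡ x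
    restricted (yes _) _ _ refl = refl
    restricted (no ¬p) _ p _ = ⊥-elim (¬p p)

  Small-patternSum : ∀ {f : ∀ s l → Vec (Vec ℤ (suc s)) l → ℕ → ℚ} → (∀ s l M → Admissible h g s l → Small (f s l M)) →
    Small (λ n → patternSum h g (λ s l M → f s l M n))
  Small-patternSum {f} S = Small-∑ (upTo (suc (h ℕ.* (g ℕ.+ 1)))) λ s → Small-∑ (upTo (suc (suc g))) λ l → Small-∑ (matrices h s l) λ M →
    small (admissible? h g s l) (fullRank-or-dependent (lookup M)) (S s l M)
    where
    small : ∀ {P Q R : Set} (d : Dec P) (e : Q ⊎ R) {u} → (P → Small u) → Small (λ n → restrict d e (u n))
    small (yes p) (inj₁ _) S = S p
    small (yes _) (inj₂ _) _ = Small-zero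
    small (no _) e _ = Small-zero

  patternSum-mono : ∀ {f f′ : ∀ s l → Vec (Vec ℤ (suc s)) l → ℚ} →
    (∀ s l M → FullRankBound (lookup M) → Admissible h g s l → f s l M ≤ f′ s l M) → patternSum h g f ≤ patternSum h g f′
  patternSum-mono {f} {f′} le = ∑-mono (upTo (suc (h ℕ.* (g ℕ.+ 1)))) λ s → ∑-mono (upTo (suc (suc g))) λ l → ∑-mono (matrices h s l) λ M →
    mono (admissible? h g s l) (fullRank-or-dependent (lookup M)) (λ adm b → le s l M b adm)
    where
    mono : ∀ {P Q R : Set} (d : Dec P) (e : Q ⊎ R) {x y} → (P → Q → x ≤ y) → restrict d e x ≤ restrict d e y
    mono (yes p) (inj₁ q) le = le p q
    mono (yes _) (inj₂ _) _ = ≤-refl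
    mono (no _) e _ = ≤-refl

  E-patternSum : ∀ {n} p (f : ∀ s l → Vec (Vec ℤ (suc s)) l → Vec Bool n → ℚ) →
    E p (λ A → patternSum h g (λ s l M → f s l M A)) ≡ patternSum h g (λ s l M → E p (f s l M))
  E-patternSum {n} p f =
    trans (E-∑ p (upTo (suc (h ℕ.* (g ℕ.+ 1)))) (λ s A → ∑ (upTo (suc (suc g))) (λ l → ∑ (matrices h s l) (r A s l)))) (∑-cong (upTo (suc (h ℕ.* (g ℕ.+ 1)))) λ s →
    trans (E-∑ p (upTo (suc (suc g))) (λ l A → ∑ (matrices h s l) (r A s l))) (∑-cong (upTo (suc (suc g))) λ l →
    trans (E-∑ p (matrices h s l) (λ M A → r A s l M)) (∑-cong (matrices h s l) λ M →
    inside (admissible? h g s l) (fullRank-or-dependent (lookup M)) (f s l M))))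
    where
    r : Vec Bool n → ∀ s l → Vec (Vec ℤ (suc s)) l → ℚ
    r A s l M = restrict (admissible? h g s l) (fullRank-or-dependent (lookup M)) (f s l M A)
    inside : ∀ {P Q R : Set} (d : Dec P) (e : Q ⊎ R) (u : Vec Bool n → ℚ) → E p (λ A → restrict d e (u A)) ≡ restrict d e (E p u)
    inside (yes _) (inj₁ _) u = refl
    inside (yes _) (inj₂ _) u = E-const {n} p 0ℚ
    inside (no _) e u = E-const {n} p 0ℚ

elems-≤ : ∀ {n} (A : Vec Bool n) {x} → x ∈ elems A → x ℕ.≤ n
elems-≤ {n} A x∈ with i , refl , one ← ∈elemsFrom⇒at 1 A x∈ with i ℕ.<? n
... | yes i<n = i<n
... | no i≮n = ⊥-elim (0≢1 (trans (sym (at-out A (ℕₚ.≮⇒≥ i≮n))) one))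
  where
  0≢1 : 0ℚ ≢ 1ℚ
  0≢1 ()

range-≤ : ∀ h n {m} → 1 ℕ.≤ n → m ∈ range h (n ℕ.* h) → m ℕ.≤ n ℕ.* h
range-≤ h n 1≤n m∈ with i , i∈ , refl ← ∈-map⁻ (h ℕ.+_) m∈ = subst (h ℕ.+ i ℕ.≤_) (ℕₚ.m+[n∸m]≡n h≤nh) (ℕₚ.+-monoʳ-≤ h (ℕₚ.≤-pred (∈-upTo⁻ i∈)))
  where
  h≤nh : h ℕ.≤ n ℕ.* h
  h≤nh = subst (ℕ._≤ n ℕ.* h) (ℕₚ.*-identityˡ h) (ℕₚ.*-monoˡ-≤ h 1≤n)

-- Every failing set contains a counted pattern

module _ {h g n : ℕ} (1≤h : 1 ℕ.≤ h) (1≤g : 1 ℕ.≤ g) (1≤n : 1 ℕ.≤ n) (A : Vec Bool n) where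

  private
    -- The box must hold the common sum, which may reach h n, as well as the elements; the extra n
    -- makes the bound strict.
    N = suc h ℕ.* n

    n<N : ∀ {x} → x ℕ.≤ n ℕ.* h → x ℕ.< N
    n<N {x} x≤ = ℕₚ.≤-<-trans (subst (x ℕ.≤_) (ℕₚ.*-comm n h) x≤) (ℕₚ.m<n+m (h ℕ.* n) 1≤n)

  -- The full-rank subfamily of g + 1 of the multisets, together with their sum, is an explicit
  -- solution of weight 1 for its own matrix, and all other terms are nonnegative.
  crowded : ∀ {m} → m ℕ.≤ n ℕ.* h → ¬ (solutions h (elems A) m ℕ.≤ g) →
    1ℚ ≤ patternSum h g (λ s l M → solutionsIn (lookup M) N A)
  crowded {m} m≤ many = ≤-trans one≤ (pattern-≤-sum {h} {g} {λ s l M → solutionsIn (lookup M) N A} nonneg s≤ l≤ M∈ adm fullRank)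
    where
    Sol : List ℕ → Set
    Sol t = t ∈ msets h (elems A) × sumℕ t ≡ m
    module R = Reduction h Sol (λ st → msets-length h (elems A) (proj₁ st))
      (λ st st′ → msets-occ-injective h (elemsFrom-unique 1 A) (proj₁ st) (proj₁ st′))
    sums : List (List ℕ)
    sums = filter (λ t → sumℕ t ℕ.≟ m) (msets h (elems A))
    F = take (suc g) sums
    lenF : length F ≡ suc g
    lenF = trans (length-take (suc g) sums) (ℕₚ.m≤n⇒m⊓n≡m (ℕₚ.≰⇒> many))
    fam : R.Family F
    fam = R.family (Unique.take⁺ (suc g) (Unique.filter⁺ (λ t → sumℕ t ℕ.≟ m) (msets-unique h (elemsFrom-unique 1 A))))
      (Allₚ.take⁺ (suc g) (All.tabulate (∈-filter⁻ (λ t → sumℕ t ℕ.≟ m))))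
    open R.FullRankSubfamily (R.fullRankSubfamily (suc (length F)) F (ℕₚ.n<1+n _) fam)
    sol : ∀ {t} → t ∈ G → Sol t
    sol = All.lookup sols
    size : ∀ {t} → t ∈ G → length t ≡ h
    size t∈ = msets-length h (elems A) (proj₁ (sol t∈))
    s = length (support G)
    l = length G
    dims : s ℕ.≤ h ℕ.* (g ℕ.+ 1) × l ℕ.≤ suc g × Admissible h g s l
    dims = go shape
      where
      go : G ≡ F ⊎ (l ℕ.≤ length F × R.Tight G) → s ℕ.≤ h ℕ.* (g ℕ.+ 1) × l ℕ.≤ suc g × Admissible h g s l
      -- For the whole family ρ = g, and admissibility is s ≤ h (g + 1) multiplied by g.
      go (inj₁ G≡F) = s≤h[g+1] , ℕₚ.≤-reflexive l≡ , subst (2 ℕ.≤_) (sym l≡) (ℕ.s≤s 1≤g) ,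
        ℕₚ.≤-trans (ℕₚ.*-monoʳ-≤ g s≤h[g+1]) (ℕₚ.≤-reflexive (trans (ℕₚ.*-comm g _) (cong (λ l → h ℕ.* (g ℕ.+ 1) ℕ.* (l ℕ.∸ 1)) (sym l≡))))
        where
        l≡ : l ≡ suc g
        l≡ = trans (cong length G≡F) lenF
        s≤h[g+1] : s ℕ.≤ h ℕ.* (g ℕ.+ 1)
        s≤h[g+1] = ℕₚ.≤-trans (support-size {F = G} G size (λ x∈ → x∈))
          (ℕₚ.≤-reflexive (trans (cong (ℕ._* h) l≡) (trans (ℕₚ.*-comm (suc g) h) (cong (h ℕ.*_) (ℕₚ.+-comm 1 g)))))
      go (inj₂ (l≤F , ρ , l≡ , 1≤ρ , s≤ρh)) =
        ℕₚ.≤-trans s≤ρh (ℕₚ.≤-trans (ℕₚ.*-monoˡ-≤ h ρ≤g+1) (ℕₚ.≤-reflexive (ℕₚ.*-comm (g ℕ.+ 1) h))) ,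
        subst (l ℕ.≤_) lenF l≤F , subst (2 ℕ.≤_) (sym l≡) (ℕ.s≤s 1≤ρ) ,
        ℕₚ.≤-trans (ℕₚ.*-monoʳ-≤ g s≤ρh) (ℕₚ.≤-trans (ℕₚ.≤-reflexive (rearrange g ρ h))
          (ℕₚ.≤-trans (ℕₚ.*-monoˡ-≤ ρ (ℕₚ.*-monoʳ-≤ h (ℕₚ.m≤m+n g 1))) (ℕₚ.≤-reflexive (cong (λ l → h ℕ.* (g ℕ.+ 1) ℕ.* (l ℕ.∸ 1)) (sym l≡)))))
        where
        ρ≤g+1 : ρ ℕ.≤ g ℕ.+ 1
        ρ≤g+1 = ℕₚ.≤-trans (ℕₚ.n≤1+n ρ) (subst₂ ℕ._≤_ l≡ (trans lenF (ℕₚ.+-comm 1 g)) l≤F)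
        rearrange : ∀ g ρ h → g ℕ.* (ρ ℕ.* h) ≡ h ℕ.* g ℕ.* ρ
        rearrange = solveℕ 3 (λ g ρ h → g ⊗ (ρ ⊗ h) ⊜ h ⊗ g ⊗ ρ) refl
          where open ℕSolver.+-*-Solver renaming (solve to solveℕ; _:=_ to _⊜_; _:*_ to _⊗_) using ()
    s≤ = proj₁ dims
    l≤ = proj₁ (proj₂ dims)
    adm = proj₂ (proj₂ dims)
    M∈ = matrix-∈ h G size
    nonneg : ∀ s l (M : Vec (Vec ℤ (suc s)) l) → 0ℚ ≤ solutionsIn (lookup M) N A
    nonneg s l M = 0≤∑ᵥ N (suc s) (0≤solutionWeight (lookup M) N A)
    xs = support G
    y = m ∷ Vec.fromList xs
    support-∈ : ∀ {x} → x ∈ xs → x ∈ elems A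
    support-∈ x∈ = let t , x∈t , t∈ = ∈-concat⁻′ G (∈-deduplicate⁻ ℕ._≟_ (concat G) x∈) in msets-⊆ h (elems A) (proj₁ (sol t∈)) x∈t
    xs-unique : Unique xs
    xs-unique = deduplicate-! ℕ._≟_ (concat G)
    y-solves : Solves (system G) (λ _ → 0ℤ) y
    y-solves i = trans (cong (λ r → dot r y) (system-row G i)) (dot-row (List.lookup G i) m xs-unique
      (λ x∈ → ∈-deduplicate⁺ ℕ._≟_ (∈-concat⁺′ {xss = G} x∈ (∈-lookup i))) (proj₂ (sol (∈-lookup i))))
    lookup-∈ : ∀ (xs : List ℕ) j → lookup (Vec.fromList xs) j ∈ xs
    lookup-∈ (x ∷ xs) zero = here refl
    lookup-∈ (x ∷ xs) (suc j) = there (lookup-∈ xs j)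
    small : ∀ j → lookup y j ℕ.< N
    small zero = n<N m≤
    small (suc j) = ℕₚ.≤-<-trans (elems-≤ A (support-∈ (lookup-∈ xs j))) (ℕₚ.m<m+n n (ℕₚ.*-mono-≤ 1≤h 1≤n))
    one : solutionWeight (system G) N A y ≡ 1ℚ
    one = cong₂ _*_ (𝟙-yes (solves? (system G) (λ _ → 0ℤ) y) y-solves)
      (cong₂ _*_ (𝟙-yes (unique? _) (subst Unique (sym (toList∘fromList xs)) xs-unique))
        (trans (cong (hasAll A) (toList∘fromList xs)) (hasAll-one A support-∈)))
    one≤ : 1ℚ ≤ solutionsIn (system G) N A
    one≤ = subst (_≤ solutionsIn (system G) N A) one (∑ᵥ-lower N (suc s) (0≤solutionWeight (system G) N A) y small)

-- the sparse regime

^-swap : ∀ q a b → (q ^ℚ a) ^ℚ b ≡ (q ^ℚ b) ^ℚ a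
^-swap q a b = trans (sym (^-* q a b)) (trans (cong (q ^ℚ_) (ℕₚ.*-comm a b)) (^-* q b a))

module _ {n : ℕ} {k p q : ℚ} (S : Scaled n k p q) where

  open Scaled S

  nq^≡1 : ∀ e → ℕ→ℚ n ^ℚ e * q ^ℚ e ≡ 1ℚ
  nq^≡1 e = trans (sym (^-distrib-* (ℕ→ℚ n) q e)) (trans (cong (_^ℚ e) nq≡1) (1^ e))

  -- There are ρ + 1 equations in s + 1 unknowns, the sum included, hence at most N^(s-ρ) solutions;
  -- times p^s = (k/n)^s this is of order k^s / n^ρ. The factor (n q)^(ρ+1) = 1 supplies the power
  -- that the rank bound needs, and the constant comes from N = (h + 1) n.
  fullRank-expectation : ∀ {h s ρ} (D : Fin (suc ρ) → Vec ℤ (suc s)) → 0ℚ ≤ k → FullRankBound D →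
    countSolutions D (λ _ → 0ℤ) (suc h ℕ.* n) * p ^ℚ s ≤ ℕ→ℚ (suc h) ^ℚ suc s * (k ^ℚ s * q ^ℚ ρ)
  fullRank-expectation {h} {s} {ρ} D 0≤k bound = begin
    cnt * p ^ℚ s ≡⟨ cong (_* p ^ℚ s) (*-identityʳ cnt) ⟨
    cnt * 1ℚ * p ^ℚ s ≡⟨ cong (λ x → cnt * x * p ^ℚ s) (nq^≡1 (suc ρ)) ⟨
    cnt * (ℕ→ℚ n ^ℚ suc ρ * q ^ℚ suc ρ) * p ^ℚ s
      ≤⟨ *-monoʳ 0≤p^s (*-monoˡ 0≤cnt (*-monoʳ (0≤^ (suc ρ) 0≤q) (^-mono (suc ρ) (0≤ℕ→ℚ n) (ℕ→ℚ-mono {n} {suc h ℕ.* n} (ℕₚ.m≤m+n n (h ℕ.* n)))))) ⟩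
    cnt * (N ^ℚ suc ρ * q ^ℚ suc ρ) * p ^ℚ s ≡⟨ cong (_* p ^ℚ s) (*-assoc cnt (N ^ℚ suc ρ) (q ^ℚ suc ρ)) ⟨
    cnt * N ^ℚ suc ρ * q ^ℚ suc ρ * p ^ℚ s ≤⟨ *-monoʳ 0≤p^s (*-monoʳ (0≤^ (suc ρ) 0≤q) (bound (λ _ → 0ℤ) (suc h ℕ.* n))) ⟩
    N ^ℚ suc s * q ^ℚ suc ρ * p ^ℚ s
      ≡⟨ solve 5 (λ N Ns q qr ps → N :* Ns :* (q :* qr) :* ps := (N :* q) :* qr :* (Ns :* ps)) refl N (N ^ℚ s) q (q ^ℚ ρ) (p ^ℚ s) ⟩
    (N * q) * q ^ℚ ρ * (N ^ℚ s * p ^ℚ s) ≡⟨ cong ((N * q) * q ^ℚ ρ *_) (^-distrib-* N p s) ⟨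
    (N * q) * q ^ℚ ρ * (N * p) ^ℚ s ≡⟨ cong₂ (λ x y → x * q ^ℚ ρ * y ^ℚ s) Nq≡c Np≡ck ⟩
    c * q ^ℚ ρ * (c * k) ^ℚ s ≡⟨ cong (c * q ^ℚ ρ *_) (^-distrib-* c k s) ⟩
    c * q ^ℚ ρ * (c ^ℚ s * k ^ℚ s) ≡⟨ solve 4 (λ c qr cs ks → c :* qr :* (cs :* ks) := c :* cs :* (ks :* qr)) refl c (q ^ℚ ρ) (c ^ℚ s) (k ^ℚ s) ⟩
    c ^ℚ suc s * (k ^ℚ s * q ^ℚ ρ) ∎
    where
    open ≤-Reasoning
    N c cnt : ℚ
    N = ℕ→ℚ (suc h ℕ.* n)
    c = ℕ→ℚ (suc h)
    cnt = countSolutions D (λ _ → 0ℤ) (suc h ℕ.* n)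
    0≤p^s : 0ℚ ≤ p ^ℚ s
    0≤p^s = 0≤^ s (Probability.0≤p isProb)
    0≤cnt : 0ℚ ≤ cnt
    0≤cnt = 0≤∑ᵥ (suc h ℕ.* n) (suc s) (λ y → 0≤𝟙 (does (solves? D (λ _ → 0ℤ) y)))
    Nq≡c : N * q ≡ c
    Nq≡c = trans (cong (_* q) (ℕ→ℚ-* (suc h) n)) (trans (*-assoc c (ℕ→ℚ n) q) (trans (cong (c *_) nq≡1) (*-identityʳ c)))
    Np≡ck : N * p ≡ c * k
    Np≡ck = trans (cong (N *_) p≡kq) (trans (solve 3 (λ N k q → N :* (k :* q) := N :* q :* k) refl N k q) (cong (_* k) Nq≡c))

  -- Raising to the power g turns the admissibility condition into a comparison with ρ copies of the hypothesis on κ.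
  power-bound : ∀ {κ ε} g h s ρ → 0ℚ ≤ k → k ≤ κ → 1ℚ ≤ κ → 0ℚ < ε → ε ≤ 1ℚ →
    κ ^ℚ (h ℕ.* (suc g ℕ.+ 1)) ≤ ε ^ℚ suc g * ℕ→ℚ n ^ℚ suc g → suc g ℕ.* s ℕ.≤ h ℕ.* (suc g ℕ.+ 1) ℕ.* suc ρ →
    k ^ℚ s * q ^ℚ suc ρ ≤ ε
  power-bound {κ} {ε} g h s ρ 0≤k k≤κ 1≤κ 0<ε ε≤1 κ^H≤ adm = ^-cancel-≤ g (<⇒≤ 0<ε) (begin
    (k ^ℚ s * q ^ℚ suc ρ) ^ℚ suc g ≡⟨ ^-distrib-* (k ^ℚ s) (q ^ℚ suc ρ) (suc g) ⟩
    (k ^ℚ s) ^ℚ suc g * Q ≤⟨ *-monoʳ 0≤Q (^-mono (suc g) (0≤^ s 0≤k) (^-mono s 0≤k k≤κ)) ⟩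
    (κ ^ℚ s) ^ℚ suc g * Q ≡⟨ cong (_* Q) (trans (^-swap κ s (suc g)) (sym (^-* κ (suc g) s))) ⟩
    κ ^ℚ (suc g ℕ.* s) * Q ≤⟨ *-monoʳ 0≤Q (^-monoᵉ 1≤κ adm) ⟩
    κ ^ℚ (H ℕ.* suc ρ) * Q ≡⟨ cong (_* Q) (^-* κ H (suc ρ)) ⟩
    (κ ^ℚ H) ^ℚ suc ρ * Q ≤⟨ *-monoʳ 0≤Q (^-mono (suc ρ) (0≤^ H (≤-trans 0≤1 1≤κ)) κ^H≤) ⟩
    (δ * ℕ→ℚ n ^ℚ suc g) ^ℚ suc ρ * Q ≡⟨ cong (_* Q) (^-distrib-* δ (ℕ→ℚ n ^ℚ suc g) (suc ρ)) ⟩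
    δ ^ℚ suc ρ * (ℕ→ℚ n ^ℚ suc g) ^ℚ suc ρ * Q ≡⟨ *-assoc (δ ^ℚ suc ρ) ((ℕ→ℚ n ^ℚ suc g) ^ℚ suc ρ) Q ⟩
    δ ^ℚ suc ρ * ((ℕ→ℚ n ^ℚ suc g) ^ℚ suc ρ * Q) ≡⟨ cong (δ ^ℚ suc ρ *_) cancel ⟩
    δ ^ℚ suc ρ * 1ℚ ≡⟨ *-identityʳ (δ ^ℚ suc ρ) ⟩
    δ * δ ^ℚ ρ ≤⟨ *-monoˡ 0≤δ (^≤1 ρ 0≤δ (^≤1 (suc g) (<⇒≤ 0<ε) ε≤1)) ⟩
    δ * 1ℚ ≡⟨ *-identityʳ δ ⟩
    δ ∎)
    where
    open ≤-Reasoning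
    H = h ℕ.* (suc g ℕ.+ 1)
    Q δ : ℚ
    Q = (q ^ℚ suc ρ) ^ℚ suc g
    δ = ε ^ℚ suc g
    0≤Q : 0ℚ ≤ Q
    0≤Q = 0≤^ (suc g) (0≤^ (suc ρ) 0≤q)
    0≤δ : 0ℚ ≤ δ
    0≤δ = 0≤^ (suc g) (<⇒≤ 0<ε)
    cancel : (ℕ→ℚ n ^ℚ suc g) ^ℚ suc ρ * Q ≡ 1ℚ
    cancel = trans (cong₂ _*_ (sym (^-* (ℕ→ℚ n) (suc g) (suc ρ))) (trans (^-swap q (suc ρ) (suc g)) (sym (^-* q (suc g) (suc ρ)))))
      (nq^≡1 (suc g ℕ.* suc ρ))

n≤n^ : ∀ n g → 1 ℕ.≤ n → ℕ→ℚ n ≤ ℕ→ℚ n ^ℚ suc g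
n≤n^ n g 1≤n = subst (_≤ ℕ→ℚ n ^ℚ suc g) (*-identityʳ (ℕ→ℚ n)) (*-monoˡ (0≤ℕ→ℚ n) (1≤^ g (ℕ→ℚ-mono {1} {n} 1≤n)))

eventually-large : ∀ g {δ} → 0ℚ < δ → ∀ B → Eventually (λ n → B ≤ δ * ℕ→ℚ n ^ℚ suc g)
eventually-large g {δ} 0<δ B = let d , 0<d , δd≡1 = inverse 0<δ
                                   N , large = archimedes (B * d)
  in suc N , λ n n> → ≤-trans (≤-reflexive (sym (trans (solve 3 (λ δ B d → δ :* (B :* d) := B :* (δ :* d)) refl δ B d)
       (trans (cong (B *_) δd≡1) (*-identityʳ B)))))
     (*-monoˡ {δ} {B * d} {ℕ→ℚ n ^ℚ suc g} (<⇒≤ 0<δ) (≤-trans (large n (ℕₚ.<⇒≤ n>)) (n≤n^ n g (ℕₚ.≤-trans (ℕ.s≤s ℕ.z≤n) n>))))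

capped : ∀ {ε} → 0ℚ < ε → ∃[ η ] (0ℚ < η × η ≤ 1ℚ × η ≤ ε)
capped {ε} 0<ε = cases (≤-total ε 1ℚ)
  where
  cases : ε ≤ 1ℚ ⊎ 1ℚ ≤ ε → ∃[ η ] (0ℚ < η × η ≤ 1ℚ × η ≤ ε)
  cases (inj₁ ε≤1) = ε , 0<ε , ε≤1 , ≤-refl
  cases (inj₂ 1≤ε) = 1ℚ , 0<1 , ≤-refl , 1≤ε

module _ (h g : ℕ) (k : ℕ → ℚ) (bounds : ∀ n → (0ℚ ≤ k n) × (k n ≤ ℕ→ℚ n)) where

  scaled : ∀ n → 1 ℕ.≤ n → Scaled n (k n) (pOf n (k n)) (qOf n)
  scaled n = pOf-scaled n (k n) (proj₁ (bounds n)) (proj₂ (bounds n))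

  -- In this module `g` is the predecessor of the parameter in the theorem: the property under study
  -- is that with bound `suc g`.
  Sparse : Set
  Sparse = ∀ ε → 0ℚ < ε → Eventually (λ n → (k n ^ℚ (h ℕ.* (suc g ℕ.+ 1))) ≤ ε * (ℕ→ℚ n ^ℚ suc g))

  module _ (1≤h : 1 ℕ.≤ h) (sparse : Sparse) where

    -- Comparing powers with different exponents needs a base of at least 1, so `power-bound` is
    -- applied with κ = max(k, 1). For κ = 1 its hypothesis becomes 1 ≤ (η n)^(g+1), true for large
    -- n.
    Small-term : ∀ s ρ → suc g ℕ.* s ℕ.≤ h ℕ.* (suc g ℕ.+ 1) ℕ.* suc ρ → Small (λ n → k n ^ℚ s * qOf n ^ℚ suc ρ)
    Small-term s ρ adm ε 0<ε =
      let η , 0<η , η≤1 , η≤ε = capped 0<ε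
          δ = η ^ℚ suc g
          0<δ = 0<^ (suc g) 0<η
      in Eventually-map (λ n (k≤ , 1≤ , 1≤n) → ≤-trans (bound n η 0<η η≤1 k≤ 1≤ 1≤n (≤-total (k n) 1ℚ)) η≤ε)
           (Eventually-× (sparse δ 0<δ) (Eventually-× (eventually-large g 0<δ 1ℚ) (1 , λ n 1≤n → 1≤n)))
      where
      H = h ℕ.* (suc g ℕ.+ 1)
      bound : ∀ n η → 0ℚ < η → η ≤ 1ℚ → k n ^ℚ H ≤ η ^ℚ suc g * ℕ→ℚ n ^ℚ suc g → 1ℚ ≤ η ^ℚ suc g * ℕ→ℚ n ^ℚ suc g →
        1 ℕ.≤ n → k n ≤ 1ℚ ⊎ 1ℚ ≤ k n → k n ^ℚ s * qOf n ^ℚ suc ρ ≤ η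
      bound n η 0<η η≤1 k≤ 1≤ 1≤n (inj₁ kn≤1) = power-bound (scaled n 1≤n) g h s ρ (proj₁ (bounds n)) kn≤1 ≤-refl 0<η η≤1
        (≤-trans (≤-reflexive (1^ H)) 1≤) adm
      bound n η 0<η η≤1 k≤ 1≤ 1≤n (inj₂ 1≤kn) = power-bound (scaled n 1≤n) g h s ρ (proj₁ (bounds n)) ≤-refl 1≤kn 0<η η≤1 k≤ adm

    private
      term : ∀ s l → Vec (Vec ℤ (suc s)) l → ℕ → ℚ
      term s l M n = ℕ→ℚ (suc h) ^ℚ suc s * (k n ^ℚ s * qOf n ^ℚ (l ℕ.∸ 1))

      Small-term′ : ∀ s l M → Admissible h (suc g) s l → Small (term s l M)
      Small-term′ s (suc (suc ρ)) M (_ , adm) = Small-*ˡ (ℕ→ℚ (suc h) ^ℚ suc s) (0<^ (suc s) (0<ℕ→ℚ-suc h)) (Small-term s ρ adm)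
      Small-term′ s (suc zero) M (ℕ.s≤s () , adm)

    -- First moment method: each subset either has the property or contributes at least 1 to `bad`,
    -- so the failure probability is at most the expectation of `bad`.
    failure-≤ : ∀ n → 1 ℕ.≤ n → 1ℚ - probBhg h (suc g) n (pOf n (k n)) ≤ patternSum h (suc g) (λ s l M → term s l M n)
    failure-≤ n 1≤n = begin
      1ℚ - probBhg h (suc g) n p ≡⟨ cong (λ x → 1ℚ - x) (probBhg≡E h (suc g) n p) ⟩
      1ℚ - E p good ≡⟨ cong (λ x → x - E p good) (E-const {n} p 1ℚ) ⟨
      E {n} p (λ _ → 1ℚ) - E p good ≤⟨ +-monoˡ-≤ (- E p good) (E-mono P covered) ⟩
      E p (λ A → good A + bad A) - E p good ≡⟨ cong (λ x → x - E p good) (E-+ p good bad) ⟩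
      (E p good + E p bad) - E p good ≡⟨ solve 2 (λ a b → (a :+ b) :- a := b) refl (E p good) (E p bad) ⟩
      E p bad ≡⟨ E-patternSum {h} {suc g} {n} p (λ s l M → solutionsIn (lookup M) N) ⟩
      patternSum h (suc g) (λ s l M → E {n} p (solutionsIn (lookup M) N)) ≤⟨ patternSum-mono {h} {suc g} term-≤ ⟩
      patternSum h (suc g) (λ s l M → term s l M n) ∎
      where
      open ≤-Reasoning
      N = suc h ℕ.* n
      p : ℚ
      p = pOf n (k n)
      P = Scaled.isProb (scaled n 1≤n)
      good bad : Vec Bool n → ℚ
      good A = 𝟙 (does (isBhg? h (suc g) n A))
      bad A = patternSum h (suc g) (λ s l M → solutionsIn (lookup M) N A)
      0≤bad : ∀ A → 0ℚ ≤ bad A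
      0≤bad A = 0≤∑ (upTo (suc (h ℕ.* (suc g ℕ.+ 1)))) λ s → 0≤∑ (upTo (suc (suc (suc g)))) λ l → 0≤∑ (matrices h s l) λ M →
        0≤restrict (admissible? h (suc g) s l) (fullRank-or-dependent (lookup M)) (0≤∑ᵥ N (suc s) (0≤solutionWeight (lookup M) N A))
      covered : ∀ A → 1ℚ ≤ good A + bad A
      covered A = cases (isBhg? h (suc g) n A)
        where
        cases : (d : Dec (IsBhg h (suc g) n A)) → 1ℚ ≤ 𝟙 (does d) + bad A
        cases (yes _) = a≤a+b (0≤bad A)
        cases (no ¬B) = let m , m∈ , many = find (Allₚ.¬All⇒Any¬ (λ m → solutions h (elems A) m ℕ.≤? suc g) (range h (n ℕ.* h)) ¬B) in
          ≤-trans (crowded {h} {suc g} {n} 1≤h (ℕ.s≤s ℕ.z≤n) 1≤n A (range-≤ h n 1≤n m∈) many) (b≤a+b ≤-refl)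
      term-≤ : ∀ s l M → FullRankBound (lookup M) → Admissible h (suc g) s l → E {n} p (solutionsIn (lookup M) N) ≤ term s l M n
      term-≤ s (suc ρ) M bound adm = ≤-trans (E-solutionsIn (lookup M) N {n} P) (fullRank-expectation (scaled n 1≤n) {h} (lookup M) (proj₁ (bounds n)) bound)
      term-≤ s zero M bound (() , _)

    failure-small : Small (λ n → 1ℚ - probBhg h (suc g) n (pOf n (k n)))
    failure-small = Small-mono (1 , failure-≤) (Small-patternSum {h} {suc g} Small-term′)

-- moments of the number of structured solutions

unique-++ˡ : ∀ {xs ys : List X} → Unique (xs ++ ys) → Unique xs
unique-++ˡ {xs = []} _ = []
unique-++ˡ {xs = x ∷ xs} (x∉ ∷ u) = Allₚ.++⁻ˡ xs x∉ ∷ unique-++ˡ u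

unique-++ʳ : ∀ (xs : List X) {ys} → Unique (xs ++ ys) → Unique ys
unique-++ʳ [] u = u
unique-++ʳ (x ∷ xs) (_ ∷ u) = unique-++ʳ xs u

unique-++-∉ : ∀ {xs ys : List X} {x} → Unique (xs ++ ys) → x ∈ xs → x ∉ ys
unique-++-∉ {xs = x ∷ xs} (x∉ ∷ u) (here refl) x∈ys = All.lookup (Allₚ.++⁻ʳ xs x∉) x∈ys refl
unique-++-∉ (_ ∷ u) (there x∈) = unique-++-∉ u x∈

Row : Set
Row = ℕ × List ℕ

classes : Row → List ℕ
classes (e , cs) = e ∷ cs

module Slots (M L : ℕ) where

  slot : ℕ → ℕ → ℕ
  slot c y = c ℕ.+ y ℕ.* suc M

  slot-class : ∀ {c c′} y y′ → c ℕ.≤ M → c′ ℕ.≤ M → slot c y ≡ slot c′ y′ → c ≡ c′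
  slot-class {c} {c′} y y′ c≤ c′≤ eq = trans (sym (residue c y c≤)) (trans (cong (DivMod._% suc M) eq) (residue c′ y′ c′≤))
    where
    residue : ∀ c y → c ℕ.≤ M → slot c y DivMod.% suc M ≡ c
    residue c y c≤ = trans (DivMod.[m+kn]%n≡m%n c y (suc M)) (DivMod.m<n⇒m%n≡m (ℕ.s≤s c≤))

  slot-injective : ∀ c {y y′} → slot c y ≡ slot c y′ → y ≡ y′
  slot-injective c {y} {y′} eq = ℕₚ.*-cancelʳ-≡ y y′ (suc M) (ℕₚ.+-cancelˡ-≡ c _ _ eq)

  -- A choice u in a class of cs contributes the quotient L − u and raises the quotient of the last class e by u, so the
  -- total does not depend on the choices.
  chain : ∀ {n} → Vec Bool n → List ℕ → ℕ → ℕ → ℚ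
  chain A [] e s = at A (slot e s)
  chain A (c ∷ cs) e s = ∑ (upTo L) (λ u → at A (slot c (L ℕ.∸ u)) * chain A cs e (s ℕ.+ u))

  0≤chain : ∀ {n} (A : Vec Bool n) cs e s → 0ℚ ≤ chain A cs e s
  0≤chain A [] e s = 0≤at A _
  0≤chain A (c ∷ cs) e s = 0≤∑ (upTo L) (λ u → 0≤* (0≤at A (slot c (L ℕ.∸ u))) (0≤chain A cs e (s ℕ.+ u)))

  ClassFree : ∀ {n} → ℕ → (Vec Bool n → ℚ) → Set
  ClassFree c f = ∀ y → Free (slot c y) f

  chain-free : ∀ {n c} cs e s → c ℕ.≤ M → e ℕ.≤ M → All (ℕ._≤ M) cs → c ≢ e → c ∉ cs → ClassFree {n} c (λ A → chain A cs e s)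
  chain-free [] e s c≤ e≤ _ c≢e _ y = at-free (λ eq → c≢e (slot-class y s c≤ e≤ eq))
  chain-free (c′ ∷ cs) e s c≤ e≤ (c′≤ ∷ cs≤) c≢e c∉ y = ∑-free (upTo L) (λ u →
    *-free (at-free (λ eq → c∉ (here (slot-class y (L ℕ.∸ u) c≤ c′≤ eq)))) (chain-free cs e (s ℕ.+ u) c≤ e≤ cs≤ c≢e (c∉ ∘ there) y))

  rowsProduct : ∀ {n} → Vec Bool n → List Row → ℕ → ℚ
  rowsProduct A [] s = 1ℚ
  rowsProduct A ((e , cs) ∷ rs) s = chain A cs e s * rowsProduct A rs s

  0≤rowsProduct : ∀ {n} (A : Vec Bool n) rs s → 0ℚ ≤ rowsProduct A rs s
  0≤rowsProduct A [] s = 0≤1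
  0≤rowsProduct A ((e , cs) ∷ rs) s = 0≤* (0≤chain A cs e s) (0≤rowsProduct A rs s)

  rowsProduct-free : ∀ {n c} rs s → c ℕ.≤ M → All (ℕ._≤ M) (concat (map classes rs)) → c ∉ concat (map classes rs) →
    ClassFree {n} c (λ A → rowsProduct A rs s)
  rowsProduct-free [] s c≤ _ _ y b A = refl
  rowsProduct-free ((e , cs) ∷ rs) s c≤ (e≤ ∷ all≤) c∉ y = *-free
    (chain-free cs e s c≤ e≤ (Allₚ.++⁻ˡ cs all≤) (c∉ ∘ here) (c∉ ∘ there ∘ ∈-++⁺ˡ) y)
    (rowsProduct-free rs s c≤ (Allₚ.++⁻ʳ cs all≤) (c∉ ∘ there ∘ ∈-++⁺ʳ cs) y)

  -- The random variable of the second moment argument. A row with d free classes has total quotient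
  -- s + d L whatever its choices, so rows with the same d and the same sum of classes share their
  -- total for each s.
  structured : ∀ {n} → Vec Bool n → List Row → ℚ
  structured A rs = ∑ (upTo L) (rowsProduct A rs)

  module Moments {n : ℕ} {p : ℚ} (P : Probability p) where

    z : ℚ
    z = ℕ→ℚ L * p

    -- The mean number of solutions of a row with `d` free classes at a fixed total; `z` is the mean
    -- number of available elements among L quotients of one class.
    μ : ℕ → ℚ
    μ d = p * z ^ℚ d

    module _ {B : ℕ} (inRange : ∀ {c y} → c ℕ.≤ M → y ℕ.≤ B → slot c y ℕ.< n) (L≤B : L ℕ.≤ B) where

      -- The classes are distinct, so the memberships factor out one at a time: a free class gives L
      -- choices of probability p each, and the last class, whose quotient is forced, gives a single
      -- p.
      E-chain : ∀ cs e s {f : Vec Bool n → ℚ} → Unique (e ∷ cs) → All (ℕ._≤ M) (e ∷ cs) → s ℕ.+ length cs ℕ.* L ℕ.≤ B →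
        (∀ {c} → c ∈ e ∷ cs → ClassFree c f) → E p (λ A → chain A cs e s * f A) ≡ μ (length cs) * E p f
      E-chain [] e s {f} _ (e≤ ∷ _) s≤ free = trans
        (E-at p (inRange e≤ (subst (ℕ._≤ B) (ℕₚ.+-identityʳ s) s≤)) (free (here refl) s)) (cong (_* E p f) (sym (*-identityʳ p)))
      E-chain (c ∷ cs) e s {f} ((e≢c ∷ e∉) ∷ c∉ ∷ uniq) (e≤ ∷ c≤ ∷ cs≤) s≤ free = begin
        E p (λ A → chain A (c ∷ cs) e s * f A) ≡⟨ E-cong p (λ A → sym (∑-*ʳ (upTo L) (f A) (λ u → at A (slot c (L ℕ.∸ u)) * chain A cs e (s ℕ.+ u)))) ⟩
        E p (λ A → ∑ (upTo L) (λ u → at A (slot c (L ℕ.∸ u)) * chain A cs e (s ℕ.+ u) * f A))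
          ≡⟨ E-∑ p (upTo L) (λ u A → at A (slot c (L ℕ.∸ u)) * chain A cs e (s ℕ.+ u) * f A) ⟩
        ∑ (upTo L) (λ u → E p (λ A → at A (slot c (L ℕ.∸ u)) * chain A cs e (s ℕ.+ u) * f A)) ≡⟨ ∑-cong∈ (upTo L) step ⟩
        ∑ (upTo L) (λ u → p * (μ (length cs) * E p f)) ≡⟨ ∑-const (upTo L) (p * (μ (length cs) * E p f)) ⟩
        ℕ→ℚ (length (upTo L)) * (p * (μ (length cs) * E p f)) ≡⟨ cong (λ l → ℕ→ℚ l * (p * (μ (length cs) * E p f))) (length-upTo L) ⟩
        ℕ→ℚ L * (p * (p * z ^ℚ length cs * E p f))
          ≡⟨ solve 4 (λ l p Z Ef → l :* (p :* (p :* Z :* Ef)) := p :* ((l :* p) :* Z) :* Ef) refl (ℕ→ℚ L) p (z ^ℚ length cs) (E p f) ⟩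
        μ (suc (length cs)) * E p f ∎
        where
        open ≡-Reasoning
        step : ∀ {u} → u ∈ upTo L → E p (λ A → at A (slot c (L ℕ.∸ u)) * chain A cs e (s ℕ.+ u) * f A) ≡ p * (μ (length cs) * E p f)
        step {u} u∈ = trans (E-cong p (λ A → *-assoc (at A (slot c (L ℕ.∸ u))) (chain A cs e (s ℕ.+ u)) (f A)))
          (trans (E-at p (inRange c≤ (ℕₚ.≤-trans (ℕₚ.m∸n≤m L u) L≤B))
                   (*-free (chain-free cs e (s ℕ.+ u) c≤ e≤ cs≤ (e≢c ∘ sym) (λ c∈ → All.lookup c∉ c∈ refl) (L ℕ.∸ u)) (free (there (here refl)) (L ℕ.∸ u))))
            (cong (p *_) (E-chain cs e (s ℕ.+ u) (e∉ ∷ uniq) (e≤ ∷ cs≤)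
              (ℕₚ.≤-trans (subst (ℕ._≤ s ℕ.+ (L ℕ.+ length cs ℕ.* L)) (sym (ℕₚ.+-assoc s u _))
                (ℕₚ.+-monoʳ-≤ s (ℕₚ.+-monoˡ-≤ (length cs ℕ.* L) (ℕₚ.<⇒≤ (∈-upTo⁻ u∈))))) s≤)
              (λ { (here eq) → free (here eq) ; (there c∈) → free (there (there c∈)) }))))

      E-rowsProduct : ∀ d rs s → Unique (concat (map classes rs)) → All (ℕ._≤ M) (concat (map classes rs)) →
        All (λ r → length (proj₂ r) ≡ d) rs → s ℕ.+ d ℕ.* L ℕ.≤ B → E {n} p (λ A → rowsProduct A rs s) ≡ μ d ^ℚ length rs
      E-rowsProduct d [] s _ _ _ _ = E-const {n} p 1ℚ
      E-rowsProduct d ((e , cs) ∷ rs) s uniq all≤ (refl ∷ lens) s≤ = trans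
        (E-chain cs e s (unique-++ˡ uniq) (Allₚ.++⁻ˡ (e ∷ cs) all≤) s≤
          (λ c∈ → rowsProduct-free rs s (All.lookup (Allₚ.++⁻ˡ (e ∷ cs) all≤) c∈) (Allₚ.++⁻ʳ (e ∷ cs) all≤) (unique-++-∉ uniq c∈)))
        (cong (μ d *_) (E-rowsProduct d rs s (unique-++ʳ (e ∷ cs) uniq) (Allₚ.++⁻ʳ (e ∷ cs) all≤) lens s≤))

      E-structured : ∀ d rs → Unique (concat (map classes rs)) → All (ℕ._≤ M) (concat (map classes rs)) →
        All (λ r → length (proj₂ r) ≡ d) rs → L ℕ.+ d ℕ.* L ℕ.≤ B → E {n} p (λ A → structured A rs) ≡ ℕ→ℚ L * μ d ^ℚ length rs
      E-structured d rs uniq all≤ lens le = trans (E-∑ {n = n} p (upTo L) (λ s A → rowsProduct A rs s))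
        (trans (∑-cong∈ (upTo L) (λ s∈ → E-rowsProduct d rs _ uniq all≤ lens (ℕₚ.≤-trans (ℕₚ.+-monoˡ-≤ (d ℕ.* L) (ℕₚ.<⇒≤ (∈-upTo⁻ s∈))) le)))
          (trans (∑-const (upTo L) (μ d ^ℚ length rs)) (cong (λ l → ℕ→ℚ l * μ d ^ℚ length rs) (length-upTo L))))

    -- A bound for the joint expectation of two chains of one row with parameters s and s′. Elements
    -- in equal positions coincide exactly when their quotients do, so the classes themselves drop
    -- out.
    correlation : ℕ → ℕ → ℕ → ℚ
    correlation zero s s′ = pairProb p s s′
    correlation (suc d) s s′ = ∑ (upTo L) (λ u → ∑ (upTo L) (λ v → pairProb p u v * correlation d (s ℕ.+ u) (s′ ℕ.+ v)))

    0≤pairProb : ∀ x y → 0ℚ ≤ pairProb p x y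
    0≤pairProb x y with x ℕ.≟ y
    ... | yes _ = Probability.0≤p P
    ... | no _ = 0≤* (Probability.0≤p P) (Probability.0≤p P)

    0≤correlation : ∀ d s s′ → 0ℚ ≤ correlation d s s′
    0≤correlation zero s s′ = 0≤pairProb s s′
    0≤correlation (suc d) s s′ = 0≤∑ (upTo L) (λ u → 0≤∑ (upTo L) (λ v → 0≤* (0≤pairProb u v) (0≤correlation d (s ℕ.+ u) (s′ ℕ.+ v))))

    pairProb-cong : ∀ {x y x′ y′} → (x ≡ y → x′ ≡ y′) → (x′ ≡ y′ → x ≡ y) → pairProb p x y ≡ pairProb p x′ y′
    pairProb-cong {x} {y} {x′} {y′} to from with x ℕ.≟ y | x′ ℕ.≟ y′
    ... | yes _ | yes _ = refl
    ... | no _ | no _ = refl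
    ... | yes eq | no ne = ⊥-elim (ne (to eq))
    ... | no ne | yes eq = ⊥-elim (ne (from eq))

    E-chain² : ∀ cs e s s′ {f : Vec Bool n → ℚ} → (∀ A → 0ℚ ≤ f A) → Unique (e ∷ cs) → All (ℕ._≤ M) (e ∷ cs) →
      (∀ {c} → c ∈ e ∷ cs → ClassFree c f) →
      E p (λ A → chain A cs e s * chain A cs e s′ * f A) ≤ correlation (length cs) s s′ * E p f
    E-chain² [] e s s′ {f} 0≤f _ _ free = subst (λ w → E p (λ A → at A (slot e s) * at A (slot e s′) * f A) ≤ w * E p f)
      (pairProb-cong {slot e s} {slot e s′} {s} {s′} (slot-injective e) (cong (slot e)))
      (E-at-at-≤ P 0≤f (free (here refl) s) (free (here refl) s′))
    E-chain² (c ∷ cs) e s s′ {f} 0≤f ((e≢c ∷ e∉) ∷ c∉ ∷ uniq) (e≤ ∷ c≤ ∷ cs≤) free = begin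
      E p (λ A → chain A (c ∷ cs) e s * chain A (c ∷ cs) e s′ * f A) ≡⟨ E-cong p expand ⟩
      E p (λ A → ∑ (upTo L) (λ u → ∑ (upTo L) (λ v → term u v A))) ≡⟨ E-∑ p (upTo L) (λ u A → ∑ (upTo L) (λ v → term u v A)) ⟩
      ∑ (upTo L) (λ u → E p (λ A → ∑ (upTo L) (λ v → term u v A))) ≡⟨ ∑-cong (upTo L) (λ u → E-∑ p (upTo L) (term u)) ⟩
      ∑ (upTo L) (λ u → ∑ (upTo L) (λ v → E p (term u v))) ≤⟨ ∑-mono∈ (upTo L) (λ u∈ → ∑-mono∈ (upTo L) (λ v∈ → step u∈ v∈)) ⟩
      ∑ (upTo L) (λ u → ∑ (upTo L) (λ v → w u v * E p f)) ≡⟨ ∑-cong (upTo L) (λ u → ∑-*ʳ (upTo L) (E p f) (w u)) ⟩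
      ∑ (upTo L) (λ u → ∑ (upTo L) (w u) * E p f) ≡⟨ ∑-*ʳ (upTo L) (E p f) (λ u → ∑ (upTo L) (w u)) ⟩
      correlation (suc (length cs)) s s′ * E p f ∎
      where
      open ≤-Reasoning
      x : Vec Bool n → ℕ → ℚ
      x A u = at A (slot c (L ℕ.∸ u))
      r r′ : Vec Bool n → ℕ → ℚ
      r A u = chain A cs e (s ℕ.+ u)
      r′ A v = chain A cs e (s′ ℕ.+ v)
      term : ℕ → ℕ → Vec Bool n → ℚ
      term u v A = x A u * x A v * (r A u * r′ A v * f A)
      w : ℕ → ℕ → ℚ
      w u v = pairProb p u v * correlation (length cs) (s ℕ.+ u) (s′ ℕ.+ v)
      expand : ∀ A → chain A (c ∷ cs) e s * chain A (c ∷ cs) e s′ * f A ≡ ∑ (upTo L) (λ u → ∑ (upTo L) (λ v → term u v A))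
      expand A = trans (cong (_* f A) (∑-* (upTo L) (upTo L) (λ u → x A u * r A u) (λ v → x A v * r′ A v)))
        (trans (sym (∑-*ʳ (upTo L) (f A) (λ u → ∑ (upTo L) (λ v → x A u * r A u * (x A v * r′ A v)))))
        (∑-cong (upTo L) (λ u → trans (sym (∑-*ʳ (upTo L) (f A) (λ v → x A u * r A u * (x A v * r′ A v))))
          (∑-cong (upTo L) (λ v → solve 5 (λ a b c d f → a :* b :* (c :* d) :* f := a :* c :* (b :* d :* f)) refl (x A u) (r A u) (x A v) (r′ A v) (f A))))))
      rest-free : ∀ s → ClassFree {n} c (λ A → chain A cs e s)
      rest-free s = chain-free cs e s c≤ e≤ cs≤ (e≢c ∘ sym) (λ c∈ → All.lookup c∉ c∈ refl)
      g-free : ∀ u v → ClassFree c (λ A → r A u * r′ A v * f A)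
      g-free u v y = *-free (*-free (rest-free (s ℕ.+ u) y) (rest-free (s′ ℕ.+ v) y)) (free (there (here refl)) y)
      step : ∀ {u v} → u ∈ upTo L → v ∈ upTo L → E p (term u v) ≤ w u v * E p f
      step {u} {v} u∈ v∈ = begin
        E p (term u v) ≤⟨ E-at-at-≤ P (λ A → 0≤* (0≤* (0≤chain A cs e (s ℕ.+ u)) (0≤chain A cs e (s′ ℕ.+ v))) (0≤f A)) (g-free u v (L ℕ.∸ u)) (g-free u v (L ℕ.∸ v)) ⟩
        pairProb p (slot c (L ℕ.∸ u)) (slot c (L ℕ.∸ v)) * E p (λ A → r A u * r′ A v * f A)
          -- For u and v below L the subtraction is never truncated, so equal slots force u = v.
          ≡⟨ cong (_* E p (λ A → r A u * r′ A v * f A)) (pairProb-cong {slot c (L ℕ.∸ u)} {slot c (L ℕ.∸ v)} {u} {v}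
               (λ eq → ℕₚ.∸-cancelˡ-≡ (ℕₚ.<⇒≤ (∈-upTo⁻ u∈)) (ℕₚ.<⇒≤ (∈-upTo⁻ v∈)) (slot-injective c eq)) (cong (λ u → slot c (L ℕ.∸ u)))) ⟩
        pairProb p u v * E p (λ A → r A u * r′ A v * f A)
          ≤⟨ *-monoˡ (0≤pairProb u v) (E-chain² cs e (s ℕ.+ u) (s′ ℕ.+ v) 0≤f (e∉ ∷ uniq) (e≤ ∷ cs≤) (λ { (here eq) → free (here eq) ; (there c∈) → free (there (there c∈)) })) ⟩
        pairProb p u v * (correlation (length cs) (s ℕ.+ u) (s′ ℕ.+ v) * E p f) ≡⟨ *-assoc (pairProb p u v) _ (E p f) ⟨
        w u v * E p f ∎

    E-rowsProduct² : ∀ d rs s s′ → Unique (concat (map classes rs)) → All (ℕ._≤ M) (concat (map classes rs)) → All (λ r → length (proj₂ r) ≡ d) rs →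
      E {n} p (λ A → rowsProduct A rs s * rowsProduct A rs s′) ≤ correlation d s s′ ^ℚ length rs
    E-rowsProduct² d [] s s′ _ _ _ = ≤-reflexive (E-const {n} p 1ℚ)
    E-rowsProduct² d ((e , cs) ∷ rs) s s′ uniq all≤ (refl ∷ lens) = begin
      E {n} p (λ A → chain A cs e s * rowsProduct A rs s * (chain A cs e s′ * rowsProduct A rs s′))
        ≡⟨ E-cong {n} p (λ A → solve 4 (λ a b c d → a :* b :* (c :* d) := a :* c :* (b :* d)) refl (chain A cs e s) (rowsProduct A rs s) (chain A cs e s′) (rowsProduct A rs s′)) ⟩
      E {n} p (λ A → chain A cs e s * chain A cs e s′ * (rowsProduct A rs s * rowsProduct A rs s′))
        ≤⟨ E-chain² cs e s s′ (λ A → 0≤* (0≤rowsProduct A rs s) (0≤rowsProduct A rs s′)) (unique-++ˡ uniq) (Allₚ.++⁻ˡ (e ∷ cs) all≤)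
             (λ c∈ y → *-free (rows-free s c∈ y) (rows-free s′ c∈ y)) ⟩
      correlation d s s′ * E {n} p (λ A → rowsProduct A rs s * rowsProduct A rs s′)
        ≤⟨ *-monoˡ (0≤correlation d s s′) (E-rowsProduct² d rs s s′ (unique-++ʳ (e ∷ cs) uniq) (Allₚ.++⁻ʳ (e ∷ cs) all≤) lens) ⟩
      correlation d s s′ * correlation d s s′ ^ℚ length rs ∎
      where
      open ≤-Reasoning
      rows-free : ∀ s {c} → c ∈ e ∷ cs → ClassFree {n} c (λ A → rowsProduct A rs s)
      rows-free s c∈ = rowsProduct-free rs s (All.lookup (Allₚ.++⁻ˡ (e ∷ cs) all≤) c∈) (Allₚ.++⁻ʳ (e ∷ cs) all≤) (unique-++-∉ uniq c∈)

-- Bounds for correlations and the second moment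

module CorrelationBound (M L : ℕ) {n : ℕ} {p : ℚ} (P : Probability p) where

  open Slots M L
  open Moments {n} P
  open Probability P renaming (0≤p to p≥0; p≤1 to p≤one)

  -- The correlation bound for s ≠ s′. The factor z² + z bounds the double sum of `pairProb`,
  -- diagonal included. The last term is p² · L · μ d: for each of the L choices u at most one v
  -- makes the shifted parameters equal, and there the shorter chains may have the excess μ d.
  α : ℕ → ℚ
  α zero = p * p
  α (suc d) = (z * z + z) * α d + p * p * z ^ℚ suc d

  δ : ℕ → ℕ → ℚ
  δ s s′ = 𝟙 (does (s ℕ.≟ s′))

  pp≥0 : 0ℚ ≤ p * p
  pp≥0 = 0≤* p≥0 p≥0

  z≥0 : 0ℚ ≤ z
  z≥0 = 0≤* (0≤ℕ→ℚ L) p≥0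

  0≤α : ∀ d → 0ℚ ≤ α d
  0≤α zero = pp≥0
  0≤α (suc d) = 0≤+ (0≤* (0≤+ (0≤* z≥0 z≥0) z≥0) (0≤α d)) (0≤* pp≥0 (0≤^ (suc d) z≥0))

  0≤μ : ∀ d → 0ℚ ≤ μ d
  0≤μ d = 0≤* p≥0 (0≤^ d z≥0)

  pairProb-≤p : ∀ x y → pairProb p x y ≤ p
  pairProb-≤p x y with x ℕ.≟ y
  ... | yes _ = ≤-refl
  ... | no _ = ≤-trans (*-monoˡ {p} {p} {1ℚ} p≥0 p≤one) (≤-reflexive (*-identityʳ p))

  pairProb-≢ : ∀ {x y} → x ≢ y → pairProb p x y ≡ p * p
  pairProb-≢ {x} {y} x≢y with x ℕ.≟ y
  ... | yes x≡y = ⊥-elim (x≢y x≡y)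
  ... | no _ = refl

  pairProb-≤ : ∀ x y → pairProb p x y ≤ p * p + δ x y * p
  pairProb-≤ x y = cases (x ℕ.≟ y)
    where
    cases : (d : Dec (x ≡ y)) → pairProb p x y ≤ p * p + 𝟙 (does d) * p
    cases (yes _) = ≤-trans (pairProb-≤p x y) (≤-trans (≤-reflexive (sym (*-identityˡ p))) (b≤a+b pp≥0))
    cases (no x≢y) = ≤-trans (≤-reflexive (pairProb-≢ x≢y)) (a≤a+b (0≤* ≤-refl p≥0))

  ∑-δ : ∀ a b → ∑ (upTo L) (λ v → δ a (b ℕ.+ v)) ≤ 1ℚ
  ∑-δ a b = ∑-𝟙-unique (λ v → a ℕ.≟ b ℕ.+ v) (yes (refl {x = 0})) (Unique.upTo⁺ L) (λ _ → refl)
    (λ {v} {v′} eq eq′ → ℕₚ.+-cancelˡ-≡ b v v′ (trans (sym eq) eq′))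

  ∑-upTo-const : ∀ c → ∑ (upTo L) (λ _ → c) ≡ ℕ→ℚ L * c
  ∑-upTo-const c = trans (∑-const (upTo L) c) (cong (λ l → ℕ→ℚ l * c) (length-upTo L))

  ∑∑-pairProb : ∑ (upTo L) (λ u → ∑ (upTo L) (pairProb p u)) ≤ z * z + z
  ∑∑-pairProb = begin
    ∑ (upTo L) (λ u → ∑ (upTo L) (pairProb p u)) ≤⟨ ∑-mono (upTo L) inner ⟩
    ∑ (upTo L) (λ u → ℓ * (p * p) + p) ≡⟨ ∑-upTo-const (ℓ * (p * p) + p) ⟩
    ℓ * (ℓ * (p * p) + p) ≡⟨ solve 2 (λ l p → l :* (l :* (p :* p) :+ p) := (l :* p) :* (l :* p) :+ l :* p) refl ℓ p ⟩
    z * z + z ∎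
    where
    open ≤-Reasoning
    ℓ : ℚ
    ℓ = ℕ→ℚ L
    inner : ∀ u → ∑ (upTo L) (pairProb p u) ≤ ℓ * (p * p) + p
    inner u = begin
      ∑ (upTo L) (pairProb p u) ≤⟨ ∑-mono (upTo L) (pairProb-≤ u) ⟩
      ∑ (upTo L) (λ v → p * p + δ u v * p) ≡⟨ ∑-+ (upTo L) (λ _ → p * p) (λ v → δ u v * p) ⟩
      ∑ (upTo L) (λ _ → p * p) + ∑ (upTo L) (λ v → δ u v * p) ≡⟨ cong₂ _+_ (∑-upTo-const (p * p)) (∑-*ʳ (upTo L) p (δ u)) ⟩
      ℓ * (p * p) + ∑ (upTo L) (δ u) * p ≤⟨ +-monoʳ-≤ (ℓ * (p * p)) (*-monoʳ p≥0 (∑-δ u 0)) ⟩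
      ℓ * (p * p) + 1ℚ * p ≡⟨ cong (ℓ * (p * p) +_) (*-identityˡ p) ⟩
      ℓ * (p * p) + p ∎

  -- If s + u = s′ + v and s ≠ s′ then u ≠ v.
  pairProb-δ : ∀ s s′ u v → pairProb p u v * δ (s ℕ.+ u) (s′ ℕ.+ v) ≤ (p * p + δ s s′ * p) * δ (s ℕ.+ u) (s′ ℕ.+ v)
  pairProb-δ s s′ u v = cases (s ℕ.+ u ℕ.≟ s′ ℕ.+ v) (s ℕ.≟ s′)
    where
    cases : (d : Dec (s ℕ.+ u ≡ s′ ℕ.+ v)) (e : Dec (s ≡ s′)) → pairProb p u v * 𝟙 (does d) ≤ (p * p + 𝟙 (does e) * p) * 𝟙 (does d)
    cases (no _) e = ≤-reflexive (trans (*-zeroʳ (pairProb p u v)) (sym (*-zeroʳ (p * p + 𝟙 (does e) * p))))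
    cases (yes _) (yes _) = *-monoʳ 0≤1 (≤-trans (pairProb-≤p u v) (≤-trans (≤-reflexive (sym (*-identityˡ p))) (b≤a+b pp≥0)))
    cases (yes eq) (no s≢s′) = *-monoʳ 0≤1 (≤-trans (≤-reflexive (pairProb-≢ u≢v)) (a≤a+b (0≤* ≤-refl p≥0)))
      where
      u≢v : u ≢ v
      u≢v refl = s≢s′ (ℕₚ.+-cancelʳ-≡ u s s′ eq)

  -- Pairs with s + u = s′ + v carry the excess of the induction hypothesis. If s ≠ s′ they have u ≠
  -- v and so weight only p²; if s = s′ the additional weight p, over L choices of u, accounts for L
  -- p · μ d = μ (d + 1).
  correlation-≤ : ∀ d s s′ → correlation d s s′ ≤ α d + δ s s′ * μ d
  correlation-≤ zero s s′ = subst (λ x → pairProb p s s′ ≤ p * p + δ s s′ * x) (sym (*-identityʳ p)) (pairProb-≤ s s′)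
  correlation-≤ (suc d) s s′ = begin
    ∑ (upTo L) (λ u → ∑ (upTo L) (λ v → pairProb p u v * correlation d (s ℕ.+ u) (s′ ℕ.+ v)))
      ≤⟨ ∑-mono (upTo L) (λ u → ∑-mono (upTo L) (λ v → entry u v)) ⟩
    ∑ (upTo L) (λ u → ∑ (upTo L) (λ v → pairProb p u v * α d + c * μ d * δ′ u v))
      ≡⟨ trans (∑-cong (upTo L) (λ u → trans (∑-+ (upTo L) (λ v → pairProb p u v * α d) (λ v → c * μ d * δ′ u v))
           (cong₂ _+_ (∑-*ʳ (upTo L) (α d) (pairProb p u)) (∑-*ˡ (upTo L) (c * μ d) (δ′ u)))))
           (∑-+ (upTo L) (λ u → ∑ (upTo L) (pairProb p u) * α d) (λ u → c * μ d * ∑ (upTo L) (δ′ u))) ⟩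
    ∑ (upTo L) (λ u → ∑ (upTo L) (pairProb p u) * α d) + ∑ (upTo L) (λ u → c * μ d * ∑ (upTo L) (δ′ u))
      ≡⟨ cong₂ _+_ (∑-*ʳ (upTo L) (α d) (λ u → ∑ (upTo L) (pairProb p u))) (∑-*ˡ (upTo L) (c * μ d) (λ u → ∑ (upTo L) (δ′ u))) ⟩
    ∑ (upTo L) (λ u → ∑ (upTo L) (pairProb p u)) * α d + c * μ d * ∑ (upTo L) (λ u → ∑ (upTo L) (δ′ u))
      ≤⟨ +-mono-≤ (*-monoʳ (0≤α d) ∑∑-pairProb) (*-monoˡ (0≤* 0≤c (0≤μ d)) (∑-mono (upTo L) (λ u → ∑-δ (s ℕ.+ u) s′))) ⟩
    (z * z + z) * α d + c * μ d * ∑ (upTo L) (λ _ → 1ℚ) ≡⟨ cong (λ x → (z * z + z) * α d + c * μ d * x) (trans (∑-upTo-const 1ℚ) (*-identityʳ ℓ)) ⟩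
    (z * z + z) * α d + c * μ d * ℓ
      ≡⟨ solve 5 (λ a p e Z l → a :+ (p :* p :+ e :* p) :* (p :* Z) :* l := (a :+ p :* p :* ((l :* p) :* Z)) :+ e :* (p :* ((l :* p) :* Z)))
           refl ((z * z + z) * α d) p (δ s s′) (z ^ℚ d) ℓ ⟩
    α (suc d) + δ s s′ * μ (suc d) ∎
    where
    open ≤-Reasoning
    ℓ c : ℚ
    ℓ = ℕ→ℚ L
    c = p * p + δ s s′ * p
    0≤c : 0ℚ ≤ c
    0≤c = 0≤+ pp≥0 (0≤* (0≤𝟙 (does (s ℕ.≟ s′))) p≥0)
    δ′ : ℕ → ℕ → ℚ
    δ′ u v = δ (s ℕ.+ u) (s′ ℕ.+ v)
    entry : ∀ u v → pairProb p u v * correlation d (s ℕ.+ u) (s′ ℕ.+ v) ≤ pairProb p u v * α d + c * μ d * δ′ u v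
    entry u v = begin
      pairProb p u v * correlation d (s ℕ.+ u) (s′ ℕ.+ v) ≤⟨ *-monoˡ (0≤pairProb u v) (correlation-≤ d (s ℕ.+ u) (s′ ℕ.+ v)) ⟩
      pairProb p u v * (α d + δ′ u v * μ d) ≡⟨ solve 4 (λ w a e m → w :* (a :+ e :* m) := w :* a :+ w :* e :* m) refl (pairProb p u v) (α d) (δ′ u v) (μ d) ⟩
      pairProb p u v * α d + pairProb p u v * δ′ u v * μ d ≤⟨ +-monoʳ-≤ (pairProb p u v * α d) (*-monoʳ (0≤μ d) (pairProb-δ s s′ u v)) ⟩
      pairProb p u v * α d + c * δ′ u v * μ d ≡⟨ cong (pairProb p u v * α d +_) (solve 3 (λ c e m → c :* e :* m := c :* m :* e) refl c (δ′ u v) (μ d)) ⟩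
      pairProb p u v * α d + c * μ d * δ′ u v ∎

  -- Different rows use disjoint classes, so the correlation of one row is raised to the number of
  -- rows. The L² pairs of parameters all receive the power of α, and the L diagonal pairs in
  -- addition that of α + μ.
  E-structured² : ∀ d rs → Unique (concat (map classes rs)) → All (ℕ._≤ M) (concat (map classes rs)) → All (λ r → length (proj₂ r) ≡ d) rs →
    E {n} p (λ A → structured A rs * structured A rs) ≤ ℕ→ℚ L * ℕ→ℚ L * α d ^ℚ length rs + ℕ→ℚ L * (α d + μ d) ^ℚ length rs
  E-structured² d rs uniq all≤ lens = begin
    E {n} p (λ A → structured A rs * structured A rs)
      ≡⟨ E-cong {n} p (λ A → ∑-* (upTo L) (upTo L) (rowsProduct A rs) (rowsProduct A rs)) ⟩
    E {n} p (λ A → ∑ (upTo L) (λ s → ∑ (upTo L) (λ s′ → rowsProduct A rs s * rowsProduct A rs s′)))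
      ≡⟨ trans (E-∑ {n = n} p (upTo L) (λ s A → ∑ (upTo L) (λ s′ → rowsProduct A rs s * rowsProduct A rs s′)))
           (∑-cong (upTo L) (λ s → E-∑ {n = n} p (upTo L) (λ s′ A → rowsProduct A rs s * rowsProduct A rs s′))) ⟩
    ∑ (upTo L) (λ s → ∑ (upTo L) (λ s′ → E {n} p (λ A → rowsProduct A rs s * rowsProduct A rs s′)))
      ≤⟨ ∑-mono (upTo L) (λ s → ∑-mono (upTo L) (λ s′ → ≤-trans (E-rowsProduct² d rs s s′ uniq all≤ lens) (power s s′))) ⟩
    ∑ (upTo L) (λ s → ∑ (upTo L) (λ s′ → a + δ s s′ * b)) ≤⟨ ∑-mono (upTo L) inner ⟩
    ∑ (upTo L) (λ s → ℓ * a + b) ≡⟨ ∑-upTo-const (ℓ * a + b) ⟩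
    ℓ * (ℓ * a + b) ≡⟨ solve 3 (λ l a b → l :* (l :* a :+ b) := l :* l :* a :+ l :* b) refl ℓ a b ⟩
    ℓ * ℓ * a + ℓ * b ∎
    where
    open ≤-Reasoning
    G = length rs
    ℓ a b : ℚ
    ℓ = ℕ→ℚ L
    a = α d ^ℚ G
    b = (α d + μ d) ^ℚ G
    0≤a : 0ℚ ≤ a
    0≤a = 0≤^ G (0≤α d)
    0≤b : 0ℚ ≤ b
    0≤b = 0≤^ G (0≤+ (0≤α d) (0≤μ d))
    power : ∀ s s′ → correlation d s s′ ^ℚ G ≤ a + δ s s′ * b
    power s s′ = ≤-trans (^-mono G (0≤correlation d s s′) (correlation-≤ d s s′)) (cases (s ℕ.≟ s′))
      where
      cases : (e : Dec (s ≡ s′)) → (α d + 𝟙 (does e) * μ d) ^ℚ G ≤ a + 𝟙 (does e) * b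
      cases (yes _) = ≤-trans (≤-reflexive (trans (cong (λ x → (α d + x) ^ℚ G) (*-identityˡ (μ d))) (sym (*-identityˡ b)))) (b≤a+b 0≤a)
      cases (no _) = ≤-trans (≤-reflexive (cong (_^ℚ G) (trans (cong (α d +_) (*-zeroˡ (μ d))) (+-identityʳ (α d))))) (a≤a+b (0≤* ≤-refl 0≤b))
    inner : ∀ s → ∑ (upTo L) (λ s′ → a + δ s s′ * b) ≤ ℓ * a + b
    inner s = begin
      ∑ (upTo L) (λ s′ → a + δ s s′ * b) ≡⟨ ∑-+ (upTo L) (λ _ → a) (λ s′ → δ s s′ * b) ⟩
      ∑ (upTo L) (λ _ → a) + ∑ (upTo L) (λ s′ → δ s s′ * b) ≡⟨ cong₂ _+_ (∑-upTo-const a) (∑-*ʳ (upTo L) b (δ s)) ⟩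
      ℓ * a + ∑ (upTo L) (δ s) * b ≤⟨ +-monoʳ-≤ (ℓ * a) (*-monoʳ 0≤b (∑-δ s 0)) ⟩
      ℓ * a + 1ℚ * b ≡⟨ cong (ℓ * a +_) (*-identityˡ b) ⟩
      ℓ * a + b ∎

-- Chosen so that α d ≤ μ d ² (1 + growth d · t) whenever 1 ≤ z t and t ≤ 1.
growth : ℕ → ℚ
growth zero = 0ℚ
growth (suc d) = growth d + growth d + (1ℚ + 1ℚ)

0≤growth : ∀ d → 0ℚ ≤ growth d
0≤growth zero = ≤-refl
0≤growth (suc d) = 0≤+ (0≤+ (0≤growth d) (0≤growth d)) (0≤+ 0≤1 0≤1)

module _ (M L : ℕ) {n : ℕ} {p : ℚ} (P : Probability p) {t : ℚ} (0≤t : 0ℚ ≤ t) (t≤1 : t ≤ 1ℚ) where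

  open Slots M L
  open Moments {n} P
  open CorrelationBound M L {n} P

  module _ (1≤zt : 1ℚ ≤ z * t) where

    1≤z : 1ℚ ≤ z
    1≤z = ≤-trans 1≤zt (≤-trans (*-monoˡ {z} {t} {1ℚ} z≥0 t≤1) (≤-reflexive (*-identityʳ z)))

    -- Since 1 ≤ z t gives z ≤ z² t, every lower-order term becomes a relative error of size t. The
    -- recursion of `growth` comes from (1 + t)(1 + C t) + t ≤ 1 + (2 C + 2) t for t ≤ 1.
    α-≤ : ∀ d → α d ≤ μ d * μ d * (1ℚ + growth d * t)
    α-≤ zero = ≤-reflexive (sym (trans (cong (λ x → p * 1ℚ * (p * 1ℚ) * (1ℚ + x)) (*-zeroˡ t)) (solve 1 (λ p → p :* con 1ℚ :* (p :* con 1ℚ) :* (con 1ℚ :+ con 0ℚ) := p :* p) refl p)))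
    α-≤ (suc d) = begin
      (z * z + z) * α d + p * p * (z * Z) ≤⟨ +-mono-≤ (*-mono (0≤+ zz≥0 z≥0) (0≤α d) zz+z≤ (α-≤ d)) second ⟩
      z * z * (1ℚ + t) * (p * Z * (p * Z) * (1ℚ + C * t)) + p * p * (z * z * t * (Z * Z))
        ≡⟨ solve 5 (λ z p Z C t → z :* z :* (con 1ℚ :+ t) :* (p :* Z :* (p :* Z) :* (con 1ℚ :+ C :* t)) :+ p :* p :* (z :* z :* t :* (Z :* Z))
             := p :* (z :* Z) :* (p :* (z :* Z)) :* (con 1ℚ :+ (C :+ (con 1ℚ :+ con 1ℚ)) :* t :+ C :* (t :* t))) refl z p Z C t ⟩
      μ (suc d) * μ (suc d) * (1ℚ + (C + (1ℚ + 1ℚ)) * t + C * (t * t)) ≤⟨ *-monoˡ (0≤* (0≤μ (suc d)) (0≤μ (suc d))) tail-≤ ⟩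
      μ (suc d) * μ (suc d) * (1ℚ + growth (suc d) * t) ∎
      where
      open ≤-Reasoning
      Z C : ℚ
      Z = z ^ℚ d
      C = growth d
      zz≥0 : 0ℚ ≤ z * z
      zz≥0 = 0≤* z≥0 z≥0
      z≤zzt : z ≤ z * z * t
      z≤zzt = ≤-trans (≤-reflexive (sym (*-identityʳ z))) (≤-trans (*-monoˡ {z} {1ℚ} {z * t} z≥0 1≤zt) (≤-reflexive (sym (*-assoc z z t))))
      zz+z≤ : z * z + z ≤ z * z * (1ℚ + t)
      zz+z≤ = ≤-trans (+-monoʳ-≤ (z * z) z≤zzt) (≤-reflexive (solve 2 (λ z t → z :* z :+ z :* z :* t := z :* z :* (con 1ℚ :+ t)) refl z t))
      1≤Z : 1ℚ ≤ Z
      1≤Z = 1≤^ d 1≤z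
      0≤Z : 0ℚ ≤ Z
      0≤Z = ≤-trans 0≤1 1≤Z
      Z≤ZZ : Z ≤ Z * Z
      Z≤ZZ = ≤-trans (≤-reflexive (sym (*-identityʳ Z))) (*-monoˡ {Z} {1ℚ} {Z} 0≤Z 1≤Z)
      second : p * p * (z * Z) ≤ p * p * (z * z * t * (Z * Z))
      second = *-monoˡ pp≥0 (*-mono z≥0 0≤Z z≤zzt Z≤ZZ)
      tail-≤ : 1ℚ + (C + (1ℚ + 1ℚ)) * t + C * (t * t) ≤ 1ℚ + growth (suc d) * t
      tail-≤ = ≤-trans (+-monoʳ-≤ (1ℚ + (C + (1ℚ + 1ℚ)) * t) (*-monoˡ {C} {t * t} {t} (0≤growth d) (≤-trans (*-monoˡ {t} {t} {1ℚ} 0≤t t≤1) (≤-reflexive (*-identityʳ t)))))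
        (≤-reflexive (solve 2 (λ C t → con 1ℚ :+ (C :+ (con 1ℚ :+ con 1ℚ)) :* t :+ C :* t := con 1ℚ :+ (C :+ C :+ (con 1ℚ :+ con 1ℚ)) :* t) refl C t))

-- Elementary inequalities and Chebyshev's inequality

bernoulli : ℚ → ℕ → ℚ
bernoulli C zero = 0ℚ
bernoulli C (suc G) = C + bernoulli C G + C * bernoulli C G

0≤bernoulli : ∀ {C} G → 0ℚ ≤ C → 0ℚ ≤ bernoulli C G
0≤bernoulli zero 0≤C = ≤-refl
0≤bernoulli (suc G) 0≤C = 0≤+ (0≤+ 0≤C (0≤bernoulli G 0≤C)) (0≤* 0≤C (0≤bernoulli G 0≤C))

module _ {C t : ℚ} (0≤C : 0ℚ ≤ C) (0≤t : 0ℚ ≤ t) (t≤1 : t ≤ 1ℚ) where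

  -- The constant `bernoulli C G` is (1 + C)^G - 1, so the right side is the chord of the convex
  -- function (1 + C t)^G over [0, 1].
  ^-≤-bernoulli : ∀ G → (1ℚ + C * t) ^ℚ G ≤ 1ℚ + bernoulli C G * t
  ^-≤-bernoulli zero = ≤-reflexive (sym (trans (cong (1ℚ +_) (*-zeroˡ t)) (+-identityʳ 1ℚ)))
  ^-≤-bernoulli (suc G) = begin
    (1ℚ + C * t) * (1ℚ + C * t) ^ℚ G ≤⟨ *-monoˡ (0≤+ 0≤1 (0≤* 0≤C 0≤t)) (^-≤-bernoulli G) ⟩
    (1ℚ + C * t) * (1ℚ + B * t) ≡⟨ solve 3 (λ C B t → (con 1ℚ :+ C :* t) :* (con 1ℚ :+ B :* t) := con 1ℚ :+ (C :+ B) :* t :+ C :* B :* (t :* t)) refl C B t ⟩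
    1ℚ + (C + B) * t + C * B * (t * t)
      ≤⟨ +-monoʳ-≤ (1ℚ + (C + B) * t) (*-monoˡ {C * B} {t * t} {t} (0≤* 0≤C (0≤bernoulli G 0≤C)) (≤-trans (*-monoˡ {t} {t} {1ℚ} 0≤t t≤1) (≤-reflexive (*-identityʳ t)))) ⟩
    1ℚ + (C + B) * t + C * B * t ≡⟨ solve 3 (λ C B t → con 1ℚ :+ (C :+ B) :* t :+ C :* B :* t := con 1ℚ :+ (C :+ B :+ C :* B) :* t) refl C B t ⟩
    1ℚ + bernoulli C (suc G) * t ∎
    where
    open ≤-Reasoning
    B : ℚ
    B = bernoulli C G

two : ℚ
two = 1ℚ + 1ℚ

0≤two : 0ℚ ≤ two
0≤two = 0≤+ 0≤1 0≤1

-- Because x + 1 ≤ 2 max(x, 1), and a maximum of two nonnegative terms is at most their sum.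
^-sum-≤ : ∀ {x} G → 0ℚ ≤ x → (x + 1ℚ) ^ℚ G ≤ two ^ℚ G * (x ^ℚ G + 1ℚ)
^-sum-≤ {x} G 0≤x = cases (≤-total x 1ℚ)
  where
  0≤x+1 = 0≤+ 0≤x 0≤1
  cases : x ≤ 1ℚ ⊎ 1ℚ ≤ x → (x + 1ℚ) ^ℚ G ≤ two ^ℚ G * (x ^ℚ G + 1ℚ)
  cases (inj₁ x≤1) = ≤-trans (^-mono G 0≤x+1 (+-monoˡ-≤ 1ℚ x≤1)) (≤-trans (≤-reflexive (sym (*-identityʳ (two ^ℚ G))))
    (*-monoˡ {two ^ℚ G} {1ℚ} {x ^ℚ G + 1ℚ} (0≤^ G 0≤two) (b≤a+b (0≤^ G 0≤x))))
  cases (inj₂ 1≤x) = ≤-trans (^-mono G 0≤x+1 (+-monoʳ-≤ x 1≤x)) (≤-trans (≤-reflexive (trans (cong (_^ℚ G) (solve 1 (λ x → x :+ x := (con 1ℚ :+ con 1ℚ) :* x) refl x)) (^-distrib-* two x G)))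
    (*-monoˡ {two ^ℚ G} {x ^ℚ G} {x ^ℚ G + 1ℚ} (0≤^ G 0≤two) (a≤a+b 0≤1)))

-- The first summand comes from the pairs of parameters counted L² times, the second from the L
-- diagonal pairs.
variance-factor : ℚ → ℕ → ℚ
variance-factor C G = bernoulli C G + two ^ℚ G * ((1ℚ + C) ^ℚ G + 1ℚ)

-- After m^G is extracted, the diagonal part consists of multiples of ℓ m^(2G) and ℓ m^G. The
-- hypotheses 1 ≤ ℓ t and 1 ≤ ℓ m^G t bound each of these by t (ℓ m^G)².
second-moment-≤ : ∀ {ℓ a m C t} G → 0ℚ ≤ ℓ → 0ℚ ≤ a → 0ℚ ≤ m → 0ℚ ≤ C → 0ℚ ≤ t → t ≤ 1ℚ →
  a ≤ m * m * (1ℚ + C * t) → 1ℚ ≤ ℓ * t → 1ℚ ≤ ℓ * m ^ℚ G * t →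
  ℓ * ℓ * a ^ℚ G + ℓ * (a + m) ^ℚ G ≤ (ℓ * m ^ℚ G) * (ℓ * m ^ℚ G) * (1ℚ + variance-factor C G * t)
second-moment-≤ {ℓ} {a} {m} {C} {t} G 0≤ℓ 0≤a 0≤m 0≤C 0≤t t≤1 a≤ 1≤ℓt 1≤ℓmt = begin
  ℓ * ℓ * a ^ℚ G + ℓ * (a + m) ^ℚ G ≤⟨ +-mono-≤ first second ⟩
  S * (1ℚ + bernoulli C G * t) + S * (W * (V + 1ℚ) * t)
    ≡⟨ solve 5 (λ S B W V t → S :* (con 1ℚ :+ B :* t) :+ S :* (W :* (V :+ con 1ℚ) :* t) := S :* (con 1ℚ :+ (B :+ W :* (V :+ con 1ℚ)) :* t)) refl S (bernoulli C G) W V t ⟩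
  S * (1ℚ + variance-factor C G * t) ∎
  where
  open ≤-Reasoning
  b Q S W V : ℚ
  b = 1ℚ + C * t
  Q = m ^ℚ G
  S = (ℓ * Q) * (ℓ * Q)
  W = two ^ℚ G
  V = (1ℚ + C) ^ℚ G
  0≤b : 0ℚ ≤ b
  0≤b = 0≤+ 0≤1 (0≤* 0≤C 0≤t)
  0≤Q : 0ℚ ≤ Q
  0≤Q = 0≤^ G 0≤m
  0≤W : 0ℚ ≤ W
  0≤W = 0≤^ G 0≤two
  0≤V : 0ℚ ≤ V
  0≤V = 0≤^ G (0≤+ 0≤1 0≤C)
  b^G≤V : b ^ℚ G ≤ V
  b^G≤V = ^-mono G 0≤b (+-monoʳ-≤ 1ℚ (≤-trans (*-monoˡ {C} {t} {1ℚ} 0≤C t≤1) (≤-reflexive (*-identityʳ C))))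
  first : ℓ * ℓ * a ^ℚ G ≤ S * (1ℚ + bernoulli C G * t)
  first = begin
    ℓ * ℓ * a ^ℚ G ≤⟨ *-monoˡ (0≤* 0≤ℓ 0≤ℓ) (^-mono G 0≤a a≤) ⟩
    ℓ * ℓ * (m * m * b) ^ℚ G ≡⟨ cong (ℓ * ℓ *_) (trans (^-distrib-* (m * m) b G) (cong (_* b ^ℚ G) (^-distrib-* m m G))) ⟩
    ℓ * ℓ * (Q * Q * b ^ℚ G) ≡⟨ solve 3 (λ l Q x → l :* l :* (Q :* Q :* x) := (l :* Q) :* (l :* Q) :* x) refl ℓ Q (b ^ℚ G) ⟩
    S * b ^ℚ G ≤⟨ *-monoˡ (0≤* (0≤* 0≤ℓ 0≤Q) (0≤* 0≤ℓ 0≤Q)) (^-≤-bernoulli 0≤C 0≤t t≤1 G) ⟩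
    S * (1ℚ + bernoulli C G * t) ∎
  second : ℓ * (a + m) ^ℚ G ≤ S * (W * (V + 1ℚ) * t)
  second = begin
    ℓ * (a + m) ^ℚ G ≤⟨ *-monoˡ 0≤ℓ (^-mono G (0≤+ 0≤a 0≤m) (+-monoˡ-≤ m a≤)) ⟩
    ℓ * (m * m * b + m) ^ℚ G ≡⟨ cong (ℓ *_) (trans (cong (_^ℚ G) (solve 2 (λ m b → m :* m :* b :+ m := m :* (m :* b :+ con 1ℚ)) refl m b)) (^-distrib-* m (m * b + 1ℚ) G)) ⟩
    ℓ * (Q * (m * b + 1ℚ) ^ℚ G) ≤⟨ *-monoˡ 0≤ℓ (*-monoˡ 0≤Q (^-sum-≤ G (0≤* 0≤m 0≤b))) ⟩
    ℓ * (Q * (W * ((m * b) ^ℚ G + 1ℚ))) ≡⟨ cong (λ x → ℓ * (Q * (W * (x + 1ℚ)))) (^-distrib-* m b G) ⟩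
    ℓ * (Q * (W * (Q * b ^ℚ G + 1ℚ))) ≤⟨ *-monoˡ 0≤ℓ (*-monoˡ 0≤Q (*-monoˡ 0≤W (+-monoˡ-≤ 1ℚ (*-monoˡ 0≤Q b^G≤V)))) ⟩
    ℓ * (Q * (W * (Q * V + 1ℚ))) ≡⟨ solve 4 (λ l Q W V → l :* (Q :* (W :* (Q :* V :+ con 1ℚ))) := W :* (l :* (Q :* Q :* V) :* con 1ℚ :+ l :* Q :* con 1ℚ)) refl ℓ Q W V ⟩
    W * (ℓ * (Q * Q * V) * 1ℚ + ℓ * Q * 1ℚ)
      ≤⟨ *-monoˡ 0≤W (+-mono-≤ (*-monoˡ (0≤* 0≤ℓ (0≤* (0≤* 0≤Q 0≤Q) 0≤V)) 1≤ℓt) (*-monoˡ (0≤* 0≤ℓ 0≤Q) 1≤ℓmt)) ⟩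
    W * (ℓ * (Q * Q * V) * (ℓ * t) + ℓ * Q * (ℓ * Q * t))
      ≡⟨ solve 5 (λ l Q W V t → W :* (l :* (Q :* Q :* V) :* (l :* t) :+ l :* Q :* (l :* Q :* t)) := (l :* Q) :* (l :* Q) :* (W :* (V :+ con 1ℚ) :* t)) refl ℓ Q W V t ⟩
    S * (W * (V + 1ℚ) * t) ∎

-- Wherever `G` is 1 the variable `X` is 0, so m² G ≤ (X - m)² holds pointwise; expectations give
-- the claim after division by m².
chebyshev : ∀ {n p} → Probability p → ∀ {m K} (G X : Vec Bool n → ℚ) →
  (∀ A → (G A ≡ 0ℚ) ⊎ (G A ≡ 1ℚ × X A ≡ 0ℚ)) → E p X ≡ m → E p (λ A → X A * X A) ≤ m * m * (1ℚ + K) → 0ℚ < m * m → E p G ≤ K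
chebyshev {n} {p} P {m} {K} G X vanish EX EXX 0<mm = *-cancelʳ {E p G} {K} {m * m} 0<mm (begin
  E p G * (m * m) ≡⟨ trans (*-comm (E p G) (m * m)) (sym (E-*ˡ p (m * m) G)) ⟩
  E p (λ A → m * m * G A) ≤⟨ E-mono P pointwise ⟩
  E p (λ A → X A * X A + ((- (m + m)) * X A + m * m)) ≡⟨ expand ⟩
  E p (λ A → X A * X A) + ((- (m + m)) * m + m * m) ≤⟨ +-monoˡ-≤ ((- (m + m)) * m + m * m) EXX ⟩
  m * m * (1ℚ + K) + ((- (m + m)) * m + m * m) ≡⟨ solve 2 (λ m K → m :* m :* (con 1ℚ :+ K) :+ ((:- (m :+ m)) :* m :+ m :* m) := K :* (m :* m)) refl m K ⟩
  K * (m * m) ∎)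
  where
  open ≤-Reasoning
  square : ∀ A → X A * X A + ((- (m + m)) * X A + m * m) ≡ (X A - m) * (X A - m)
  square A = solve 2 (λ x m → x :* x :+ ((:- (m :+ m)) :* x :+ m :* m) := (x :- m) :* (x :- m)) refl (X A) m
  pointwise : ∀ A → m * m * G A ≤ X A * X A + ((- (m + m)) * X A + m * m)
  pointwise A = cases (vanish A)
    where
    cases : (G A ≡ 0ℚ) ⊎ (G A ≡ 1ℚ × X A ≡ 0ℚ) → m * m * G A ≤ X A * X A + ((- (m + m)) * X A + m * m)
    cases (inj₁ G≡0) = ≤-trans (≤-reflexive (trans (cong (m * m *_) G≡0) (*-zeroʳ (m * m)))) (≤-trans (0≤square (X A - m)) (≤-reflexive (sym (square A))))
    cases (inj₂ (G≡1 , X≡0)) = ≤-reflexive (trans (cong (m * m *_) G≡1) (sym (trans (cong (λ x → x * x + ((- (m + m)) * x + m * m)) X≡0)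
      (solve 1 (λ m → con 0ℚ :* con 0ℚ :+ ((:- (m :+ m)) :* con 0ℚ :+ m :* m) := m :* m :* con 1ℚ) refl m))))
  expand : E p (λ A → X A * X A + ((- (m + m)) * X A + m * m)) ≡ E p (λ A → X A * X A) + ((- (m + m)) * m + m * m)
  expand = trans (E-+ p (λ A → X A * X A) (λ A → (- (m + m)) * X A + m * m)) (cong (E p (λ A → X A * X A) +_)
    (trans (E-+ p (λ A → (- (m + m)) * X A) (λ _ → m * m)) (cong₂ _+_ (trans (E-*ˡ p (- (m + m)) X) (cong ((- (m + m)) *_) EX)) (E-const {n} p (m * m)))))

-- Completeness of the list of multisets

msets-insert : ∀ h {x} xs {t} → x ∈ xs → t ∈ msets h xs → ∃[ t′ ] (t′ ∈ msets (suc h) xs × t′ ↭ x ∷ t)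
msets-insert zero (z ∷ zs) (here refl) (here refl) = z ∷ [] , here refl , ↭-refl
msets-insert zero (z ∷ zs) (there x∈) (here refl) = let t′ , t′∈ , p = msets-insert zero zs x∈ (here refl) in t′ , there t′∈ , p
msets-insert (suc h) (z ∷ zs) x∈ t∈ with msets-∷⁻ h z zs t∈
msets-insert (suc h) {x} (z ∷ zs) x∈ t∈ | inj₁ (r , refl , r∈) =
  let r′ , r′∈ , p = msets-insert h (z ∷ zs) x∈ r∈ in
  z ∷ r′ , ∈-++⁺ˡ (∈-map⁺ (z ∷_) r′∈) , ↭-trans (↭-prep z p) (↭-swap z x ↭-refl)
msets-insert (suc h) (z ∷ zs) (here refl) t∈ | inj₂ t∈ʳ = z ∷ _ , ∈-++⁺ˡ (∈-map⁺ (z ∷_) (∈-++⁺ʳ (map (z ∷_) (msets h (z ∷ zs))) t∈ʳ)) , ↭-refl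
msets-insert (suc h) (z ∷ zs) (there x∈) t∈ | inj₂ t∈ʳ =
  let t′ , t′∈ , p = msets-insert (suc h) zs x∈ t∈ʳ in t′ , ∈-++⁺ʳ (map (z ∷_) (msets (suc h) (z ∷ zs))) t′∈ , p

-- Structured solutions are listed in the order of their classes, while `msets` follows the order of
-- the candidates; this supplies the rearrangement that is counted.
msets-complete : ∀ {xs} t → (∀ {x} → x ∈ t → x ∈ xs) → ∃[ t′ ] (t′ ∈ msets (length t) xs × t′ ↭ t)
msets-complete [] sub = [] , here refl , ↭-refl
msets-complete {xs} (x ∷ t) sub =
  let r , r∈ , p = msets-complete t (sub ∘ there)
      t′ , t′∈ , p′ = msets-insert (length t) xs (sub (here refl)) r∈
  in t′ , t′∈ , ↭-trans p′ (↭-prep x p)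

sum-≥-length : ∀ t → (∀ {x} → x ∈ t → 1 ℕ.≤ x) → length t ℕ.≤ sumℕ t
sum-≥-length [] _ = ℕ.z≤n
sum-≥-length (x ∷ t) ge = ℕₚ.+-mono-≤ (ge (here refl)) (sum-≥-length t (ge ∘ there))

sum-≤-length : ∀ {n} t → (∀ {x} → x ∈ t → x ℕ.≤ n) → sumℕ t ℕ.≤ length t ℕ.* n
sum-≤-length [] _ = ℕ.z≤n
sum-≤-length (x ∷ t) le = ℕₚ.+-mono-≤ (le (here refl)) (sum-≤-length t (le ∘ there))

∈-range : ∀ {lo hi m} → lo ℕ.≤ m → m ℕ.≤ hi → m ∈ range lo hi
∈-range {lo} {hi} {m} lo≤m m≤hi = subst (_∈ range lo hi) (ℕₚ.m+[n∸m]≡n lo≤m)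
  (∈-map⁺ (lo ℕ.+_) (∈-upTo⁺ (ℕ.s≤s (ℕₚ.∸-monoˡ-≤ lo m≤hi))))

-- structured solutions in B_h[g] sets

module _ (M L : ℕ) {n : ℕ} (A : Vec Bool n) where

  open Slots M L

  -- The leading `length ks` in the total is the shift by one between 0-based coordinates and
  -- elements of [n].
  record Solution (ks : List ℕ) (q : ℕ) : Set where
    field
      t : List ℕ
      size : length t ≡ length ks
      inside : ∀ {x} → x ∈ t → x ∈ elems A
      total : sumℕ t ≡ length ks ℕ.+ (sumℕ ks ℕ.+ q ℕ.* suc M)
      class : ∀ {x} → x ∈ t → ∃[ c ] ∃[ y ] (c ∈ ks × x ≡ suc (slot c y))

  private
    -- A constructive form of the principle that a nonzero sum has a nonzero term: each term
    -- vanishes or yields a witness, hence so does the sum.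
    ∑-zero-or : ∀ {Q : Set} (xs : List ℕ) {f : ℕ → ℚ} → (∀ {u} → u ∈ xs → f u ≡ 0ℚ ⊎ Q) → ∑ xs f ≡ 0ℚ ⊎ Q
    ∑-zero-or [] _ = inj₁ refl
    ∑-zero-or (x ∷ xs) alt with alt (here refl) | ∑-zero-or xs (alt ∘ there)
    ... | inj₂ q | _ = inj₂ q
    ... | inj₁ _ | inj₂ q = inj₂ q
    ... | inj₁ eq | inj₁ eq′ = inj₁ (cong₂ _+_ eq eq′)

    *-zero-or : ∀ {a b} {Q R : Set} → a ≡ 0ℚ ⊎ Q → b ≡ 0ℚ ⊎ R → a * b ≡ 0ℚ ⊎ (Q × R)
    *-zero-or {a} {b} (inj₁ eq) _ = inj₁ (trans (cong (_* b) eq) (*-zeroˡ b))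
    *-zero-or {a} {b} (inj₂ _) (inj₁ eq) = inj₁ (trans (cong (a *_) eq) (*-zeroʳ a))
    *-zero-or (inj₂ q) (inj₂ r) = inj₂ (q , r)

    open ℕSolver.+-*-Solver renaming (solve to solveℕ; _:=_ to _⊜_; _:+_ to _⊕_; _:*_ to _⊗_; con to conℕ) using ()

    total-∷ : ∀ c w l e σ s u K m → suc (c ℕ.+ w ℕ.* m) ℕ.+ (l ℕ.+ (e ℕ.+ σ ℕ.+ (s ℕ.+ u ℕ.+ K) ℕ.* m)) ≡ suc l ℕ.+ (e ℕ.+ (c ℕ.+ σ) ℕ.+ (s ℕ.+ (w ℕ.+ u ℕ.+ K)) ℕ.* m)
    total-∷ = solveℕ 9 (λ c w l e σ s u K m → conℕ 1 ⊕ (c ⊕ w ⊗ m) ⊕ (l ⊕ (e ⊕ σ ⊕ (s ⊕ u ⊕ K) ⊗ m)) ⊜ conℕ 1 ⊕ l ⊕ (e ⊕ (c ⊕ σ) ⊕ (s ⊕ (w ⊕ u ⊕ K)) ⊗ m)) refl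

  chain-zero-or-solution : ∀ cs e s → chain A cs e s ≡ 0ℚ ⊎ Solution (e ∷ cs) (s ℕ.+ length cs ℕ.* L)
  chain-zero-or-solution [] e s = single (at-zero-or-∈ 1 A (slot e s))
    where
    single : at A (slot e s) ≡ 0ℚ ⊎ suc (slot e s) ∈ elems A → at A (slot e s) ≡ 0ℚ ⊎ Solution (e ∷ []) (s ℕ.+ 0)
    single (inj₁ eq) = inj₁ eq
    single (inj₂ x∈) = inj₂ (record
      { t = suc (slot e s) ∷ []
      ; size = refl
      ; inside = λ { (here refl) → x∈ }
      ; total = cong suc (solveℕ 3 (λ e s m → e ⊕ s ⊗ m ⊕ conℕ 0 ⊜ e ⊕ conℕ 0 ⊕ (s ⊕ conℕ 0) ⊗ m) refl e s (suc M))
      ; class = λ { (here refl) → e , s , here refl , refl } })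
  chain-zero-or-solution (c ∷ cs) e s = ∑-zero-or (upTo L) (λ {u} u∈ → extend u (ℕₚ.<⇒≤ (∈-upTo⁻ u∈)) (*-zero-or (at-zero-or-∈ 1 A (slot c (L ℕ.∸ u))) (chain-zero-or-solution cs e (s ℕ.+ u))))
    where
    extend : ∀ u → u ℕ.≤ L → ∀ {f} → f ≡ 0ℚ ⊎ (suc (slot c (L ℕ.∸ u)) ∈ elems A × Solution (e ∷ cs) (s ℕ.+ u ℕ.+ length cs ℕ.* L)) →
      f ≡ 0ℚ ⊎ Solution (e ∷ c ∷ cs) (s ℕ.+ (L ℕ.+ length cs ℕ.* L))
    extend u u≤L (inj₁ eq) = inj₁ eq
    extend u u≤L (inj₂ (x∈ , S)) = inj₂ (record
      { t = suc (slot c w) ∷ S.t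
      ; size = cong suc S.size
      ; inside = λ { (here refl) → x∈ ; (there y∈) → S.inside y∈ }
      ; total = trans (cong (suc (slot c w) ℕ.+_) S.total)
          (trans (total-∷ c w (suc (length cs)) e (sumℕ cs) s u (length cs ℕ.* L) (suc M))
            (cong (λ l → suc (suc (length cs)) ℕ.+ (e ℕ.+ (c ℕ.+ sumℕ cs) ℕ.+ (s ℕ.+ (l ℕ.+ length cs ℕ.* L)) ℕ.* suc M)) (ℕₚ.m∸n+n≡m u≤L)))
      ; class = λ { (here refl) → c , w , there (here refl) , refl
                  ; (there y∈) → let c′ , y , c′∈ , eq = S.class y∈ in c′ , y , skip c′∈ , eq } })
      where
      module S = Solution S
      w = L ℕ.∸ u
      skip : ∀ {c′} → c′ ∈ e ∷ cs → c′ ∈ e ∷ c ∷ cs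
      skip (here eq) = here eq
      skip (there c′∈) = there (there c′∈)

  rowsProduct-zero-or-solutions : ∀ d rs s → All (λ r → length (proj₂ r) ≡ d) rs →
    rowsProduct A rs s ≡ 0ℚ ⊎ All (λ r → Solution (classes r) (s ℕ.+ d ℕ.* L)) rs
  rowsProduct-zero-or-solutions d [] s [] = inj₂ []
  rowsProduct-zero-or-solutions d ((e , cs) ∷ rs) s (refl ∷ lens) =
    combine (*-zero-or (chain-zero-or-solution cs e s) (rowsProduct-zero-or-solutions d rs s lens))
    where
    combine : ∀ {f} {Q : Row → Set} → f ≡ 0ℚ ⊎ (Q (e , cs) × All Q rs) → f ≡ 0ℚ ⊎ All Q ((e , cs) ∷ rs)
    combine (inj₁ eq) = inj₁ eq
    combine (inj₂ (q , qs)) = inj₂ (q ∷ qs)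

  module _ (d σ q : ℕ) where

    private
      m = suc d ℕ.+ (σ ℕ.+ q ℕ.* suc M)

      sums : List (List ℕ)
      sums = filter (λ t → sumℕ t ℕ.≟ m) (msets (suc d) (elems A))

    record Listed (rs : List Row) : Set where
      field
        T : List (List ℕ)
        count : length T ≡ length rs
        unique : Unique T
        listed : ∀ {t} → t ∈ T → t ∈ sums
        class : ∀ {t x} → t ∈ T → x ∈ t → ∃[ c ] ∃[ y ] (c ∈ concat (map classes rs) × x ≡ suc (slot c y))

    -- Multisets from different rows are distinct because their elements lie in disjoint sets of
    -- residue classes; a single element of the new multiset decides, and it exists since the size
    -- is `suc d`.
    listSolutions : ∀ rs → Unique (concat (map classes rs)) → All (ℕ._≤ M) (concat (map classes rs)) →
      All (λ r → length (proj₂ r) ≡ d) rs → All (λ r → sumℕ (classes r) ≡ σ) rs → All (λ r → Solution (classes r) q) rs → Listed rs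
    listSolutions [] _ _ _ _ _ = record { T = [] ; count = refl ; unique = [] ; listed = λ () ; class = λ () }
    listSolutions ((e , cs) ∷ rs) uniq all≤ (len ∷ lens) (sum≡ ∷ sums≡) (S ∷ Ss) = record
      { T = t′ ∷ R.T
      ; count = cong suc R.count
      ; unique = All.tabulate (λ r∈ t′≡r → new (subst (_∈ R.T) (sym t′≡r) r∈)) ∷ R.unique
      ; listed = λ { (here refl) → ∈-filter⁺ (λ t → sumℕ t ℕ.≟ m) (subst (λ l → t′ ∈ msets l (elems A)) size t′∈) (trans (sum-↭ perm) total)
                   ; (there r∈) → R.listed r∈ }
      ; class = λ { (here refl) x∈ → let c , y , c∈ , eq = S.class (Perm.∈-resp-↭ perm x∈) in c , y , ∈-++⁺ˡ c∈ , eq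
                  ; (there r∈) x∈ → let c , y , c∈ , eq = R.class r∈ x∈ in c , y , ∈-++⁺ʳ (e ∷ cs) c∈ , eq } }
      where
      module S = Solution S
      module R = Listed (listSolutions rs (unique-++ʳ (e ∷ cs) uniq) (Allₚ.++⁻ʳ (e ∷ cs) all≤) lens sums≡ Ss)
      size : length S.t ≡ suc d
      size = trans S.size (cong suc len)
      total : sumℕ S.t ≡ m
      total = trans S.total (cong₂ ℕ._+_ (cong suc len) (cong (ℕ._+ q ℕ.* suc M) sum≡))
      sorted = msets-complete S.t S.inside
      t′ = proj₁ sorted
      t′∈ = proj₁ (proj₂ sorted)
      perm = proj₂ (proj₂ sorted)
      element : ∃[ x ] x ∈ S.t
      element = first S.t size
        where
        first : ∀ t → length t ≡ suc d → ∃[ x ] x ∈ t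
        first (x ∷ _) _ = x , here refl
      new : t′ ∉ R.T
      new t′∈T =
        let x , x∈ = element
            c , y , c∈ , eq = S.class x∈
            c′ , y′ , c′∈ , eq′ = R.class t′∈T (Perm.∈-resp-↭ (↭-sym perm) x∈)
            c≡c′ = slot-class y y′ (All.lookup (Allₚ.++⁻ˡ (e ∷ cs) all≤) c∈) (All.lookup (Allₚ.++⁻ʳ (e ∷ cs) all≤) c′∈) (ℕₚ.suc-injective (trans (sym eq) eq′))
        in unique-++-∉ uniq c∈ (subst (_∈ concat (map classes rs)) (sym c≡c′) c′∈)

    solutions-bound : ∀ g rs → IsBhg (suc d) g n A → suc g ≡ length rs → Unique (concat (map classes rs)) → All (ℕ._≤ M) (concat (map classes rs)) →
      All (λ r → length (proj₂ r) ≡ d) rs → All (λ r → sumℕ (classes r) ≡ σ) rs → ¬ All (λ r → Solution (classes r) q) rs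
    solutions-bound g rs bhg len uniq all≤ lens sums≡ Ss =
      ℕₚ.<⇒≱ (subst (ℕ._≤ length sums) (trans R.count (sym len)) (unique-length-≤ R.unique R.listed)) (All.lookup bhg m∈)
      where
      module R = Listed (listSolutions rs uniq all≤ lens sums≡ Ss)
      head-solution : ∃[ t ] t ∈ sums
      head-solution = first R.T (trans R.count (sym len)) R.listed
        where
        first : ∀ T → length T ≡ suc g → (∀ {t} → t ∈ T → t ∈ sums) → ∃[ t ] t ∈ sums
        first (t ∷ T) _ listed = t , listed (here refl)
      -- The property speaks only about totals in its range; `m` lies there as the sum of `suc d`
      -- elements between 1 and n.
      m∈ : m ∈ range (suc d) (n ℕ.* suc d)
      m∈ = let t , t∈ = head-solution
               t∈′ , total = ∈-filter⁻ (λ t → sumℕ t ℕ.≟ m) {xs = msets (suc d) (elems A)} t∈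
               size = msets-length (suc d) (elems A) t∈′
               inside = λ {x} (x∈ : x ∈ t) → msets-⊆ (suc d) (elems A) t∈′ x∈
           in subst (_∈ range (suc d) (n ℕ.* suc d)) total (∈-range
                (subst (ℕ._≤ sumℕ t) size (sum-≥-length t (λ x∈ → elemsFrom-≥ 1 A (inside x∈))))
                (subst (sumℕ t ℕ.≤_) (trans (cong (ℕ._* n) size) (ℕₚ.*-comm (suc d) n)) (sum-≤-length t (λ x∈ → elems-≤ A (inside x∈)))))

  structured-vanishes : ∀ d g σ rs → IsBhg (suc d) g n A → suc g ≡ length rs → Unique (concat (map classes rs)) → All (ℕ._≤ M) (concat (map classes rs)) →
    All (λ r → length (proj₂ r) ≡ d) rs → All (λ r → sumℕ (classes r) ≡ σ) rs → structured A rs ≡ 0ℚ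
  structured-vanishes d g σ rs bhg len uniq all≤ lens sums≡ = trans (∑-cong (upTo L) (λ s → vanish s (rowsProduct-zero-or-solutions d rs s lens))) (∑-zero (upTo L))
    where
    vanish : ∀ s {f} → f ≡ 0ℚ ⊎ All (λ r → Solution (classes r) (s ℕ.+ d ℕ.* L)) rs → f ≡ 0ℚ
    vanish s (inj₁ eq) = eq
    vanish s (inj₂ Ss) = ⊥-elim (solutions-bound d σ (s ℕ.+ d ℕ.* L) g rs bhg len uniq all≤ lens sums≡ Ss)

-- Row i consists of the classes i, G + i, …, (d − 1) G + i; the last class decreases in i so that all rows have the same sum.

module Rows (d g : ℕ) (1≤d : 1 ℕ.≤ d) where

  G = suc g
  D = d ℕ.* G
  top = D ℕ.+ d ℕ.* g

  last : ℕ → ℕ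
  last i = D ℕ.+ d ℕ.* (g ℕ.∸ i)

  low : ℕ → List ℕ
  low i = map (λ l → l ℕ.* G ℕ.+ i) (upTo d)

  rowAt : ℕ → Row
  rowAt i = last i , low i

  rows : List (Row)
  rows = List.applyUpTo rowAt G

  low-≤ : ∀ {i c} → i ℕ.≤ g → c ∈ low i → c ℕ.< D
  low-≤ {i} i≤g c∈ with l , l∈ , refl ← ∈-map⁻ (λ l → l ℕ.* G ℕ.+ i) c∈ =
    ℕₚ.<-≤-trans (subst (l ℕ.* G ℕ.+ i ℕ.<_) (ℕₚ.+-comm (l ℕ.* G) G) (ℕₚ.+-monoʳ-< (l ℕ.* G) (ℕ.s≤s i≤g))) (ℕₚ.*-monoˡ-≤ G (∈-upTo⁻ l∈))

  row-≤ : ∀ {i} → i ℕ.≤ g → All (ℕ._≤ top) (classes (rowAt i))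
  row-≤ {i} i≤g = ℕₚ.+-monoʳ-≤ D (ℕₚ.*-monoʳ-≤ d (ℕₚ.m∸n≤m g i)) ∷ All.tabulate (λ c∈ → ℕₚ.≤-trans (ℕₚ.<⇒≤ (low-≤ i≤g c∈)) (ℕₚ.m≤m+n D (d ℕ.* g)))

  row-unique : ∀ {i} → i ℕ.≤ g → Unique (classes (rowAt i))
  row-unique {i} i≤g = All.tabulate (λ c∈ eq → ℕₚ.<⇒≱ (low-≤ i≤g c∈) (subst (D ℕ.≤_) eq (ℕₚ.m≤m+n D (d ℕ.* (g ℕ.∸ i))))) ∷
    Unique.map⁺ (λ {l} {l′} eq → ℕₚ.*-cancelʳ-≡ l l′ G (ℕₚ.+-cancelʳ-≡ i (l ℕ.* G) (l′ ℕ.* G) eq)) (Unique.upTo⁺ d)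

  -- Last classes are at least `D` and all others are below it; those below are separated by their
  -- residue i modulo `G`. Last classes of different rows differ because d ≥ 1, which is where h ≥ 2
  -- enters.
  row-disjoint : ∀ {i j} → i ℕ.≤ g → j ℕ.≤ g → i ≢ j → ∀ {c} → c ∈ classes (rowAt i) × c ∈ classes (rowAt j) → ⊥
  row-disjoint {i} {j} i≤g j≤g i≢j (here refl , here eq) =
    i≢j (ℕₚ.∸-cancelˡ-≡ i≤g j≤g (ℕₚ.*-cancelˡ-≡ (g ℕ.∸ i) (g ℕ.∸ j) d {{ℕ.>-nonZero 1≤d}} (ℕₚ.+-cancelˡ-≡ D _ _ eq)))
  row-disjoint {i} i≤g j≤g i≢j (here refl , there c∈) = ℕₚ.<⇒≱ (low-≤ j≤g c∈) (ℕₚ.m≤m+n D (d ℕ.* (g ℕ.∸ i)))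
  row-disjoint {i} {j} i≤g j≤g i≢j (there c∈ , here refl) = ℕₚ.<⇒≱ (low-≤ i≤g c∈) (ℕₚ.m≤m+n D (d ℕ.* (g ℕ.∸ j)))
  row-disjoint {i} {j} i≤g j≤g i≢j (there c∈ , there c∈′)
    with l , _ , refl ← ∈-map⁻ (λ l → l ℕ.* G ℕ.+ i) c∈ | l′ , _ , eq ← ∈-map⁻ (λ l → l ℕ.* G ℕ.+ j) c∈′ =
    i≢j (trans (sym (residue l i i≤g)) (trans (cong (DivMod._% G) eq) (residue l′ j j≤g)))
    where
    residue : ∀ l i → i ℕ.≤ g → (l ℕ.* G ℕ.+ i) DivMod.% G ≡ i
    residue l i i≤g = trans (cong (DivMod._% G) (ℕₚ.+-comm (l ℕ.* G) i)) (trans (DivMod.[m+kn]%n≡m%n i l G) (DivMod.m<n⇒m%n≡m (ℕ.s≤s i≤g)))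

  All-rows : ∀ {P : Row → Set} → (∀ {i} → i ℕ.≤ g → P (rowAt i)) → All P rows
  All-rows p = Allₚ.applyUpTo⁺₁ rowAt G (λ i<G → p (ℕₚ.≤-pred i<G))

  rows-length : suc g ≡ length rows
  rows-length = sym (length-applyUpTo rowAt G)

  rows-lengths : All (λ r → length (proj₂ r) ≡ d) rows
  rows-lengths = All-rows (λ {i} _ → trans (length-map (λ l → l ℕ.* G ℕ.+ i) (upTo d)) (length-upTo d))

  rows-≤ : All (ℕ._≤ top) (concat (map classes rows))
  rows-≤ = Allₚ.concat⁺ (Allₚ.map⁺ {f = classes} (All-rows row-≤))

  rows-unique : Unique (concat (map classes rows))
  rows-unique = Unique.concat⁺ (Allₚ.map⁺ {f = classes} (All-rows row-unique)) (AllPairsₚ.map⁺ {f = classes} (AllPairsₚ.applyUpTo⁺₁ rowAt G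
    (λ i<j j<G → row-disjoint (ℕₚ.≤-pred (ℕₚ.<-trans i<j j<G)) (ℕₚ.≤-pred j<G) (ℕₚ.<⇒≢ i<j))))

  rowSum : ℕ
  rowSum = D ℕ.+ (sumℕ (map (ℕ._* G) (upTo d)) ℕ.+ d ℕ.* g)

  rows-sum : All (λ r → sumℕ (classes r) ≡ rowSum) rows
  rows-sum = All-rows balanced
    where
    sum-shift : ∀ i ls → sumℕ (map (λ l → l ℕ.* G ℕ.+ i) ls) ≡ sumℕ (map (ℕ._* G) ls) ℕ.+ length ls ℕ.* i
    sum-shift i [] = refl
    sum-shift i (l ∷ ls) = trans (cong (l ℕ.* G ℕ.+ i ℕ.+_) (sum-shift i ls)) (rearrange (l ℕ.* G) i (sumℕ (map (ℕ._* G) ls)) (length ls ℕ.* i))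
      where
      open ℕSolver.+-*-Solver renaming (solve to solveℕ; _:=_ to _⊜_; _:+_ to _⊕_) using ()
      rearrange : ∀ a i s k → a ℕ.+ i ℕ.+ (s ℕ.+ k) ≡ a ℕ.+ s ℕ.+ (i ℕ.+ k)
      rearrange = solveℕ 4 (λ a i s k → a ⊕ i ⊕ (s ⊕ k) ⊜ a ⊕ s ⊕ (i ⊕ k)) refl
    balanced : ∀ {i} → i ℕ.≤ g → sumℕ (classes (rowAt i)) ≡ rowSum
    balanced {i} i≤g = trans (cong (last i ℕ.+_) (trans (sum-shift i (upTo d)) (cong (λ l → S ℕ.+ l ℕ.* i) (length-upTo d))))
      (trans (rearrange D d (g ℕ.∸ i) S i) (cong (λ x → D ℕ.+ (S ℕ.+ d ℕ.* x)) (ℕₚ.m∸n+n≡m i≤g)))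
      where
      open ℕSolver.+-*-Solver renaming (solve to solveℕ; _:=_ to _⊜_; _:+_ to _⊕_; _:*_ to _⊗_) using ()
      S = sumℕ (map (ℕ._* G) (upTo d))
      rearrange : ∀ D d x S i → D ℕ.+ d ℕ.* x ℕ.+ (S ℕ.+ d ℕ.* i) ≡ D ℕ.+ (S ℕ.+ d ℕ.* (x ℕ.+ i))
      rearrange = solveℕ 5 (λ D d x S i → D ⊕ d ⊗ x ⊕ (S ⊕ d ⊗ i) ⊜ D ⊕ (S ⊕ d ⊗ (x ⊕ i))) refl

-- the dense regime

module DenseRegime (d g : ℕ) (1≤d : 1 ℕ.≤ d) where

  -- The property has bound `suc g` here, so there are g + 2 rows, one more than it allows.
  open Rows d (suc g) 1≤d

  -- Quotients reach at most L + d L = h L, so a coordinate is below (h L + 1)(top + 1). This is at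
  -- most L W when L ≥ 1, and L W ≤ n keeps every slot inside the ground set.
  h W : ℕ
  h = suc d
  W = suc h ℕ.* suc top

  failureConstant : ℚ
  failureConstant = variance-factor (growth d) (length rows)

  probBhg-≤ : ∀ {n k p q L t} → Scaled n k p q → 1 ℕ.≤ L → L ℕ.* W ℕ.≤ n → 0ℚ ≤ t → t ≤ 1ℚ →
    let z = ℕ→ℚ L * p in
    1ℚ ≤ z * t → 1ℚ ≤ ℕ→ℚ L * t → 1ℚ ≤ ℕ→ℚ L * (p * z ^ℚ d) ^ℚ length rows * t → probBhg h (suc g) n p ≤ failureConstant * t
  probBhg-≤ {n} {k} {p} {q} {L} {t} S 1≤L LW≤n 0≤t t≤1 1≤zt 1≤Lt 1≤mt = subst (_≤ failureConstant * t) (sym (probBhg≡E h (suc g) n p))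
    (chebyshev P {m} {failureConstant * t} (λ A → 𝟙 (does (isBhg? h (suc g) n A))) (λ A → structured A rows) vanish EX
      (≤-trans (E-structured² d rows rows-unique rows-≤ rows-lengths)
        (second-moment-≤ (length rows) (0≤ℕ→ℚ L) (0≤α d) (0≤μ d) (0≤growth d) 0≤t t≤1 (α-≤ top L {n} P 0≤t t≤1 1≤zt d) 1≤Lt 1≤mt))
      (0<* 0<m 0<m))
    where
    P = Scaled.isProb S
    open Slots top L
    open Moments {n} P using (μ; E-structured)
    open CorrelationBound top L {n} P using (E-structured²; 0≤α; 0≤μ)
    m : ℚ
    m = ℕ→ℚ L * μ d ^ℚ length rows
    0<m : 0ℚ < m
    0<m = ≰⇒> (λ m≤0 → <-irrefl refl (<-≤-trans 0<1 (≤-trans 1≤mt (≤-trans (*-monoʳ 0≤t m≤0) (≤-reflexive (*-zeroˡ t))))))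
    inRange : ∀ {c y} → c ℕ.≤ top → y ℕ.≤ L ℕ.+ d ℕ.* L → slot c y ℕ.< n
    inRange {c} {y} c≤ y≤ = ℕₚ.<-≤-trans (ℕₚ.+-mono-<-≤ (ℕ.s≤s c≤) (ℕₚ.*-monoˡ-≤ (suc top) y≤))
      (ℕₚ.≤-trans (subst (ℕ._≤ L ℕ.* W) (cong (ℕ._+ h ℕ.* L ℕ.* suc top) (ℕₚ.*-identityˡ (suc top)))
        (subst (1 ℕ.* suc top ℕ.+ h ℕ.* L ℕ.* suc top ℕ.≤_) (rearrange L h (suc top)) (ℕₚ.+-monoˡ-≤ (h ℕ.* L ℕ.* suc top) (ℕₚ.*-monoˡ-≤ (suc top) 1≤L)))) LW≤n)
      where
      rearrange : ∀ L h m → L ℕ.* m ℕ.+ h ℕ.* L ℕ.* m ≡ L ℕ.* (suc h ℕ.* m)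
      rearrange = solveℕ 3 (λ L h m → L ⊗ m ⊕ h ⊗ L ⊗ m ⊜ L ⊗ ((conℕ 1 ⊕ h) ⊗ m)) refl
        where open ℕSolver.+-*-Solver renaming (solve to solveℕ; _:=_ to _⊜_; _:+_ to _⊕_; _:*_ to _⊗_; con to conℕ) using ()
    EX : E {n} p (λ A → structured A rows) ≡ m
    EX = E-structured inRange (ℕₚ.m≤m+n L (d ℕ.* L)) d rows rows-unique rows-≤ rows-lengths ℕₚ.≤-refl
    vanish : ∀ A → (𝟙 (does (isBhg? h (suc g) n A)) ≡ 0ℚ) ⊎ (𝟙 (does (isBhg? h (suc g) n A)) ≡ 1ℚ × structured A rows ≡ 0ℚ)
    vanish A = cases (isBhg? h (suc g) n A)
      where
      cases : (b : Dec (IsBhg h (suc g) n A)) → (𝟙 (does b) ≡ 0ℚ) ⊎ (𝟙 (does b) ≡ 1ℚ × structured A rows ≡ 0ℚ)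
      cases (no _) = inj₁ refl
      cases (yes bhg) = inj₂ (refl , structured-vanishes top L A d (suc g) rowSum rows bhg rows-length rows-unique rows-≤ rows-lengths rows-sum)

  -- With L = n / W and n ≥ W the remainder is at most L W, so n ≤ 2 W L = c L.
  c : ℚ
  c = ℕ→ℚ (W ℕ.+ W)

  0<c : 0ℚ < c
  0<c = 0<ℕ→ℚ-suc (ℕ.pred (W ℕ.+ W))

  -- With R = g + 2 rows the mean is, up to powers of c, n (k^h / n)^R = k^(h R) / n^(g+1), exactly
  -- the ratio in the hypothesis on k. Replacing n by c L costs one factor c, and replacing k by c z
  -- in d places of each row costs c^(d R); together they form the power of c that ties η to t.
  mean-large : ∀ {n k p q L t η} → Scaled n k p q → 0ℚ ≤ k → 0ℚ ≤ η → ℕ→ℚ n ≤ c * ℕ→ℚ L →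
    c ^ℚ suc (d ℕ.* suc (suc g)) * η ≡ t → ℕ→ℚ n ^ℚ suc g ≤ η * k ^ℚ (h ℕ.* (suc g ℕ.+ 1)) →
    k ≤ c * (ℕ→ℚ L * p) → 1ℚ ≤ ℕ→ℚ L * (p * (ℕ→ℚ L * p) ^ℚ d) ^ℚ suc (suc g) * t
  mean-large {n} {k} {p} {q} {L} {t} {η} S 0≤k 0≤η n≤cL cη≡t dense k≤cz = begin
    1ℚ ≡⟨ nq^≡1 S R ⟨
    N ^ℚ R * q ^ℚ R ≡⟨ solve 3 (λ N x y → N :* x :* y := x :* (N :* y)) refl N (N ^ℚ suc g) (q ^ℚ R) ⟩
    N ^ℚ suc g * (N * q ^ℚ R) ≤⟨ *-monoʳ (0≤* (0≤ℕ→ℚ n) (0≤^ R 0≤q)) dense ⟩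
    η * k ^ℚ (h ℕ.* (suc g ℕ.+ 1)) * (N * q ^ℚ R) ≡⟨ cong (λ x → η * x * (N * q ^ℚ R)) (trans (cong (λ e → k ^ℚ (h ℕ.* e)) (ℕₚ.+-comm (suc g) 1)) (^-* k h R)) ⟩
    η * (k ^ℚ h) ^ℚ R * (N * q ^ℚ R) ≡⟨ solve 4 (λ e x N y → e :* x :* (N :* y) := N :* (x :* y) :* e) refl η ((k ^ℚ h) ^ℚ R) N (q ^ℚ R) ⟩
    N * ((k ^ℚ h) ^ℚ R * q ^ℚ R) * η ≡⟨ cong (λ x → N * x * η) (sym (^-distrib-* (k ^ℚ h) q R)) ⟩
    N * (k ^ℚ h * q) ^ℚ R * η ≡⟨ cong (λ x → N * x ^ℚ R * η) (trans (solve 3 (λ k x q → k :* x :* q := (k :* q) :* x) refl k (k ^ℚ d) q) (cong (_* k ^ℚ d) (sym p≡kq))) ⟩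
    N * (p * k ^ℚ d) ^ℚ R * η
      ≤⟨ *-monoʳ 0≤η (*-mono (0≤ℕ→ℚ n) (0≤^ R (0≤* p≥0 (0≤^ d 0≤k))) n≤cL (^-mono R (0≤* p≥0 (0≤^ d 0≤k)) (*-monoˡ p≥0 (^-mono d 0≤k k≤cz)))) ⟩
    c * ℓ * (p * (c * z) ^ℚ d) ^ℚ R * η ≡⟨ cong (λ x → c * ℓ * x * η) powers ⟩
    c * ℓ * (c ^ℚ (d ℕ.* R) * (p * z ^ℚ d) ^ℚ R) * η
      ≡⟨ solve 5 (λ c l C x e → c :* l :* (C :* x) :* e := l :* x :* ((c :* C) :* e)) refl c ℓ (c ^ℚ (d ℕ.* R)) ((p * z ^ℚ d) ^ℚ R) η ⟩
    ℓ * (p * z ^ℚ d) ^ℚ R * (c ^ℚ suc (d ℕ.* R) * η) ≡⟨ cong (ℓ * (p * z ^ℚ d) ^ℚ R *_) cη≡t ⟩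
    ℓ * (p * z ^ℚ d) ^ℚ R * t ∎
    where
    open ≤-Reasoning
    open Scaled S
    R : ℕ
    R = suc (suc g)
    N ℓ z : ℚ
    N = ℕ→ℚ n
    ℓ = ℕ→ℚ L
    z = ℓ * p
    p≥0 : 0ℚ ≤ p
    p≥0 = Probability.0≤p isProb
    powers : (p * (c * z) ^ℚ d) ^ℚ R ≡ c ^ℚ (d ℕ.* R) * (p * z ^ℚ d) ^ℚ R
    powers = trans (cong (_^ℚ R) (trans (cong (p *_) (^-distrib-* c z d)) (solve 3 (λ p x y → p :* (x :* y) := x :* (p :* y)) refl p (c ^ℚ d) (z ^ℚ d))))
      (trans (^-distrib-* (c ^ℚ d) (p * z ^ℚ d) R) (cong (_* (p * z ^ℚ d) ^ℚ R) (sym (^-* c d R))))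

  module _ (k : ℕ → ℚ) (bounds : ∀ n → (0ℚ ≤ k n) × (k n ≤ ℕ→ℚ n))
    (dense : ∀ ε → 0ℚ < ε → Eventually (λ n → (ℕ→ℚ n ^ℚ suc g) ≤ ε * (k n ^ℚ (h ℕ.* (suc g ℕ.+ 1))))) where

    k-large : ∀ B → Eventually (λ n → B ≤ k n)
    k-large B = Eventually-map
      -- The exponent passed here is the predecessor of h (g + 2), with h = d + 1 unfolded.
      (λ n (lo , hi) → ^-cancel-≤ {B} {k n} (g ℕ.+ 1 ℕ.+ d ℕ.* suc (g ℕ.+ 1)) (proj₁ (bounds n)) (≤-trans lo (≤-trans (≤-reflexive (*-identityˡ (ℕ→ℚ n ^ℚ suc g))) (≤-trans hi (≤-reflexive (*-identityˡ (k n ^ℚ (h ℕ.* (suc g ℕ.+ 1)))))))))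
      (Eventually-× (eventually-large g 0<1 (B ^ℚ (h ℕ.* (suc g ℕ.+ 1)))) (dense 1ℚ 0<1))

    -- The threshold B is c / t, so that B ≤ k together with k ≤ c z gives 1 ≤ z t; likewise c ≤ t n
    -- together with n ≤ c L gives 1 ≤ L t.
    probBhg-≤-t : ∀ {t η B} → 0ℚ < t → t ≤ 1ℚ → 0ℚ < η → c ^ℚ suc (d ℕ.* suc (suc g)) * η ≡ t → t * B ≡ c → ∀ n → n ≥ W →
      ℕ→ℚ n ^ℚ suc g ≤ η * (k n ^ℚ (h ℕ.* (suc g ℕ.+ 1))) → B ≤ k n → c ≤ t * ℕ→ℚ n ^ℚ 1 →
      probBhg h (suc g) n (pOf n (k n)) ≤ failureConstant * t
    probBhg-≤-t {t} {η} {B} 0<t t≤1 0<η cη≡t tB≡c n n≥W dense-n B≤k c≤tn =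
      probBhg-≤ {n} {k n} {p} {qOf n} {L} {t} S 1≤L (DivMod.m/n*n≤m n W) 0≤t t≤1 1≤zt 1≤Lt
        (subst (λ e → 1ℚ ≤ ℕ→ℚ L * (p * z ^ℚ d) ^ℚ e * t) rows-length (mean-large {n} {k n} {p} {qOf n} {L} {t} {η} S 0≤k (<⇒≤ 0<η) n≤cL cη≡t dense-n k≤cz))
      where
      open ≤-Reasoning
      L = n DivMod./ W
      p z : ℚ
      p = pOf n (k n)
      z = ℕ→ℚ L * p
      0≤k = proj₁ (bounds n)
      0≤t : 0ℚ ≤ t
      0≤t = <⇒≤ 0<t
      1≤L : 1 ℕ.≤ L
      1≤L = DivMod.m≥n⇒m/n>0 n≥W
      S : Scaled n (k n) p (qOf n)
      S = pOf-scaled n (k n) 0≤k (proj₂ (bounds n)) (ℕₚ.≤-trans (ℕ.s≤s ℕ.z≤n) n≥W)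
      open Scaled S
      n≤[W+W]L : n ℕ.≤ (W ℕ.+ W) ℕ.* L
      n≤[W+W]L = subst (ℕ._≤ (W ℕ.+ W) ℕ.* L) (sym (DivMod.m≡m%n+[m/n]*n n W))
        (subst (n DivMod.% W ℕ.+ L ℕ.* W ℕ.≤_) (sym (trans (ℕₚ.*-distribʳ-+ L W W) (cong (W ℕ.* L ℕ.+_) (ℕₚ.*-comm W L))))
          (ℕₚ.+-monoˡ-≤ (L ℕ.* W) (ℕₚ.≤-trans (ℕₚ.<⇒≤ (DivMod.m%n<n n W)) (ℕₚ.m≤m*n W L {{ℕ.>-nonZero 1≤L}}))))
      n≤cL : ℕ→ℚ n ≤ c * ℕ→ℚ L
      n≤cL = subst (ℕ→ℚ n ≤_) (ℕ→ℚ-* (W ℕ.+ W) L) (ℕ→ℚ-mono n≤[W+W]L)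
      k≤cz : k n ≤ c * z
      k≤cz = begin
        k n ≡⟨ trans (sym (*-identityʳ (k n))) (cong (k n *_) (sym nq≡1)) ⟩
        k n * (ℕ→ℚ n * qOf n) ≡⟨ trans (solve 3 (λ k N q → k :* (N :* q) := N :* (k :* q)) refl (k n) (ℕ→ℚ n) (qOf n)) (cong (ℕ→ℚ n *_) (sym p≡kq)) ⟩
        ℕ→ℚ n * p ≤⟨ *-monoʳ (Probability.0≤p isProb) n≤cL ⟩
        c * ℕ→ℚ L * p ≡⟨ *-assoc c (ℕ→ℚ L) p ⟩
        c * z ∎
      1≤Lt : 1ℚ ≤ ℕ→ℚ L * t
      1≤Lt = *-cancelʳ {1ℚ} {ℕ→ℚ L * t} {c} 0<c (begin
        1ℚ * c ≡⟨ *-identityˡ c ⟩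
        c ≤⟨ c≤tn ⟩
        t * (ℕ→ℚ n * 1ℚ) ≡⟨ cong (t *_) (*-identityʳ (ℕ→ℚ n)) ⟩
        t * ℕ→ℚ n ≤⟨ *-monoˡ 0≤t n≤cL ⟩
        t * (c * ℕ→ℚ L) ≡⟨ solve 3 (λ t c l → t :* (c :* l) := l :* t :* c) refl t c (ℕ→ℚ L) ⟩
        ℕ→ℚ L * t * c ∎)
      1≤zt : 1ℚ ≤ z * t
      1≤zt = *-cancelʳ {1ℚ} {z * t} {c} 0<c (begin
        1ℚ * c ≡⟨ *-identityˡ c ⟩
        c ≡⟨ tB≡c ⟨
        t * B ≤⟨ *-monoˡ 0≤t (≤-trans B≤k k≤cz) ⟩
        t * (c * z) ≡⟨ solve 3 (λ t c z → t :* (c :* z) := z :* t :* c) refl t c z ⟩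
        z * t * c ∎)

    0≤failureConstant : 0ℚ ≤ failureConstant
    0≤failureConstant = 0≤+ (0≤bernoulli (length rows) (0≤growth d))
      (0≤* (0≤^ (length rows) 0≤two) (0≤+ (0≤^ (length rows) (0≤+ 0≤1 (0≤growth d))) 0≤1))

    success-small : Small (λ n → probBhg h (suc g) n (pOf n (k n)))
    success-small ε 0<ε =
      -- Adding 1 makes the constant positive, so that ε can be divided by it.
      let K = 1ℚ + failureConstant
          0<K = <-≤-trans 0<1 (a≤a+b {1ℚ} {failureConstant} 0≤failureConstant)
          δ , 0<δ , Kδ≡ε = split-ε {ε} {K} 0<ε 0<K
          t , 0<t , t≤1 , t≤δ = capped 0<δ
          -- The tolerance requested from the hypothesis on k is t divided by the power of c that
          -- `mean-large` loses.
          η , 0<η , cη≡t = split-ε {t} {c ^ℚ suc (d ℕ.* suc (suc g))} 0<t (0<^ (suc (d ℕ.* suc (suc g))) 0<c)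
          B , _ , tB≡c = split-ε {c} {t} 0<c 0<t
      in Eventually-map
           (λ n (n≥W , dense-n , B≤k , c≤tn) → ≤-trans (probBhg-≤-t 0<t t≤1 0<η cη≡t tB≡c n n≥W dense-n B≤k c≤tn)
             (≤-trans (*-mono {failureConstant} {K} {t} {δ} 0≤failureConstant (<⇒≤ 0<t) (b≤a+b 0≤1) t≤δ) (≤-reflexive Kδ≡ε)))
           (Eventually-× (W , λ n n≥W → n≥W) (Eventually-× (dense η 0<η) (Eventually-× (k-large B) (eventually-large 0 0<t c))))

theorem3p4 : (h g : ℕ) → h ≥ 2 → g ≥ 1 → (k : ℕ → ℚ)
    → (∀ n → (0ℚ ≤ k n) × (k n ≤ ℕ→ℚ n))
    → ((∀ ε → 0ℚ < ε → ∃[ N ] (∀ n → n ≥ N → (k n ^ℚ (h Data.Nat.* (g Data.Nat.+ 1))) ≤ ε * (ℕ→ℚ n ^ℚ g)))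
    → ∀ ε → 0ℚ < ε → ∃[ N ] (∀ n → n ≥ N → 1ℚ - probBhg h g n (pOf n (k n)) ≤ ε))
    × ((∀ ε → 0ℚ < ε → ∃[ N ] (∀ n → n ≥ N → (ℕ→ℚ n ^ℚ g) ≤ ε * (k n ^ℚ (h Data.Nat.* (g Data.Nat.+ 1)))))
    → ∀ ε → 0ℚ < ε → ∃[ N ] (∀ n → n ≥ N → probBhg h g n (pOf n (k n)) ≤ ε))
theorem3p4 (suc (suc d)) (suc g) (ℕ.s≤s (ℕ.s≤s _)) (ℕ.s≤s _) k bounds =
  failure-small (suc (suc d)) g k bounds (ℕ.s≤s ℕ.z≤n) ,
  DenseRegime.success-small (suc d) g (ℕ.s≤s ℕ.z≤n) k bounds
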